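{- Let $n\ge 4$ and let $T_n\in\mathfrak{T}_n$ be a triangular chain with length vector $(l_1,\dots,l_s)$. Let $TI$ be a bond incident degree index with edge weights $\theta_{a,b}$. Put \[\Lambda_{0}=2n\theta_{4,4}+2\theta_{2,3}+2\theta_{2,4}+2\theta_{3,4}-\theta_{3,5}-4\theta_{4,5},\] \[\Lambda_{1}=\theta_{2,5}-\theta_{2,4}+\theta_{3,3}-3\theta_{3,4}+\theta_{3,5}+3\theta_{4,4}-2\theta_{4,5},\] \[\Lambda_{2}=\theta_{3,5}-\theta_{3,4}+\theta_{4,4}-\theta_{4,5},\qquad \Lambda_{3}=2\theta_{3,4}+\theta_{3,5}-7\theta_{4,4}+4\theta_{4,5},\] \[\Lambda_{4}=2\theta_{3,5}-2\theta_{3,4}+3\theta_{4,4}-4\theta_{4,5}+\theta_{5,5},\qquad \Lambda_{5}=\theta_{4,4}-2\theta_{4,5}+\theta_{5,5}.\] Then \[TI(T_{n})= \begin{cases} \Lambda_{0}+\Lambda_{3} & \text{if } s=1,\\ \Lambda_{0}+\Lambda_{1}(\eta_{1}+\eta_{2})+\Lambda_{2}(\xi_{1}+\xi_{2})+2\Lambda_{3} & \text{if } s=2,\\ \Lambda_{0}+\Lambda_{1}(\eta_{1}+\eta_{s})+\Lambda_{2}(\xi_{1}+\xi_{s})+s\Lambda_{3}+\Lambda_{4}\sum_{i=2}^{s-1}\xi_{i}+\Lambda_{5}\sum_{i=2}^{s-1}\sigma_{i} & \text{if } s\ge 3. \end{cases}\]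
   Context: A triangular chain is a plane figure obtained by concatenating congruent equilateral triangles side to side so that every bounded (internal) region is one of these triangles, and whose characteristic graph (vertices = the triangles, two triangles adjacent iff they share a side) is a path; it is regarded as the simple graph whose vertices are the corner points of the triangles and whose edges are the sides of the triangles. A triangle is terminal if it shares a side with exactly one other triangle. A linear triangular chain is a triangular chain in which every vertex has degree at most 4. A segment of a triangular chain $T$ is a part of $T$ forming an induced subgraph which is a maximal linear triangular chain contained in $T$; a segment is terminal if it contains a terminal triangle. The length of a segment is its number of triangles. If $T$ has segments $S_1,\dots,S_s$, listed in order along the chain (so that for $s\ge 2$ the segments $S_1,S_s$ are the terminal ones), with lengths $l_i=$ length of $S_i$, then $(l_1,\dots,l_s)$ is the length vector of $T$. For $n\ge4$, $\mathfrak{T}_n$ is the set of triangular chains with $n$ triangles in which every vertex has degree at most 5. For $1\le i\le s$: $\eta_i=1$ if $l_i=3$ and $0$ otherwise; $\xi_i=1$ if $l_i=4$ and $0$ otherwise; $\sigma_i=1$ if $l_i=5$ and $0$ otherwise. A bond incident degree (BID) index is $TI(G)=\sum_{uv\in E(G)}\theta_{d_u,d_v}$, where $d_u$ is the degree of vertex $u$ and $\theta_{a,b}=\theta_{b,a}$ is a non-negative real number depending on $a,b$. -}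

module Defs where

open import Algebra.Bundles.Raw using (RawMonoid)
open import Data.Bool.Base using (if_then_else_)
open import Data.Fin.Base using (Fin; toℕ)
open import Data.Integer.Base as ℤ using (ℤ; 1ℤ)
import Data.Integer.Properties as ℤ
open import Data.List.Base using (List; []; _∷_; length; lookup; map; concatMap; deduplicate; filter; foldr)
open import Data.List.Membership.Propositional using (_∈_; _∉_)
open import Data.List.Relation.Binary.Sublist.Propositional using (_⊆_)
open import Data.List.Relation.Unary.AllPairs using (AllPairs)
open import Data.List.Relation.Unary.Unique.Propositional using (Unique)
open import Data.Nat.Base as ℕ using (ℕ; suc)
import Data.Nat.Properties as ℕ
open import Data.Product.Base using (∃; ∃₂; _×_; _,_; proj₁; proj₂)
open import Data.Product.Properties using (≡-dec)
open import Data.Rational.Base as ℚ using (ℚ; 0ℚ; ½)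
import Data.Rational.Properties as ℚ
open import Data.Rational.Solver using (module +-*-Solver)
open import Data.Sum.Base using (_⊎_)
open import Data.Vec.Base as Vec using (Vec; []; _∷_)
open import Function.Bundles using (_⇔_)
open import Level using (0ℓ)
open import Relation.Binary.Construct.Closure.ReflexiveTransitive using (Star)
open import Relation.Binary.Definitions using (DecidableEquality)
open import Relation.Binary.PropositionalEquality using (_≡_; _≢_; refl; sym; trans; cong; subst; subst₂)
open import Relation.Nullary.Decidable using (_⊎-dec_)

-- Real numbers are Cauchy sequences of rationals, with _≈_ as equality.

IsCauchy : (ℕ → ℚ) → Set
IsCauchy x = ∀ ε → 0ℚ ℚ.< ε →
  ∃ λ N → ∀ m n → N ℕ.≤ m → N ℕ.≤ n → ℚ.∣ x m ℚ.- x n ∣ ℚ.< ε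

record ℝ : Set where
  constructor mkℝ
  field
    seq    : ℕ → ℚ
    cauchy : IsCauchy seq

open ℝ public

infix 4 _≈_
_≈_ : ℝ → ℝ → Set
x ≈ y = ∀ ε → 0ℚ ℚ.< ε →
  ∃ λ N → ∀ n → N ℕ.≤ n → ℚ.∣ seq x n ℚ.- seq y n ∣ ℚ.< ε

NonNegative : ℝ → Set
NonNegative x = ∀ ε → 0ℚ ℚ.< ε →
  ∃ λ N → ∀ n → N ℕ.≤ n → ℚ.- ε ℚ.< seq x n

private
  open +-*-Solver

  0<½*ε : ∀ {ε} → 0ℚ ℚ.< ε → 0ℚ ℚ.< ½ ℚ.* ε
  0<½*ε {ε} 0<ε = subst (ℚ._< ½ ℚ.* ε) (ℚ.*-zeroʳ ½) (ℚ.*-monoʳ-<-pos ½ 0<ε)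

  ½*ε+½*ε≡ε : ∀ ε → ½ ℚ.* ε ℚ.+ ½ ℚ.* ε ≡ ε
  ½*ε+½*ε≡ε ε = trans (sym (ℚ.*-distribʳ-+ ε ½ ½)) (ℚ.*-identityˡ ε)

  +-interchange-minus : ∀ a b c d →
    (a ℚ.+ b) ℚ.- (c ℚ.+ d) ≡ (a ℚ.- c) ℚ.+ (b ℚ.- d)
  +-interchange-minus = solve 4
    (λ a b c d → (a :+ b) :- (c :+ d) := (a :- c) :+ (b :- d)) refl

  neg-minus : ∀ a b → (ℚ.- a) ℚ.- (ℚ.- b) ≡ ℚ.- (a ℚ.- b)
  neg-minus = solve 2 (λ a b → (:- a) :- (:- b) := :- (a :- b)) refl

0ℝ : ℝ
0ℝ = mkℝ (λ _ → 0ℚ) (λ _ 0<ε → 0 , λ _ _ _ _ → 0<ε)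

infixl 6 _+_ _-_
infix  8 -_

_+_ : ℝ → ℝ → ℝ
x + y = mkℝ (λ n → seq x n ℚ.+ seq y n) λ ε 0<ε →
  let N , p = cauchy x (½ ℚ.* ε) (0<½*ε 0<ε)
      M , q = cauchy y (½ ℚ.* ε) (0<½*ε 0<ε)
  in N ℕ.⊔ M , λ m n N⊔M≤m N⊔M≤n → subst₂ ℚ._<_
       (cong ℚ.∣_∣ (sym (+-interchange-minus (seq x m) (seq y m) (seq x n) (seq y n))))
       (½*ε+½*ε≡ε ε)
       (ℚ.≤-<-trans (ℚ.∣p+q∣≤∣p∣+∣q∣ (seq x m ℚ.- seq x n) (seq y m ℚ.- seq y n))
         (ℚ.+-mono-<
           (p m n (ℕ.m⊔n≤o⇒m≤o N M N⊔M≤m) (ℕ.m⊔n≤o⇒m≤o N M N⊔M≤n))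
           (q m n (ℕ.m⊔n≤o⇒n≤o N M N⊔M≤m) (ℕ.m⊔n≤o⇒n≤o N M N⊔M≤n))))

-_ : ℝ → ℝ
- x = mkℝ (λ n → ℚ.- seq x n) λ ε 0<ε →
  let N , p = cauchy x ε 0<ε
  in N , λ m n N≤m N≤n → subst (ℚ._< ε)
       (trans (sym (ℚ.∣-p∣≡∣p∣ (seq x m ℚ.- seq x n)))
              (cong ℚ.∣_∣ (sym (neg-minus (seq x m) (seq x n)))))
       (p m n N≤m N≤n)

_-_ : ℝ → ℝ → ℝ
x - y = x + (- y)

+-rawMonoid : RawMonoid 0ℓ 0ℓ
+-rawMonoid = record { Carrier = ℝ ; _≈_ = _≈_ ; _∙_ = _+_ ; ε = 0ℝ }

-- k · x is the natural multiple x + … + x.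
open import Algebra.Definitions.RawMonoid +-rawMonoid public using () renaming (_×_ to infixr 7 _·_)

sumℝ : List ℝ → ℝ
sumℝ = foldr _+_ 0ℝ

-- (a , b) stands for the point a e₁ + b e₂, where
-- e₁ and e₂ are unit vectors at an angle of 60°.  Congruent equilateral
-- triangles glued side to side are, up to similarity, cells of this lattice.

Point : Set
Point = ℤ × ℤ

_≟ₚ_ : DecidableEquality Point
_≟ₚ_ = ≡-dec ℤ._≟_ ℤ._≟_

-- △ p has corners p, p + e₁, p + e₂;
-- ▽ p has corners p + e₁, p + e₂, p + e₁ + e₂.
data Cell : Set where
  △ ▽ : Point → Cell

anchor : Cell → Point
anchor (△ p) = p
anchor (▽ p) = p

corners : Cell → List Point
corners (△ (a , b)) = (a , b) ∷ (1ℤ ℤ.+ a , b) ∷ (a , 1ℤ ℤ.+ b) ∷ []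
corners (▽ (a , b)) = (1ℤ ℤ.+ a , b) ∷ (a , 1ℤ ℤ.+ b) ∷ (1ℤ ℤ.+ a , 1ℤ ℤ.+ b) ∷ []

-- A unit segment of the lattice, as the pair of its end points (u , v) in
-- the order for which v - u is e₁, e₂ or e₂ - e₁; thus equal unordered
-- pairs are represented by equal ordered pairs.
Side : Set
Side = Point × Point

_≟ₛ_ : DecidableEquality Side
_≟ₛ_ = ≡-dec _≟ₚ_ _≟ₚ_

sides : Cell → List Side
sides (△ (a , b)) = ((a , b) , (1ℤ ℤ.+ a , b))
                  ∷ ((a , b) , (a , 1ℤ ℤ.+ b))
                  ∷ ((1ℤ ℤ.+ a , b) , (a , 1ℤ ℤ.+ b)) ∷ []
sides (▽ (a , b)) = ((a , 1ℤ ℤ.+ b) , (1ℤ ℤ.+ a , 1ℤ ℤ.+ b))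
                  ∷ ((1ℤ ℤ.+ a , b) , (1ℤ ℤ.+ a , 1ℤ ℤ.+ b))
                  ∷ ((1ℤ ℤ.+ a , b) , (a , 1ℤ ℤ.+ b)) ∷ []

vertices : List Cell → List Point
vertices ts = deduplicate _≟ₚ_ (concatMap corners ts)

edges : List Cell → List Side
edges ts = deduplicate _≟ₛ_ (concatMap sides ts)

degree : List Cell → Point → ℕ
degree ts u =
  length (filter (λ e → (u ≟ₚ proj₁ e) ⊎-dec (u ≟ₚ proj₂ e)) (edges ts))

MaxDegree≤ : ℕ → List Cell → Set
MaxDegree≤ k ts = ∀ u → u ∈ vertices ts → degree ts u ℕ.≤ k

record IsBIDWeight (θ : ℕ → ℕ → ℝ) : Set where
  field
    symmetric   : ∀ a b → θ a b ≈ θ b a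
    nonNegative : ∀ a b → NonNegative (θ a b)

TI : (ℕ → ℕ → ℝ) → List Cell → ℝ
TI θ ts = sumℝ (map (λ (u , v) → θ (degree ts u) (degree ts v)) (edges ts))

-- The triangles of a chain are listed in the order in which they
-- occur along the characteristic graph.

SharesSide : Cell → Cell → Set
SharesSide c d = c ≢ d × ∃ λ e → e ∈ sides c × e ∈ sides d

Consecutive : ∀ {n} → Fin n → Fin n → Set
Consecutive i j = suc (toℕ i) ≡ toℕ j ⊎ suc (toℕ j) ≡ toℕ i

-- The regions into which the drawing of ts divides the plane are the
-- connected components of the set of all lattice cells, two cells being
-- joined when they have a common side that is not an edge of the drawing.
Step : List Cell → Cell → Cell → Set
Step ts c d = ∃ λ e → e ∈ sides c × e ∈ sides d × e ∉ edges ts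

Region : List Cell → Cell → Cell → Set
Region ts = Star (Step ts)

Bounded : (Cell → Set) → Set
Bounded R = ∃ λ N → ∀ c → R c →
  ℤ.∣ proj₁ (anchor c) ∣ ℕ.≤ N × ℤ.∣ proj₂ (anchor c) ∣ ℕ.≤ N

-- All sides of a cell of ts are drawn, so its region is that cell alone;
-- hence `regions` says that every bounded region is one of the triangles.
record TriangularChain (ts : List Cell) : Set where
  field
    distinct : Unique ts
    path     : ∀ i j → SharesSide (lookup ts i) (lookup ts j) ⇔ Consecutive i j
    regions  : ∀ c → Bounded (Region ts c) → c ∈ ts

record _∈𝔗_ (ts : List Cell) (n : ℕ) : Set where
  field
    chain     : TriangularChain ts
    size      : length ts ≡ n
    maxDegree : MaxDegree≤ 5 ts

LinearChain : List Cell → Set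
LinearChain ts = TriangularChain ts × MaxDegree≤ 4 ts

-- Parts of a chain are order-preserving sublists of its list of triangles.

record Segment (ts S : List Cell) : Set where
  field
    part    : S ⊆ ts
    linear  : LinearChain S
    induced : ∀ {u v} → (u , v) ∈ edges ts →
              u ∈ vertices S → v ∈ vertices S → (u , v) ∈ edges S
    maximal : ∀ S′ → S′ ⊆ ts → LinearChain S′ → S ⊆ S′ → S′ ≡ S

-- The first triangle of S occurs strictly before that of S′ along ts.
Precedes : (ts S S′ : List Cell) → Set
Precedes ts S S′ = ∃₂ λ c d → ∃₂ λ cs ds →
  S ≡ c ∷ cs × S′ ≡ d ∷ ds × (c ∷ d ∷ []) ⊆ ts

record LengthVector (ts : List Cell) {s : ℕ} (l : Vec ℕ s) : Set where
  field
    segments : Vec (List Cell) s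
    complete : ∀ S → S ∈ Vec.toList segments ⇔ Segment ts S
    ordered  : AllPairs (Precedes ts) (Vec.toList segments)
    lengths  : l ≡ Vec.map length segments

indicator : ℕ → ℕ → ℕ
indicator k l = if l ℕ.≡ᵇ k then 1 else 0

η ξ σ : ℕ → ℕ
η = indicator 3
ξ = indicator 4
σ = indicator 5

module Formula (θ : ℕ → ℕ → ℝ) (n : ℕ) where

  Λ₀ Λ₁ Λ₂ Λ₃ Λ₄ Λ₅ : ℝ
  Λ₀ = (2 ℕ.* n) · θ 4 4 + 2 · θ 2 3 + 2 · θ 2 4 + 2 · θ 3 4 - θ 3 5 - 4 · θ 4 5
  Λ₁ = θ 2 5 - θ 2 4 + θ 3 3 - 3 · θ 3 4 + θ 3 5 + 3 · θ 4 4 - 2 · θ 4 5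
  Λ₂ = θ 3 5 - θ 3 4 + θ 4 4 - θ 4 5
  Λ₃ = 2 · θ 3 4 + θ 3 5 - 7 · θ 4 4 + 4 · θ 4 5
  Λ₄ = 2 · θ 3 5 - 2 · θ 3 4 + 3 · θ 4 4 - 4 · θ 4 5 + θ 5 5
  Λ₅ = θ 4 4 - 2 · θ 4 5 + θ 5 5

  -- The argument is the length vector (l₁ , … , lₛ) with s = suc k.
  value : ∀ {k} → Vec ℕ (suc k) → ℝ
  value (l₁ ∷ []) = Λ₀ + Λ₃
  value (l₁ ∷ l₂ ∷ []) =
    Λ₀ + (η l₁ ℕ.+ η l₂) · Λ₁ + (ξ l₁ ℕ.+ ξ l₂) · Λ₂ + 2 · Λ₃
  value {k} (l₁ ∷ ls@(_ ∷ _ ∷ _)) =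
    Λ₀ + (η l₁ ℕ.+ η lₛ) · Λ₁ + (ξ l₁ ℕ.+ ξ lₛ) · Λ₂ + suc k · Λ₃
       + Vec.sum (Vec.map ξ inner) · Λ₄ + Vec.sum (Vec.map σ inner) · Λ₅
    where
    lₛ    = Vec.last ls
    inner = Vec.init ls

{-# OPTIONS --safe #-}
-- A chain is coded by its first cell, the side through which it is left, and a
-- word of left and right turns.  The two hands of its border are lattice walks;
-- if the chain returned to an earlier vertex they would close up to two loops,
-- and since modulo 2 these loops together bound the cells of the chain, one of
-- them would wind around a cell outside the chain, which would then lie in a
-- bounded region.  Hence all vertices are distinct and every degree can be read
-- off the word: a vertex has degree one more than the number of consecutive
-- cells around it.  Segments are the maximal alternating stretches of the word,
-- and the index is summed stretch by stretch, which only needs the stretches of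
-- length at most three to be treated separately.
module Submission where

import Defs as D
open import Defs hiding (_+_; _-_; -_; _·_)
open import Algebra.Bundles using (CommutativeMonoid; CommutativeRing)
import Algebra.Properties.CommutativeSemigroup as CommutativeSemigroupProperties
open import Data.Bool.Base as Bool using (Bool; true; false; _∧_; _xor_; not; if_then_else_)
open import Data.Bool.Properties using (xor-comm; xor-assoc; xor-same; ∧-comm; not-involutive; if-float; xor-∧-commutativeRing)
open import Data.Empty using (⊥; ⊥-elim)
open import Data.Fin.Base using (Fin; zero; suc)
import Data.Integer.Base as ℤ
import Data.Integer.Properties as ℤ
open import Data.Integer.Base using (ℤ; 1ℤ)
open import Data.List.Base using (List; []; _∷_; _++_; _∷ʳ_; foldr; map; length; lookup; filter; concatMap)
open import Data.List.Membership.Propositional using (_∈_; _∉_; lose; find)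
open import Data.List.Membership.Propositional.Properties using (∈-deduplicate⁺; ∈-deduplicate⁻; ∈-concatMap⁺; ∈-concatMap⁻; ∈-lookup; ∈-++⁺ˡ; ∈-++⁺ʳ; ∈-++⁻)
open import Data.List.Membership.Propositional.Properties.WithK using (unique∧set⇒bag)
open import Data.List.Properties using (++-identityʳ; ∷ʳ-++; ∷-injectiveˡ; ∷-injectiveʳ; filter-accept; filter-reject; filter-none; filter-++; length-++)
open import Data.List.Relation.Binary.BagAndSetEquality using (∼bag⇒↭)
open import Data.List.Relation.Binary.Permutation.Propositional as ↭ using (_↭_)
open import Data.List.Relation.Binary.Permutation.Propositional.Properties using (↭-length; filter-↭)
import Data.List.Relation.Binary.Sublist.Propositional as Sublist
open import Data.List.Relation.Binary.Sublist.Propositional using (_⊆_; []; _∷_; ⊆-refl; ⊆-trans; ⊆-antisym; minimum) renaming (_∷ʳ_ to skip)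
open import Data.List.Relation.Binary.Sublist.Propositional.Properties using (++⁺ʳ)
open import Data.List.Relation.Unary.All as All using (All; []; _∷_)
open import Data.List.Relation.Unary.AllPairs as AllPairs using (AllPairs; []; _∷_)
open import Data.List.Relation.Unary.Any as Any using (Any; here; there)
open import Data.List.Relation.Unary.Any.Properties using (lookup-index)
open import Data.List.Relation.Unary.Unique.DecPropositional.Properties using (deduplicate-!)
open import Data.List.Relation.Unary.Unique.Propositional using (Unique)
import Data.Nat.Base as ℕ
import Data.Nat.Properties as ℕ
open import Data.Nat.Base using (ℕ; zero; suc; _≤_; _≤ᵇ_; z≤n; s≤s)
open import Data.Product.Base using (∃; ∃₂; _×_; _,_; proj₁; proj₂)
open import Data.Product.Properties using (,-injectiveˡ; ,-injectiveʳ)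
import Data.Rational.Base as ℚ
import Data.Rational.Properties as ℚ
open import Data.Rational.Base using (ℚ; 0ℚ; ½; _+_; _-_)
open import Data.Rational.Solver using (module +-*-Solver)
open import Data.Sum.Base using (_⊎_; inj₁; inj₂)
open import Data.Unit.Base using (⊤; tt)
open import Data.Vec.Base as Vec using (Vec; []; _∷_)
import Data.Vec.Properties as Vec
open import Function.Base using (_∘_; _∋_)
open import Function.Bundles using (mk⇔; _⇔_; Equivalence)
open import Relation.Binary.Construct.Closure.ReflexiveTransitive as Star using (_◅_)
open import Relation.Binary.Definitions using (tri<; tri≈; tri>)
open import Relation.Binary.PropositionalEquality using (_≡_; _≢_; refl; sym; trans; cong; cong₂; subst; subst₂; module ≡-Reasoning)
open import Relation.Nullary using (¬_)
open import Relation.Nullary.Decidable using (Dec; does; yes; no; dec-true; dec-false; does-⇔; _⊎-dec_)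
open import Algebra.Definitions.RawMonoid ℚ.+-0-rawMonoid using () renaming (_×_ to infixr 7 _·_)
open import Algebra.Properties.CommutativeSemigroup (CommutativeMonoid.commutativeSemigroup ℚ.+-0-commutativeMonoid) using (x∙yz≈y∙xz)
open import Algebra.Properties.Monoid.Mult (CommutativeMonoid.monoid ℚ.+-0-commutativeMonoid) using (×-homo-+)
open +-*-Solver using (Polynomial; con; _:+_; _:-_; _:=_; solve)

-- The triangular lattice

-- `TriangularChain` forbids holes only through `regions`, a statement about all cells of the plane,
-- whereas degrees need that no vertex is met twice. Winding numbers modulo 2 link the two: they
-- change only across the sides of a closed curve and vanish far away, so a cell with odd winding
-- number has a bounded region. Working modulo 2 turns each topological step into a finite Boolean
-- identity. The condition `regions` must also pass to the parts of a chain, because segments have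
-- to be chains themselves; hence cells are removed one at a time, from either end. A stretch with r
-- letters after its first one is a segment of r + 3 triangles, and successive segments share two
-- triangles, so n = 3 + `letters`. The bound 5 on degrees forbids three equal turns in a row, which
-- is why inner segments have length at least 4 and no η occurs for them. Symmetry of θ holds only
-- up to `_≈_`, so the indices are first put in increasing order; after that the identity holds
-- exactly at each term of the Cauchy sequences and is left to the ring solver over ℚ.

1+-injective : ∀ i j → 1ℤ ℤ.+ i ≡ 1ℤ ℤ.+ j → i ≡ j
1+-injective i j eq = trans (sym (ℤ.pred-suc i)) (trans (cong ℤ.pred eq) (ℤ.pred-suc j))

i≢1+i : ∀ {i} → i ≢ 1ℤ ℤ.+ i
i≢1+i = ℤ.i≢suc[i]

i≢pred[i] : ∀ {i} → i ≢ ℤ.pred i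
i≢pred[i] {i} eq = i≢1+i (sym (trans (cong ℤ.suc eq) (ℤ.suc-pred i)))

data Kind : Set where
  hor dia sla : Kind

-- A half-edge is a cell with one of its sides; the border of the cell is run
-- through counterclockwise.
HalfEdge : Set
HalfEdge = Cell × Kind

cell : HalfEdge → Cell
cell = proj₁

rotate : Kind → Kind
rotate hor = dia
rotate dia = sla
rotate sla = hor

next : HalfEdge → HalfEdge
next (c , k) = c , rotate k

flip : HalfEdge → HalfEdge
flip (△ (a , b) , hor) = ▽ (a , ℤ.pred b) , hor
flip (△ (a , b) , dia) = ▽ (a , b) , dia
flip (△ (a , b) , sla) = ▽ (ℤ.pred a , b) , sla
flip (▽ (a , b) , hor) = △ (a , 1ℤ ℤ.+ b) , hor
flip (▽ (a , b) , dia) = △ (a , b) , dia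
flip (▽ (a , b) , sla) = △ (1ℤ ℤ.+ a , b) , sla

source target apex : HalfEdge → Point
source (△ (a , b) , hor) = a , b
source (△ (a , b) , dia) = 1ℤ ℤ.+ a , b
source (△ (a , b) , sla) = a , 1ℤ ℤ.+ b
source (▽ (a , b) , hor) = 1ℤ ℤ.+ a , 1ℤ ℤ.+ b
source (▽ (a , b) , dia) = a , 1ℤ ℤ.+ b
source (▽ (a , b) , sla) = 1ℤ ℤ.+ a , b
target h = source (next h)
apex   h = source (next (next h))

side : HalfEdge → Side
side (△ (a , b) , hor) = (a , b) , (1ℤ ℤ.+ a , b)
side (△ (a , b) , dia) = (1ℤ ℤ.+ a , b) , (a , 1ℤ ℤ.+ b)
side (△ (a , b) , sla) = (a , b) , (a , 1ℤ ℤ.+ b)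
side (▽ (a , b) , hor) = (a , 1ℤ ℤ.+ b) , (1ℤ ℤ.+ a , 1ℤ ℤ.+ b)
side (▽ (a , b) , dia) = (1ℤ ℤ.+ a , b) , (a , 1ℤ ℤ.+ b)
side (▽ (a , b) , sla) = (1ℤ ℤ.+ a , b) , (1ℤ ℤ.+ a , 1ℤ ℤ.+ b)

next³ : ∀ h → next (next (next h)) ≡ h
next³ (_ , hor) = refl
next³ (_ , dia) = refl
next³ (_ , sla) = refl

flip-flip : ∀ h → flip (flip h) ≡ h
flip-flip (△ (a , b) , hor) = cong (λ i → △ (a , i) , hor) (ℤ.suc-pred b)
flip-flip (△ (a , b) , dia) = refl
flip-flip (△ (a , b) , sla) = cong (λ i → △ (i , b) , sla) (ℤ.suc-pred a)
flip-flip (▽ (a , b) , hor) = cong (λ i → ▽ (a , i) , hor) (ℤ.pred-suc b)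
flip-flip (▽ (a , b) , dia) = refl
flip-flip (▽ (a , b) , sla) = cong (λ i → ▽ (i , b) , sla) (ℤ.pred-suc a)

side-flip : ∀ h → side (flip h) ≡ side h
side-flip (△ (a , b) , hor) = cong (λ i → (a , i) , (1ℤ ℤ.+ a , i)) (ℤ.suc-pred b)
side-flip (△ (a , b) , dia) = refl
side-flip (△ (a , b) , sla) = cong (λ i → (i , b) , (i , 1ℤ ℤ.+ b)) (ℤ.suc-pred a)
side-flip (▽ _ , hor) = refl
side-flip (▽ _ , dia) = refl
side-flip (▽ _ , sla) = refl

source-flip : ∀ h → source (flip h) ≡ target h
source-flip (△ (a , b) , hor) = cong (1ℤ ℤ.+ a ,_) (ℤ.suc-pred b)
source-flip (△ (a , b) , dia) = refl
source-flip (△ (a , b) , sla) = cong (_, b) (ℤ.suc-pred a)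
source-flip (▽ _ , hor) = refl
source-flip (▽ _ , dia) = refl
source-flip (▽ _ , sla) = refl

target-flip : ∀ h → target (flip h) ≡ source h
target-flip (△ (a , b) , hor) = cong (a ,_) (ℤ.suc-pred b)
target-flip (△ (a , b) , dia) = refl
target-flip (△ (a , b) , sla) = cong (_, 1ℤ ℤ.+ b) (ℤ.suc-pred a)
target-flip (▽ _ , hor) = refl
target-flip (▽ _ , dia) = refl
target-flip (▽ _ , sla) = refl

cell-flip≢ : ∀ h → cell (flip h) ≢ cell h
cell-flip≢ (△ _ , hor) ()
cell-flip≢ (△ _ , dia) ()
cell-flip≢ (△ _ , sla) ()
cell-flip≢ (▽ _ , hor) ()
cell-flip≢ (▽ _ , dia) ()
cell-flip≢ (▽ _ , sla) ()

side-ends : ∀ h → side h ≡ (source h , target h) ⊎ side h ≡ (target h , source h)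
side-ends (△ _ , hor) = inj₁ refl
side-ends (△ _ , dia) = inj₁ refl
side-ends (△ _ , sla) = inj₂ refl
side-ends (▽ _ , hor) = inj₂ refl
side-ends (▽ _ , dia) = inj₂ refl
side-ends (▽ _ , sla) = inj₁ refl

cong-△ : ∀ {a b a′ b′} → △ (a , b) ≡ △ (a′ , b′) → a ≡ a′ × b ≡ b′
cong-△ refl = refl , refl

cong-▽ : ∀ {a b a′ b′} → ▽ (a , b) ≡ ▽ (a′ , b′) → a ≡ a′ × b ≡ b′
cong-▽ refl = refl , refl

cell-flip-injective : ∀ c {k k′} → cell (flip (c , k)) ≡ cell (flip (c , k′)) → k ≡ k′
cell-flip-injective (△ _) {hor} {hor} _  = refl
cell-flip-injective (△ _) {hor} {dia} eq = ⊥-elim (i≢pred[i] (sym (proj₂ (cong-▽ eq))))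
cell-flip-injective (△ _) {hor} {sla} eq = ⊥-elim (i≢pred[i] (proj₁ (cong-▽ eq)))
cell-flip-injective (△ _) {dia} {hor} eq = ⊥-elim (i≢pred[i] (proj₂ (cong-▽ eq)))
cell-flip-injective (△ _) {dia} {dia} _  = refl
cell-flip-injective (△ _) {dia} {sla} eq = ⊥-elim (i≢pred[i] (proj₁ (cong-▽ eq)))
cell-flip-injective (△ _) {sla} {hor} eq = ⊥-elim (i≢pred[i] (sym (proj₁ (cong-▽ eq))))
cell-flip-injective (△ _) {sla} {dia} eq = ⊥-elim (i≢pred[i] (sym (proj₁ (cong-▽ eq))))
cell-flip-injective (△ _) {sla} {sla} _  = refl
cell-flip-injective (▽ _) {hor} {hor} _  = refl
cell-flip-injective (▽ _) {hor} {dia} eq = ⊥-elim (i≢1+i (sym (proj₂ (cong-△ eq))))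
cell-flip-injective (▽ _) {hor} {sla} eq = ⊥-elim (i≢1+i (proj₁ (cong-△ eq)))
cell-flip-injective (▽ _) {dia} {hor} eq = ⊥-elim (i≢1+i (proj₂ (cong-△ eq)))
cell-flip-injective (▽ _) {dia} {dia} _  = refl
cell-flip-injective (▽ _) {dia} {sla} eq = ⊥-elim (i≢1+i (proj₁ (cong-△ eq)))
cell-flip-injective (▽ _) {sla} {hor} eq = ⊥-elim (i≢1+i (sym (proj₁ (cong-△ eq))))
cell-flip-injective (▽ _) {sla} {dia} eq = ⊥-elim (i≢1+i (sym (proj₁ (cong-△ eq))))
cell-flip-injective (▽ _) {sla} {sla} _  = refl

apex≢source : ∀ h → apex h ≢ source h
apex≢source (△ _ , hor) = i≢1+i ∘ sym ∘ ,-injectiveʳ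
apex≢source (△ _ , dia) = i≢1+i ∘ ,-injectiveˡ
apex≢source (△ _ , sla) = i≢1+i ∘ sym ∘ ,-injectiveˡ
apex≢source (▽ _ , hor) = i≢1+i ∘ ,-injectiveʳ
apex≢source (▽ _ , dia) = i≢1+i ∘ sym ∘ ,-injectiveˡ
apex≢source (▽ _ , sla) = i≢1+i ∘ ,-injectiveˡ

apex≢target : ∀ h → apex h ≢ target h
apex≢target h eq = apex≢source (next (next h)) (sym (trans eq (cong (source ∘ next) (sym (next³ h)))))

source≢target : ∀ h → source h ≢ target h
source≢target h eq = apex≢source (next h) (trans (cong source (next³ h)) eq)

-- The direction of a side seen from its end points alone. Sides that coincide are thereby of one
-- kind, which leaves `side-injective` with only the matching kinds to treat.
HasKind : Kind → Side → Set
HasKind hor ((_ , b) , (_ , d)) = b ≡ d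
HasKind sla ((a , b) , (c , d)) = b ≢ d × a ≡ c
HasKind dia ((a , b) , (c , d)) = b ≢ d × a ≢ c

side-hasKind : ∀ c k → HasKind k (side (c , k))
side-hasKind (△ _) hor = refl
side-hasKind (△ _) dia = i≢1+i , i≢1+i ∘ sym
side-hasKind (△ _) sla = i≢1+i , refl
side-hasKind (▽ _) hor = refl
side-hasKind (▽ _) dia = i≢1+i , i≢1+i ∘ sym
side-hasKind (▽ _) sla = i≢1+i , refl

hasKind-unique : ∀ k k′ e → HasKind k e → HasKind k′ e → k ≡ k′
hasKind-unique hor hor _ _         _         = refl
hasKind-unique hor dia _ p         (¬p , _)  = ⊥-elim (¬p p)
hasKind-unique hor sla _ p         (¬p , _)  = ⊥-elim (¬p p)
hasKind-unique dia hor _ (¬p , _)  p         = ⊥-elim (¬p p)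
hasKind-unique dia dia _ _         _         = refl
hasKind-unique dia sla _ (_ , ¬p)  (_ , p)   = ⊥-elim (¬p p)
hasKind-unique sla hor _ (¬p , _)  p         = ⊥-elim (¬p p)
hasKind-unique sla dia _ (_ , p)   (_ , ¬p)  = ⊥-elim (¬p p)
hasKind-unique sla sla _ _         _         = refl

side-kind : ∀ c k c′ k′ → side (c , k) ≡ side (c′ , k′) → k ≡ k′
side-kind c k c′ k′ eq = hasKind-unique k k′ (side (c , k)) (side-hasKind c k)
  (subst (HasKind k′) (sym eq) (side-hasKind c′ k′))

coords : ∀ {a b c d a′ b′ c′ d′ : ℤ} → ((a , b) , (c , d)) ≡ ((a′ , b′) , (c′ , d′)) →
         (a ≡ a′ × b ≡ b′) × (c ≡ c′ × d ≡ d′)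
coords refl = (refl , refl) , (refl , refl)

side-injective : ∀ h h′ → side h ≡ side h′ → h ≡ h′ ⊎ h ≡ flip h′
side-injective (c , k) (c′ , k′) eq with side-kind c k c′ k′ eq
side-injective (△ _ , hor) (△ _ , hor) eq | refl with refl , refl ← proj₁ (coords eq) = inj₁ refl
side-injective (△ _ , dia) (△ _ , dia) eq | refl
  with (_ , refl) , (refl , _) ← coords eq = inj₁ refl
side-injective (△ _ , sla) (△ _ , sla) eq | refl with refl , refl ← proj₁ (coords eq) = inj₁ refl
side-injective (▽ (_ , b) , hor) (▽ (_ , b′) , hor) eq | refl
  with (refl , p) , _ ← coords eq with refl ← 1+-injective b b′ p = inj₁ refl
side-injective (▽ _ , dia) (▽ _ , dia) eq | refl
  with (_ , refl) , (refl , _) ← coords eq = inj₁ refl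
side-injective (▽ (a , _) , sla) (▽ (a′ , _) , sla) eq | refl
  with (p , refl) , _ ← coords eq with refl ← 1+-injective a a′ p = inj₁ refl
side-injective (△ _ , hor) (▽ _ , hor) eq | refl with refl , refl ← proj₁ (coords eq) = inj₂ refl
side-injective (△ _ , dia) (▽ _ , dia) eq | refl
  with (_ , refl) , (refl , _) ← coords eq = inj₂ refl
side-injective (△ _ , sla) (▽ _ , sla) eq | refl with refl , refl ← proj₁ (coords eq) = inj₂ refl
side-injective (▽ (_ , b) , hor) (△ _ , hor) eq | refl
  with refl , refl ← proj₁ (coords eq) = inj₂ (cong (λ i → ▽ (_ , i) , hor) (sym (ℤ.pred-suc b)))
side-injective (▽ _ , dia) (△ _ , dia) eq | refl
  with (_ , refl) , (refl , _) ← coords eq = inj₂ refl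
side-injective (▽ (a , _) , sla) (△ _ , sla) eq | refl
  with refl , refl ← proj₁ (coords eq) = inj₂ (cong (λ i → ▽ (i , _) , sla) (sym (ℤ.pred-suc a)))

∈-sides⁺ : ∀ h → side h ∈ sides (cell h)
∈-sides⁺ (△ _ , hor) = here refl
∈-sides⁺ (△ _ , dia) = there (there (here refl))
∈-sides⁺ (△ _ , sla) = there (here refl)
∈-sides⁺ (▽ _ , hor) = here refl
∈-sides⁺ (▽ _ , dia) = there (there (here refl))
∈-sides⁺ (▽ _ , sla) = there (here refl)

∈-sides⁻ : ∀ c {e} → e ∈ sides c → ∃ λ k → e ≡ side (c , k)
∈-sides⁻ (△ _) (here eq)                 = hor , eq
∈-sides⁻ (△ _) (there (here eq))         = sla , eq
∈-sides⁻ (△ _) (there (there (here eq))) = dia , eq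
∈-sides⁻ (▽ _) (here eq)                 = hor , eq
∈-sides⁻ (▽ _) (there (here eq))         = sla , eq
∈-sides⁻ (▽ _) (there (there (here eq))) = dia , eq

∈-corners⁺ : ∀ h → source h ∈ corners (cell h)
∈-corners⁺ (△ _ , hor) = here refl
∈-corners⁺ (△ _ , dia) = there (here refl)
∈-corners⁺ (△ _ , sla) = there (there (here refl))
∈-corners⁺ (▽ _ , hor) = there (there (here refl))
∈-corners⁺ (▽ _ , dia) = there (here refl)
∈-corners⁺ (▽ _ , sla) = here refl

∈-corners⁻ : ∀ c {u} → u ∈ corners c → ∃ λ k → u ≡ source (c , k)
∈-corners⁻ (△ _) (here eq)                 = hor , eq
∈-corners⁻ (△ _) (there (here eq))         = dia , eq
∈-corners⁻ (△ _) (there (there (here eq))) = sla , eq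
∈-corners⁻ (▽ _) (here eq)                 = sla , eq
∈-corners⁻ (▽ _) (there (here eq))         = dia , eq
∈-corners⁻ (▽ _) (there (there (here eq))) = hor , eq

-- A view of the sides of a cell relative to a given one, so that later proofs split on the position
-- relative to the chain and not on the direction in the plane.
data Rotation (h : HalfEdge) : HalfEdge → Set where
  rot₀ : Rotation h h
  rot₁ : Rotation h (next h)
  rot₂ : Rotation h (next (next h))

rotation : ∀ c k k′ → Rotation (c , k) (c , k′)
rotation c hor hor = rot₀
rotation c hor dia = rot₁
rotation c hor sla = rot₂
rotation c dia hor = rot₂
rotation c dia dia = rot₀
rotation c dia sla = rot₁
rotation c sla hor = rot₁
rotation c sla dia = rot₂
rotation c sla sla = rot₀

-- Winding numbers modulo 2

-- Kept opaque so that the comparisons remain atoms on which the case tables below can abstract.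
abstract
  _==_ _<ᵇ_ : ℤ → ℤ → Bool
  i == j = does (i ℤ.≟ j)
  i <ᵇ j = does (i ℤ.<? j)

  ==-refl : ∀ i → (i == i) ≡ true
  ==-refl i = dec-true (i ℤ.≟ i) refl

  ==⇒≡ : ∀ i j → (i == j) ≡ true → i ≡ j
  ==⇒≡ i j eq with yes p ← i ℤ.≟ j = p

  <ᵇ⇒< : ∀ i j → (i <ᵇ j) ≡ true → i ℤ.< j
  <ᵇ⇒< i j eq with yes p ← i ℤ.<? j = p

  <⇒<ᵇ : ∀ {i j} → i ℤ.< j → (i <ᵇ j) ≡ true
  <⇒<ᵇ {i} {j} = dec-true (i ℤ.<? j)

  1+==1+ : ∀ i j → ((1ℤ ℤ.+ i) == (1ℤ ℤ.+ j)) ≡ (i == j)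
  1+==1+ i j = does-⇔ (mk⇔ (1+-injective i j) (cong ℤ.suc)) (ℤ.suc i ℤ.≟ ℤ.suc j) (i ℤ.≟ j)

  1+<ᵇ1+ : ∀ i j → ((1ℤ ℤ.+ i) <ᵇ (1ℤ ℤ.+ j)) ≡ (i <ᵇ j)
  1+<ᵇ1+ i j = does-⇔ (mk⇔ (subst₂ ℤ._<_ (ℤ.pred-suc i) (ℤ.pred-suc j) ∘ ℤ.+-monoʳ-< ℤ.-1ℤ) (ℤ.+-monoʳ-< 1ℤ)) (ℤ.suc i ℤ.<? ℤ.suc j) (i ℤ.<? j)

  <ᵇ1+ : ∀ i j → (i <ᵇ (1ℤ ℤ.+ j)) ≡ (i <ᵇ j) xor (j == i)
  <ᵇ1+ i j with ℤ.<-cmp i j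
  ... | tri< i<j i≢j _ rewrite dec-true (i ℤ.<? j) i<j | dec-false (j ℤ.≟ i) (i≢j ∘ sym) =
    dec-true (i ℤ.<? ℤ.suc j) (ℤ.<-≤-trans i<j (ℤ.i≤suc[i] j))
  ... | tri≈ i≮j refl _ rewrite dec-false (i ℤ.<? i) i≮j | dec-true (i ℤ.≟ i) refl =
    dec-true (i ℤ.<? ℤ.suc i) (ℤ.suc[i]≤j⇒i<j ℤ.≤-refl)
  ... | tri> i≮j i≢j j<i rewrite dec-false (i ℤ.<? j) i≮j | dec-false (j ℤ.≟ i) (i≢j ∘ sym) =
    dec-false (i ℤ.<? ℤ.suc j) (λ i<1+j → ℤ.<-irrefl refl (ℤ.<-≤-trans i<1+j (ℤ.i<j⇒suc[i]≤j j<i)))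

  ==∧==1+ : ∀ i j → (i == j) ∧ (i == (1ℤ ℤ.+ j)) ≡ false
  ==∧==1+ i j with i ℤ.≟ j
  ... | no  _    = refl
  ... | yes refl = dec-false (i ℤ.≟ ℤ.suc i) i≢1+i

<ᵇ-pred : ∀ i j → (i <ᵇ j) ≡ ((1ℤ ℤ.+ i) <ᵇ j) xor (j == (1ℤ ℤ.+ i))
<ᵇ-pred i j = subst (λ j → (i <ᵇ j) ≡ ((1ℤ ℤ.+ i) <ᵇ j) xor (j == (1ℤ ℤ.+ i))) (ℤ.suc-pred j)
  (trans (<ᵇ1+ i (ℤ.pred j)) (sym (cong₂ _xor_ (1+<ᵇ1+ i (ℤ.pred j)) (1+==1+ (ℤ.pred j) i))))

_==ₛ_ : Side → Side → Bool
((a , b) , (c , d)) ==ₛ ((a′ , b′) , (c′ , d′)) =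
  ((a == a′) ∧ (b == b′)) ∧ ((c == c′) ∧ (d == d′))

==ₛ-refl : ∀ e → (e ==ₛ e) ≡ true
==ₛ-refl ((a , b) , (c , d)) rewrite ==-refl a | ==-refl b | ==-refl c | ==-refl d = refl

∧-true : ∀ {x y} → x ∧ y ≡ true → x ≡ true × y ≡ true
∧-true {true} {true} _ = refl , refl

≢⇒==ₛ : ∀ {e e′} → e ≢ e′ → (e ==ₛ e′) ≡ false
≢⇒==ₛ {e@((a , b) , (c , d))} {e′@((a′ , b′) , (c′ , d′))} e≢e′ with e ==ₛ e′ in eq
... | false = refl
... | true = ⊥-elim (e≢e′ (cong₂ _,_
    (cong₂ _,_ (==⇒≡ a a′ (proj₁ ab)) (==⇒≡ b b′ (proj₂ ab)))
    (cong₂ _,_ (==⇒≡ c c′ (proj₁ cd)) (==⇒≡ d d′ (proj₂ cd)))))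
  where
  abcd = ∧-true {(a == a′) ∧ (b == b′)} eq
  ab   = ∧-true {a == a′} (proj₁ abcd)
  cd   = ∧-true {c == c′} (proj₂ abcd)

-- Whether the ray in direction e₁ from the centre of the cell crosses the side.
crosses : Cell → Side → Bool
crosses (△ (a , b)) ((x , y) , (x′ , y′)) = ((y == b) ∧ (y′ == (1ℤ ℤ.+ b))) ∧ (a <ᵇ x)
crosses (▽ (a , b)) ((x , y) , (x′ , y′)) = ((y == b) ∧ (y′ == (1ℤ ℤ.+ b))) ∧ (a <ᵇ x′)

-- Moving the start of a ray across a horizontal side makes it sweep over the
-- lattice points to the right of that side.
swept : Point → Kind → Point → Bool
swept (a , b) hor (x , y) = (y == (1ℤ ℤ.+ b)) ∧ (a <ᵇ x)
swept _       dia _       = false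
swept _       sla _       = false

-- The coboundary modulo 2 of a set of points.
onEnds : (Point → Bool) → Side → Bool
onEnds f (p , q) = f p xor f q

-- Across a slanted side both rays run in one row and differ by that side alone. Across a horizontal
-- side they run in adjacent rows: a slanted side to the right in either row has just one end among
-- the swept points, and a horizontal side has just one only if it is the side passed, where the two
-- terms on the right cancel. Rows refuted by `==∧==1+` are absent from the tables.
crosses-flip-▽ : ∀ p k p′ k′ → let h = ▽ p , k; e = side (△ p′ , k′) in
  crosses (▽ p) e xor crosses (cell (flip h)) e ≡ (e ==ₛ side h) xor onEnds (swept p k) e
crosses-flip-▽ (a , b) dia (a′ , b′) hor
  with b′ == b | b′ == (1ℤ ℤ.+ b) | ==∧==1+ b′ b
... | false | _     | _ rewrite ∧-comm (a′ == (1ℤ ℤ.+ a)) false = refl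
... | true  | false | _ with a′ == (1ℤ ℤ.+ a) | (1ℤ ℤ.+ a′) == a
... | false | _     = refl
... | true  | false = refl
... | true  | true  = refl
crosses-flip-▽ (a , b) dia (a′ , b′) sla
  rewrite 1+==1+ b′ b
  with a′ == a | a′ == (1ℤ ℤ.+ a) | ==∧==1+ a′ a | b′ == b | a <ᵇ a′
... | false | false | _ | false | _     = refl
... | false | false | _ | true  | false = refl
... | false | false | _ | true  | true  = refl
... | false | true  | _ | false | _     = refl
... | false | true  | _ | true  | false = refl
... | false | true  | _ | true  | true  = refl
... | true  | false | _ | false | _     = refl
... | true  | false | _ | true  | false = refl
... | true  | false | _ | true  | true  = refl
crosses-flip-▽ (a , b) dia (a′ , b′) dia
  rewrite 1+==1+ b′ b | 1+==1+ a′ a | <ᵇ1+ a a′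
  with a′ == a | b′ == b | a <ᵇ a′
... | false | false | _     = refl
... | false | true  | false = refl
... | false | true  | true  = refl
... | true  | false | _     = refl
... | true  | true  | false = refl
... | true  | true  | true  = refl
crosses-flip-▽ (a , b) sla (a′ , b′) hor
  with b′ == b | b′ == (1ℤ ℤ.+ b) | ==∧==1+ b′ b
... | false | _     | _ rewrite ∧-comm (a′ == (1ℤ ℤ.+ a)) false = refl
... | true  | false | _ with a′ == (1ℤ ℤ.+ a) | (1ℤ ℤ.+ a′) == (1ℤ ℤ.+ a)
... | false | _     = refl
... | true  | false = refl
... | true  | true  = refl
crosses-flip-▽ (a , b) sla (a′ , b′) sla
  rewrite 1+==1+ b′ b | <ᵇ-pred a a′
  with a′ == (1ℤ ℤ.+ a) | b′ == b | (1ℤ ℤ.+ a) <ᵇ a′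
... | false | false | _     = refl
... | false | true  | false = refl
... | false | true  | true  = refl
... | true  | false | _     = refl
... | true  | true  | false = refl
... | true  | true  | true  = refl
crosses-flip-▽ (a , b) sla (a′ , b′) dia
  rewrite 1+==1+ b′ b | 1+==1+ a′ a | 1+<ᵇ1+ a a′
  with a′ == a | a′ == (1ℤ ℤ.+ a) | ==∧==1+ a′ a | b′ == b | a <ᵇ a′
... | false | _     | _ | false | _     = refl
... | false | _     | _ | true  | false = refl
... | false | _     | _ | true  | true  = refl
... | true  | false | _ | false | _     = refl
... | true  | false | _ | true  | false = refl
... | true  | false | _ | true  | true  = refl
crosses-flip-▽ (a , b) hor (a′ , b′) hor
  rewrite 1+==1+ a′ a | <ᵇ1+ a a′
  with b′ == b | b′ == (1ℤ ℤ.+ b) | b′ == (1ℤ ℤ.+ (1ℤ ℤ.+ b)) | ==∧==1+ b′ b | ==∧==1+ b′ (1ℤ ℤ.+ b) | a′ == a | a <ᵇ a′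
... | false | false | _     | _ | _ | false | _     = refl
... | false | false | _     | _ | _ | true  | _     = refl
... | false | true  | false | _ | _ | false | false = refl
... | false | true  | false | _ | _ | false | true  = refl
... | false | true  | false | _ | _ | true  | false = refl
... | false | true  | false | _ | _ | true  | true  = refl
... | true  | false | _     | _ | _ | false | _     = refl
... | true  | false | _     | _ | _ | true  | _     = refl
crosses-flip-▽ (a , b) hor (a′ , b′) sla
  rewrite 1+==1+ b′ b | 1+==1+ b′ (1ℤ ℤ.+ b)
  with b′ == b | b′ == (1ℤ ℤ.+ b) | ==∧==1+ b′ b | a′ == a | a′ == (1ℤ ℤ.+ a) | a <ᵇ a′
... | false | false | _ | false | _     | _     = refl
... | false | false | _ | true  | _     | _     = refl
... | false | true  | _ | false | _     | false = refl
... | false | true  | _ | false | _     | true  = refl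
... | false | true  | _ | true  | false | false = refl
... | false | true  | _ | true  | false | true  = refl
... | false | true  | _ | true  | true  | false = refl
... | false | true  | _ | true  | true  | true  = refl
... | true  | false | _ | false | _     | false = refl
... | true  | false | _ | false | _     | true  = refl
... | true  | false | _ | true  | _     | false = refl
... | true  | false | _ | true  | _     | true  = refl
crosses-flip-▽ (a , b) hor (a′ , b′) dia
  rewrite 1+==1+ b′ b | 1+==1+ b′ (1ℤ ℤ.+ b) | <ᵇ1+ a a′
  with b′ == b | b′ == (1ℤ ℤ.+ b) | ==∧==1+ b′ b | (1ℤ ℤ.+ a′) == a | a′ == (1ℤ ℤ.+ a) | a <ᵇ a′ | a′ == a
... | false | false | _ | false | _     | _     | _ = refl
... | false | false | _ | true  | _     | _     | _ = refl
... | false | true  | _ | false | _     | false | false = refl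
... | false | true  | _ | false | _     | false | true  = refl
... | false | true  | _ | false | _     | true  | false = refl
... | false | true  | _ | false | _     | true  | true  = refl
... | false | true  | _ | true  | false | false | false = refl
... | false | true  | _ | true  | false | false | true  = refl
... | false | true  | _ | true  | false | true  | false = refl
... | false | true  | _ | true  | false | true  | true  = refl
... | false | true  | _ | true  | true  | false | false = refl
... | false | true  | _ | true  | true  | false | true  = refl
... | false | true  | _ | true  | true  | true  | false = refl
... | false | true  | _ | true  | true  | true  | true  = refl
... | true  | false | _ | false | _     | false | _ = refl
... | true  | false | _ | false | _     | true  | _ = refl
... | true  | false | _ | true  | _     | false | _ = refl
... | true  | false | _ | true  | _     | true  | _ = refl

side-△ : ∀ h → ∃₂ λ p k → side h ≡ side (△ p , k)
side-△ (△ p , k)   = p , k , refl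
side-△ (▽ _ , hor) = _ , hor , refl
side-△ (▽ _ , dia) = _ , dia , refl
side-△ (▽ _ , sla) = _ , sla , refl

flip-△ : ∀ p k → ∃ λ q → flip (△ p , k) ≡ (▽ q , k)
flip-△ _ hor = _ , refl
flip-△ _ dia = _ , refl
flip-△ _ sla = _ , refl

-- The point set f is chosen before the side h′, so a single f serves all sides of a curve at once.
crosses-flip : ∀ h → ∃ λ f → ∀ h′ → let e = side h′ in
  crosses (cell h) e xor crosses (cell (flip h)) e ≡ (e ==ₛ side h) xor onEnds f e
crosses-flip (▽ p , k) = swept p k , λ h′ → let p′ , k′ , eq = side-△ h′ in
  subst (λ e → crosses (▽ p) e xor crosses (cell (flip (▽ p , k))) e ≡
               (e ==ₛ side (▽ p , k)) xor onEnds (swept p k) e)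
        (sym eq) (crosses-flip-▽ p k p′ k′)
crosses-flip h@(△ p₀ , k) with p , eq ← flip-△ p₀ k = swept p k , λ h′ →
  let e = side h′ ; p′ , k′ , eq′ = side-△ h′ in begin
    crosses (cell h) e xor crosses (cell (flip h)) e
      ≡⟨ xor-comm (crosses (cell h) e) _ ⟩
    crosses (cell (flip h)) e xor crosses (cell h) e
      ≡⟨ cong₂ (λ c d → crosses (cell c) e xor crosses (cell d) e) eq
               (trans (sym (flip-flip h)) (cong flip eq)) ⟩
    crosses (▽ p) e xor crosses (cell (flip (▽ p , k))) e
      ≡⟨ subst (λ e → crosses (▽ p) e xor crosses (cell (flip (▽ p , k))) e ≡
               (e ==ₛ side (▽ p , k)) xor onEnds (swept p k) e)
        (sym eq′) (crosses-flip-▽ p k p′ k′) ⟩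
    (e ==ₛ side (▽ p , k)) xor onEnds (swept p k) e
      ≡⟨ cong (λ s → (e ==ₛ s) xor onEnds (swept p k) e)
              (trans (cong side (sym eq)) (side-flip h)) ⟩
    (e ==ₛ side h) xor onEnds (swept p k) e ∎
  where
  open ≡-Reasoning

parity : (Side → Bool) → List Side → Bool
parity f = foldr (λ e → f e xor_) false

winding : Cell → List Side → Bool
winding c = parity (crosses c)

IsSide : Side → Set
IsSide e = ∃ λ h → e ≡ side h

-- A cycle modulo 2, expressed by duality: every coboundary sums to zero on it. For the loops built
-- later this comes out of telescoping.
Closed : List Side → Set
Closed es = ∀ f → parity (onEnds f) es ≡ false

xor-interchange : ∀ a b c d → (a xor b) xor (c xor d) ≡ (a xor c) xor (b xor d)
xor-interchange = CommutativeSemigroupProperties.interchange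
  (CommutativeRing.+-commutativeSemigroup xor-∧-commutativeRing)

parity-xor : ∀ f g es → parity (λ e → f e xor g e) es ≡ parity f es xor parity g es
parity-xor f g []       = refl
parity-xor f g (e ∷ es) = trans (cong ((f e xor g e) xor_) (parity-xor f g es))
  (xor-interchange (f e) (g e) (parity f es) (parity g es))

parity-cong : ∀ f g {es} → All (λ e → f e ≡ g e) es → parity f es ≡ parity g es
parity-cong f g []         = refl
parity-cong f g (eq ∷ eqs) = cong₂ _xor_ eq (parity-cong f g eqs)

parity-false : ∀ f {es} → All (λ e → f e ≡ false) es → parity f es ≡ false
parity-false f []         = refl
parity-false f (eq ∷ eqs) rewrite eq = parity-false f eqs

parity-true : ∀ f es → parity f es ≡ true → ∃ λ e → e ∈ es × f e ≡ true
parity-true f (e ∷ es) eq with f e in fe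
... | true  = e , here refl , fe
... | false = let e′ , e′∈es , fe′ = parity-true f es eq in e′ , there e′∈es , fe′

-- By `crosses-flip` the two crossing numbers differ by the passages of the curve along the side and
-- by a coboundary; the latter vanishes since the curve is closed.
winding-flip : ∀ {es} → All IsSide es → Closed es → ∀ h →
  winding (cell h) es xor winding (cell (flip h)) es ≡ parity (_==ₛ side h) es
winding-flip {es} sides closed h with f , eq ← crosses-flip h = begin
  parity (crosses (cell h)) es xor parity (crosses (cell (flip h))) es
    ≡⟨ parity-xor (crosses (cell h)) (crosses (cell (flip h))) es ⟨
  parity (λ e → crosses (cell h) e xor crosses (cell (flip h)) e) es
    ≡⟨ parity-cong (λ e → crosses (cell h) e xor crosses (cell (flip h)) e) (λ e → (e ==ₛ side h) xor onEnds f e) (All.map (λ { (h′ , refl) → eq h′ }) sides) ⟩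
  parity (λ e → (e ==ₛ side h) xor onEnds f e) es
    ≡⟨ parity-xor (_==ₛ side h) (onEnds f) es ⟩
  parity (_==ₛ side h) es xor parity (onEnds f) es
    ≡⟨ cong (parity (_==ₛ side h) es xor_) (closed f) ⟩
  parity (_==ₛ side h) es xor false
    ≡⟨ xor-comm _ false ⟩
  parity (_==ₛ side h) es ∎
  where open ≡-Reasoning

xor-≡ : ∀ {a b} → a xor b ≡ false → a ≡ b
xor-≡ {false} {false} _ = refl
xor-≡ {true}  {true}  _ = refl

-- The winding number around c of the border of a single cell: the lemmas that follow show it to be
-- the indicator of c being that cell.
around : Cell → HalfEdge → Bool
around c h = crosses c (side h) xor (crosses c (side (next h)) xor crosses c (side (next (next h))))

around-next : ∀ c h → around c (next h) ≡ around c h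
around-next c h = begin
  q xor (r xor crosses c (side (next (next (next h)))))
    ≡⟨ cong (λ h → q xor (r xor crosses c (side h))) (next³ h) ⟩
  q xor (r xor p) ≡⟨ xor-assoc q r p ⟨
  (q xor r) xor p ≡⟨ xor-comm (q xor r) p ⟩
  p xor (q xor r) ∎
  where
  open ≡-Reasoning
  p = crosses c (side h)
  q = crosses c (side (next h))
  r = crosses c (side (next (next h)))

around-hor-△△ : ∀ a b a′ b′ → around (△ (a , b)) (△ (a′ , b′) , hor) ≡ (a′ == a) ∧ (b′ == b)
around-hor-△△ a b a′ b′ rewrite ==∧==1+ b′ b | 1+==1+ b′ b | <ᵇ1+ a a′
  with b′ == b | a′ == a | a <ᵇ a′
... | false | false | _     = refl
... | false | true  | _     = refl
... | true  | false | false = refl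
... | true  | false | true  = refl
... | true  | true  | false = refl
... | true  | true  | true  = refl

around-hor-▽▽ : ∀ a b a′ b′ → around (▽ (a , b)) (▽ (a′ , b′) , hor) ≡ (a′ == a) ∧ (b′ == b)
around-hor-▽▽ a b a′ b′ rewrite ==∧==1+ (1ℤ ℤ.+ b′) b | 1+==1+ b′ b | <ᵇ1+ a a′
  with b′ == b | a′ == a | a <ᵇ a′
... | false | false | _     = refl
... | false | true  | _     = refl
... | true  | false | false = refl
... | true  | false | true  = refl
... | true  | true  | false = refl
... | true  | true  | true  = refl

around-hor-△▽ : ∀ a b a′ b′ → around (△ (a , b)) (▽ (a′ , b′) , hor) ≡ false
around-hor-△▽ a b a′ b′ rewrite ==∧==1+ (1ℤ ℤ.+ b′) b =
  xor-same (((b′ == b) ∧ ((1ℤ ℤ.+ b′) == (1ℤ ℤ.+ b))) ∧ (a <ᵇ (1ℤ ℤ.+ a′)))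

around-hor-▽△ : ∀ a b a′ b′ → around (▽ (a , b)) (△ (a′ , b′) , hor) ≡ false
around-hor-▽△ a b a′ b′ rewrite ==∧==1+ b′ b =
  xor-same (((b′ == b) ∧ ((1ℤ ℤ.+ b′) == (1ℤ ℤ.+ b))) ∧ (a <ᵇ a′))

around-hor-self : ∀ c → around c (c , hor) ≡ true
around-hor-self (△ (a , b)) = trans (around-hor-△△ a b a b) (cong₂ _∧_ (==-refl a) (==-refl b))
around-hor-self (▽ (a , b)) = trans (around-hor-▽▽ a b a b) (cong₂ _∧_ (==-refl a) (==-refl b))

==∧==-false : ∀ {a b a′ b′} → ¬ (a′ ≡ a × b′ ≡ b) → (a′ == a) ∧ (b′ == b) ≡ false
==∧==-false {a} {b} {a′} {b′} ¬eq with (a′ == a) ∧ (b′ == b) in eq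
... | false = refl
... | true  = let p , q = ∧-true {a′ == a} eq in ⊥-elim (¬eq (==⇒≡ a′ a p , ==⇒≡ b′ b q))

around-hor-other : ∀ {c c′} → c ≢ c′ → around c (c′ , hor) ≡ false
around-hor-other {△ (a , b)} {△ (a′ , b′)} c≢c′ =
  trans (around-hor-△△ a b a′ b′) (==∧==-false λ { (refl , refl) → c≢c′ refl })
around-hor-other {△ (a , b)} {▽ (a′ , b′)} _ = around-hor-△▽ a b a′ b′
around-hor-other {▽ (a , b)} {△ (a′ , b′)} _ = around-hor-▽△ a b a′ b′
around-hor-other {▽ (a , b)} {▽ (a′ , b′)} c≢c′ =
  trans (around-hor-▽▽ a b a′ b′) (==∧==-false λ { (refl , refl) → c≢c′ refl })

around-hor : ∀ c h → around c h ≡ around c (cell h , hor)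
around-hor c (_ , hor)   = refl
around-hor c (c′ , dia) = around-next c (c′ , hor)
around-hor c (c′ , sla) = trans (around-next c (c′ , dia)) (around-next c (c′ , hor))

around-self : ∀ h → around (cell h) h ≡ true
around-self h = trans (around-hor (cell h) h) (around-hor-self (cell h))

around-other : ∀ {c h} → c ≢ cell h → around c h ≡ false
around-other {c} {h} c≢h = trans (around-hor c h) (around-hor-other c≢h)

-- Lying in row b is a coboundary, namely that of the points above height b. This is what lets
-- closedness cancel the crossings of an entire row.
side-rows : ∀ h b → let (_ , y) , (_ , y′) = side h in
  (y == b) ∧ (y′ == (1ℤ ℤ.+ b)) ≡ (b <ᵇ y) xor (b <ᵇ y′)
side-rows h b with p , k , eq ← side-△ h rewrite eq = rows p k
  where
  rows : ∀ p k → let (_ , y) , (_ , y′) = side (△ p , k) in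
    (y == b) ∧ (y′ == (1ℤ ℤ.+ b)) ≡ (b <ᵇ y) xor (b <ᵇ y′)
  slanted : ∀ y → (y == b) ∧ ((1ℤ ℤ.+ y) == (1ℤ ℤ.+ b)) ≡ (b <ᵇ y) xor (b <ᵇ (1ℤ ℤ.+ y))
  slanted y rewrite 1+==1+ y b | <ᵇ1+ b y with y == b | b <ᵇ y
  ... | false | false = refl
  ... | false | true  = refl
  ... | true  | false = refl
  ... | true  | true  = refl
  rows (_ , y) hor = trans (==∧==1+ y b) (sym (xor-same (b <ᵇ y)))
  rows (_ , y) dia = slanted y
  rows (_ , y) sla = slanted y

Within : ℕ → Side → Set
Within N ((x , y) , (x′ , _)) = ℤ.∣ x ∣ ℕ.≤ N × ℤ.∣ y ∣ ℕ.≤ N × ℤ.∣ x′ ∣ ℕ.≤ N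

within : ∀ es → ∃ λ N → All (Within N) es
within [] = 0 , []
within (((x , y) , (x′ , _)) ∷ es) with N , ps ← within es =
  ℤ.∣ x ∣ ℕ.⊔ ℤ.∣ y ∣ ℕ.⊔ ℤ.∣ x′ ∣ ℕ.⊔ N ,
  ( ℕ.≤-trans (ℕ.m≤m⊔n X Y) (ℕ.≤-trans (ℕ.m≤m⊔n (X ℕ.⊔ Y) X′) (ℕ.m≤m⊔n (X ℕ.⊔ Y ℕ.⊔ X′) N))
  , ℕ.≤-trans (ℕ.m≤n⊔m X Y) (ℕ.≤-trans (ℕ.m≤m⊔n (X ℕ.⊔ Y) X′) (ℕ.m≤m⊔n (X ℕ.⊔ Y ℕ.⊔ X′) N))
  , ℕ.≤-trans (ℕ.m≤n⊔m (X ℕ.⊔ Y) X′) (ℕ.m≤m⊔n (X ℕ.⊔ Y ℕ.⊔ X′) N)) ∷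
  All.map (λ (p , q , r) → ≤N p , ≤N q , ≤N r) ps
  where
  X  = ℤ.∣ x ∣
  Y  = ℤ.∣ y ∣
  X′ = ℤ.∣ x′ ∣
  ≤N : ∀ {i} → i ℕ.≤ N → i ℕ.≤ X ℕ.⊔ Y ℕ.⊔ X′ ℕ.⊔ N
  ≤N i≤N = ℕ.≤-trans i≤N (ℕ.m≤n⊔m (X ℕ.⊔ Y ℕ.⊔ X′) N)

∣i∣≤n⇒-n≤i : ∀ i {n} → ℤ.∣ i ∣ ℕ.≤ n → ℤ.- ℤ.+ n ℤ.≤ i
∣i∣≤n⇒-n≤i (ℤ.+ m)     {n} _   = ℤ.≤-trans ℤ.neg-≤-pos (ℤ.+≤+ ℕ.z≤n)
∣i∣≤n⇒-n≤i ℤ.-[1+ m ] {ℕ.suc n} (ℕ.s≤s m≤n) = ℤ.-≤- m≤n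

∣i∣≤n⇒i≤n : ∀ i {n} → ℤ.∣ i ∣ ℕ.≤ n → i ℤ.≤ ℤ.+ n
∣i∣≤n⇒i≤n (ℤ.+ m)    m≤n = ℤ.+≤+ m≤n
∣i∣≤n⇒i≤n ℤ.-[1+ m ] _   = ℤ.-≤+

-n≤i≤n⇒∣i∣≤n : ∀ {i n} → ℤ.- ℤ.+ n ℤ.≤ i → i ℤ.≤ ℤ.+ n → ℤ.∣ i ∣ ℕ.≤ n
-n≤i≤n⇒∣i∣≤n {ℤ.+ m}                 _            (ℤ.+≤+ m≤n) = m≤n
-n≤i≤n⇒∣i∣≤n {ℤ.-[1+ m ]} {ℕ.suc n} (ℤ.-≤- m≤n) _            = ℕ.s≤s m≤n

crosses-left : ∀ {N e} c → IsSide e → Within N e → proj₁ (anchor c) ℤ.< ℤ.- ℤ.+ N →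
  crosses c e ≡ onEnds (λ (_ , y) → proj₂ (anchor c) <ᵇ y) e
crosses-left (△ (a , b)) (h , refl) (p , _ , _) a<-N
  rewrite <⇒<ᵇ (ℤ.<-≤-trans a<-N (∣i∣≤n⇒-n≤i (proj₁ (proj₁ (side h))) p)) =
  trans (∧-comm _ true) (side-rows h b)
crosses-left (▽ (a , b)) (h , refl) (_ , _ , p) a<-N
  rewrite <⇒<ᵇ (ℤ.<-≤-trans a<-N (∣i∣≤n⇒-n≤i (proj₁ (proj₂ (side h))) p)) =
  trans (∧-comm _ true) (side-rows h b)

crosses-bound : ∀ {N e} c → Within N e → crosses c e ≡ true →
  proj₁ (anchor c) ℤ.≤ ℤ.+ N × ℤ.∣ proj₂ (anchor c) ∣ ℕ.≤ N
crosses-bound {N} {(x , y) , (x′ , y′)} (△ (a , b)) (p , q , _) eq =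
  let yb , a<x = ∧-true {(y == b) ∧ (y′ == (1ℤ ℤ.+ b))} eq in
  ℤ.≤-trans (ℤ.<⇒≤ (<ᵇ⇒< a x a<x)) (∣i∣≤n⇒i≤n x p) ,
  subst (λ y → ℤ.∣ y ∣ ℕ.≤ N) (==⇒≡ y b (proj₁ (∧-true {y == b} yb))) q
crosses-bound {N} {(x , y) , (x′ , y′)} (▽ (a , b)) (_ , q , r) eq =
  let yb , a<x′ = ∧-true {(y == b) ∧ (y′ == (1ℤ ℤ.+ b))} eq in
  ℤ.≤-trans (ℤ.<⇒≤ (<ᵇ⇒< a x′ a<x′)) (∣i∣≤n⇒i≤n x′ r) ,
  subst (λ y → ℤ.∣ y ∣ ℕ.≤ N) (==⇒≡ y b (proj₁ (∧-true {y == b} yb))) q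

-- Far to the left a ray crosses a closed curve as often as the whole row of
-- cells does, which is an even number of times.
winding-bounded : ∀ {es} → All IsSide es → Closed es → Bounded (λ c → winding c es ≡ true)
winding-bounded {es} areSides closed with N , ws ← within es = N , bound
  where
  bound : ∀ c → winding c es ≡ true →
          ℤ.∣ proj₁ (anchor c) ∣ ℕ.≤ N × ℤ.∣ proj₂ (anchor c) ∣ ℕ.≤ N
  bound c w with parity-true (crosses c) es w
  ... | e , e∈es , ce with crosses-bound c (All.lookup ws e∈es) ce
  ... | a≤N , ∣b∣≤N with ℤ.- ℤ.+ N ℤ.≤? proj₁ (anchor c)
  ... | yes -N≤a = -n≤i≤n⇒∣i∣≤n -N≤a a≤N , ∣b∣≤N
  ... | no  -N≰a with () ← trans (sym w) (trans
    (parity-cong (crosses c) (onEnds (λ (_ , y) → proj₂ (anchor c) <ᵇ y)) (All.zipWith (λ (s , w) → crosses-left c s w (ℤ.≰⇒> -N≰a)) (areSides , ws)))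
    (closed (λ (_ , y) → proj₂ (anchor c) <ᵇ y)))

-- A step passes a side that is not drawn, along which the curve therefore never runs.
winding-step : ∀ ts {es y z} → All IsSide es → Closed es → All (_∈ edges ts) es →
               Step ts y z → winding y es ≡ winding z es
winding-step ts {es} {y} {z} areSides closed es⊆ (e , e∈y , e∈z , e∉)
  with k , refl ← ∈-sides⁻ y e∈y with k′ , eq ← ∈-sides⁻ z e∈z
  with side-injective (z , k′) (y , k) (sym eq)
... | inj₁ refl = refl
... | inj₂ eq′  = xor-≡ (trans
  (cong (λ h → winding y es xor winding (cell h) es) eq′)
  (trans (winding-flip areSides closed (y , k))
         (parity-false (_==ₛ side (y , k)) (All.map (λ {e′} e′∈ → ≢⇒==ₛ {e′} {side (y , k)} λ { refl → e∉ e′∈ }) es⊆))))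

winding-region : ∀ ts {es y z} → All IsSide es → Closed es → All (_∈ edges ts) es →
                 Region ts y z → winding y es ≡ winding z es
winding-region ts _ _ _ Star.ε = refl
winding-region ts s c i (st ◅ sts) = trans (winding-step ts s c i st) (winding-region ts s c i sts)

wound⇒bounded : ∀ ts {es c} → All IsSide es → Closed es → All (_∈ edges ts) es →
                winding c es ≡ true → Bounded (Region ts c)
wound⇒bounded ts s c i w with N , b ← winding-bounded s c =
  N , λ d r → b d (trans (sym (winding-region ts s c i r)) w)

-- Chains as ribbons

∈-edges⁺ : ∀ {ts c e} → c ∈ ts → e ∈ sides c → e ∈ edges ts
∈-edges⁺ c∈ts e∈c = ∈-deduplicate⁺ _≟ₛ_ (∈-concatMap⁺ sides (lose c∈ts e∈c))

∈-edges⁻ : ∀ ts {e} → e ∈ edges ts → ∃ λ c → c ∈ ts × e ∈ sides c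
∈-edges⁻ ts e∈ = find (∈-concatMap⁻ sides (∈-deduplicate⁻ _≟ₛ_ (concatMap sides ts) e∈))

∈-vertices⁺ : ∀ {ts c u} → c ∈ ts → u ∈ corners c → u ∈ vertices ts
∈-vertices⁺ c∈ts u∈c = ∈-deduplicate⁺ _≟ₚ_ (∈-concatMap⁺ corners (lose c∈ts u∈c))

∈-vertices⁻ : ∀ ts {u} → u ∈ vertices ts → ∃ λ c → c ∈ ts × u ∈ corners c
∈-vertices⁻ ts u∈ = find (∈-concatMap⁻ corners (∈-deduplicate⁻ _≟ₚ_ (concatMap corners ts) u∈))

edges-mono : ∀ {ts ts′} → (∀ {c} → c ∈ ts → c ∈ ts′) → ∀ {e} → e ∈ edges ts → e ∈ edges ts′
edges-mono {ts} i e∈ = let c , c∈ts , e∈c = ∈-edges⁻ ts e∈ in ∈-edges⁺ (i c∈ts) e∈c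

vertices-mono : ∀ {ts ts′} → (∀ {c} → c ∈ ts → c ∈ ts′) → ∀ {u} → u ∈ vertices ts → u ∈ vertices ts′
vertices-mono {ts} i u∈ = let c , c∈ts , u∈c = ∈-vertices⁻ ts u∈ in ∈-vertices⁺ (i c∈ts) u∈c

sharesSide-irrefl : ∀ {c} → ¬ SharesSide c c
sharesSide-irrefl (c≢c , _) = c≢c refl

sharesSide-sym : ∀ {c d} → SharesSide c d → SharesSide d c
sharesSide-sym (c≢d , e , e∈c , e∈d) = c≢d ∘ sym , e , e∈d , e∈c

sharesSide-flip : ∀ h → SharesSide (cell h) (cell (flip h))
sharesSide-flip h = cell-flip≢ h ∘ sym , side h , ∈-sides⁺ h ,
  subst (_∈ sides (cell (flip h))) (side-flip h) (∈-sides⁺ (flip h))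

side∈⇒ : ∀ h {c} → side h ∈ sides c → c ≡ cell h ⊎ c ≡ cell (flip h)
side∈⇒ h {c} e∈c with k , eq ← ∈-sides⁻ c e∈c with side-injective (c , k) h (sym eq)
... | inj₁ refl = inj₁ refl
... | inj₂ eq′  = inj₂ (cong cell eq′)

sharesSide⇒flip : ∀ {c d} → SharesSide c d → ∃ λ k → d ≡ cell (flip (c , k))
sharesSide⇒flip {c} (c≢d , e , e∈c , e∈d) with k , refl ← ∈-sides⁻ c e∈c with side∈⇒ (c , k) e∈d
... | inj₁ d≡c = ⊥-elim (c≢d (sym d≡c))
... | inj₂ eq  = k , eq

-- An inductive form of `Path`. Removing a cell from either end is then structural, with no indices
-- to shift.
data Thread : List Cell → Set where
  []   : Thread []
  [-]  : ∀ {c} → Thread (c ∷ [])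
  link : ∀ {c d cs} → SharesSide c d → All (λ e → ¬ SharesSide c e) cs →
         Thread (d ∷ cs) → Thread (c ∷ d ∷ cs)

Path : List Cell → Set
Path ts = ∀ i j → SharesSide (lookup ts i) (lookup ts j) ⇔ Consecutive i j

Regions : List Cell → Set
Regions ts = ∀ c → Bounded (Region ts c) → c ∈ ts

path⇒thread : ∀ ts → Path ts → Thread ts
path⇒thread []           _ = []
path⇒thread (c ∷ [])     _ = [-]
path⇒thread (c ∷ d ∷ cs) p = link
  (Equivalence.from (p zero (suc zero)) (inj₁ refl))
  (All.tabulate λ {e} e∈cs c~e → far (Equivalence.to (p zero (suc (suc (Any.index e∈cs))))
    (subst (SharesSide c) (lookup-index e∈cs) c~e)))
  (path⇒thread (d ∷ cs) λ i j → mk⇔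
    (consecutive-pred ∘ Equivalence.to (p (suc i) (suc j)))
    (Equivalence.from (p (suc i) (suc j)) ∘ consecutive-suc))
  where
  far : ∀ {n} {i : Fin n} → ¬ Consecutive zero (suc (suc i))
  far (inj₁ ())
  far (inj₂ ())
  consecutive-pred : ∀ {n} {i j : Fin n} → Consecutive (suc i) (suc j) → Consecutive i j
  consecutive-pred (inj₁ eq) = inj₁ (ℕ.suc-injective eq)
  consecutive-pred (inj₂ eq) = inj₂ (ℕ.suc-injective eq)
  consecutive-suc : ∀ {n} {i j : Fin n} → Consecutive i j → Consecutive (suc i) (suc j)
  consecutive-suc (inj₁ eq) = inj₁ (cong suc eq)
  consecutive-suc (inj₂ eq) = inj₂ (cong suc eq)

thread⇒path : ∀ ts → Thread ts → Path ts
thread⇒path ts th i j = mk⇔ (to ts th i j) (from ts th i j)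
  where
  to : ∀ ts → Thread ts → ∀ i j → SharesSide (lookup ts i) (lookup ts j) → Consecutive i j
  to (c ∷ _)      _               zero          zero          s = ⊥-elim (sharesSide-irrefl s)
  to (c ∷ d ∷ cs) _               zero          (suc zero)    s = inj₁ refl
  to (c ∷ d ∷ cs) (link _ far _)  zero          (suc (suc j)) s = ⊥-elim (All.lookup far (∈-lookup j) s)
  to (c ∷ d ∷ cs) _               (suc zero)    zero          s = inj₂ refl
  to (c ∷ d ∷ cs) (link _ far _)  (suc (suc i)) zero          s = ⊥-elim (All.lookup far (∈-lookup i) (sharesSide-sym s))
  to (c ∷ d ∷ cs) (link _ _ th)   (suc i)       (suc j)       s with to (d ∷ cs) th i j s
  ... | inj₁ eq = inj₁ (cong suc eq)
  ... | inj₂ eq = inj₂ (cong suc eq)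
  from : ∀ ts → Thread ts → ∀ i j → Consecutive i j → SharesSide (lookup ts i) (lookup ts j)
  from (c ∷ d ∷ cs) (link s _ _)  zero          (suc zero)    _ = s
  from (c ∷ d ∷ cs) (link s _ _)  (suc zero)    zero          _ = sharesSide-sym s
  from (c ∷ d ∷ cs) (link _ _ th) (suc i)       (suc j)       (inj₁ eq) = from (d ∷ cs) th i j (inj₁ (ℕ.suc-injective eq))
  from (c ∷ d ∷ cs) (link _ _ th) (suc i)       (suc j)       (inj₂ eq) = from (d ∷ cs) th i j (inj₂ (ℕ.suc-injective eq))
  from (c ∷ _)      _             zero          zero          (inj₁ ())
  from (c ∷ _)      _             zero          zero          (inj₂ ())
  from (c ∷ d ∷ cs) _             zero          (suc (suc j)) (inj₁ ())
  from (c ∷ d ∷ cs) _             zero          (suc (suc j)) (inj₂ ())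
  from (c ∷ d ∷ cs) _             (suc (suc i)) zero          (inj₁ ())
  from (c ∷ d ∷ cs) _             (suc (suc i)) zero          (inj₂ ())

record Chain (ts : List Cell) : Set where
  field
    unique  : Unique ts
    thread  : Thread ts
    regions : Regions ts

open Chain public

triangularChain⇒chain : ∀ {ts} → TriangularChain ts → Chain ts
triangularChain⇒chain {ts} tc = record
  { unique  = TriangularChain.distinct tc
  ; thread  = path⇒thread ts (TriangularChain.path tc)
  ; regions = TriangularChain.regions tc
  }

chain⇒triangularChain : ∀ {ts} → Chain ts → TriangularChain ts
chain⇒triangularChain {ts} ch = record
  { distinct = unique ch
  ; path     = thread⇒path ts (thread ch)
  ; regions  = regions ch
  }

-- Words of turns

data Turn : Set where
  left right : Turn

opposite : Turn → Turn
opposite left  = right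
opposite right = left

data SameOrOpposite (t : Turn) : Turn → Set where
  same : SameOrOpposite t t
  opp  : SameOrOpposite t (opposite t)

compare : ∀ t t′ → SameOrOpposite t t′
compare left  left  = same
compare left  right = opp
compare right left  = opp
compare right right = same

rotateBy : Turn → Kind → Kind
rotateBy left  k = rotate k
rotateBy right k = rotate (rotate k)

-- A half-edge g stands for leaving cell g through its side; step t g leaves
-- the next cell after a turn to t, that is, around the vertex pivot t g.
step : Turn → HalfEdge → HalfEdge
step t g = cell (flip g) , rotateBy t (proj₂ (flip g))

pivot : Turn → HalfEdge → Point
pivot left  = source
pivot right = target

-- The cell entered has three corners: the one turned around, the one left behind and a new one.
-- Seen from the next half-edge these are the pivot on the side of the turn, the apex and the other
-- pivot; the three lemmas from here on record this.
pivot-keep : ∀ t g → pivot t (step t g) ≡ pivot t g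
pivot-keep left  g = target-flip g
pivot-keep right g = trans (cong source (next³ (flip g))) (source-flip g)

pivot-fresh : ∀ t g → pivot (opposite t) (step t g) ≡ apex (flip g)
pivot-fresh left  g = refl
pivot-fresh right g = refl

apex-step : ∀ t g → apex (step t g) ≡ pivot (opposite t) g
apex-step left  g = trans (cong source (next³ (flip g))) (source-flip g)
apex-step right g = trans (cong (source ∘ next) (next³ (flip g))) (target-flip g)

rotateBy≢ : ∀ t k → rotateBy t k ≢ k
rotateBy≢ left  hor ()
rotateBy≢ left  dia ()
rotateBy≢ left  sla ()
rotateBy≢ right hor ()
rotateBy≢ right dia ()
rotateBy≢ right sla ()

rotateBy-injective : ∀ {t t′} k → rotateBy t k ≡ rotateBy t′ k → t ≡ t′
rotateBy-injective {left}  {left}  _   _ = refl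
rotateBy-injective {right} {right} _   _ = refl
rotateBy-injective {left}  {right} hor ()
rotateBy-injective {left}  {right} dia ()
rotateBy-injective {left}  {right} sla ()
rotateBy-injective {right} {left}  hor ()
rotateBy-injective {right} {left}  dia ()
rotateBy-injective {right} {left}  sla ()

step-injective : ∀ {t t′ g} → step t g ≡ step t′ g → t ≡ t′
step-injective {g = g} eq = rotateBy-injective (proj₂ (flip g)) (cong proj₂ eq)

kind-step : ∀ g k → k ≢ proj₂ (flip g) → ∃ λ t → (cell (flip g) , k) ≡ step t g
kind-step g k k≢ with rotation (cell (flip g)) (proj₂ (flip g)) k
... | rot₀ = ⊥-elim (k≢ refl)
... | rot₁ = left , refl
... | rot₂ = right , refl

Word : Set
Word = List Turn

beyond : HalfEdge → Word → List Cell
beyond g []      = []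
beyond g (t ∷ w) = cell (flip (step t g)) ∷ beyond (step t g) w

ribbon : HalfEdge → Word → List Cell
ribbon g w = cell g ∷ cell (flip g) ∷ beyond g w

-- The half-edge through which the last cell is entered; the last cell itself is that of
-- `flip (exit g w)`, and its apex is the last vertex.
exit : HalfEdge → Word → HalfEdge
exit g []      = g
exit g (t ∷ w) = exit (step t g) w

chain⇒ribbon : ∀ c d cs → Unique (c ∷ d ∷ cs) → Thread (c ∷ d ∷ cs) →
               ∃₂ λ g w → c ∷ d ∷ cs ≡ ribbon g w
chain⇒ribbon c d cs u th@(link s _ _) with k , refl ← sharesSide⇒flip s = (c , k) , go (c , k) cs u th
  where
  go : ∀ g cs → Unique (cell g ∷ cell (flip g) ∷ cs) → Thread (cell g ∷ cell (flip g) ∷ cs) →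
       ∃ λ w → cell g ∷ cell (flip g) ∷ cs ≡ ribbon g w
  go g [] _ _ = [] , refl
  go g (d ∷ cs) ((_ ∷ g≢d ∷ _) ∷ u) (link _ _ th@(link s _ _)) with k , refl ← sharesSide⇒flip s
    -- Leaving through the side of entry would lead back to `cell g`, contrary to uniqueness. The
    -- other two sides are the two turns.
    with kind-step g k (λ { refl → g≢d (sym (cong cell (flip-flip g))) })
  ... | t , refl with w , eq ← go (step t g) cs u th = t ∷ w , cong (cell g ∷_) eq

OnlyNeighbour : List Cell → HalfEdge → Set
OnlyNeighbour ts g = ∀ {c} → c ∈ ts → SharesSide (cell g) c → c ≡ cell (flip g)

first-neighbour : ∀ g w → Thread (ribbon g w) → OnlyNeighbour (ribbon g w) g
first-neighbour g w _              (here refl)         s = ⊥-elim (sharesSide-irrefl s)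
first-neighbour g w _              (there (here refl)) s = refl
first-neighbour g w (link _ far _) (there (there c∈))  s = ⊥-elim (All.lookup far c∈ s)

last-neighbour : ∀ g w → Thread (ribbon g w) →
  ∀ {c} → c ∈ ribbon g w → SharesSide (cell (flip (exit g w))) c → c ≡ cell (exit g w)
last-neighbour g []      _ (here refl)         s = refl
last-neighbour g []      _ (there (here refl)) s = ⊥-elim (sharesSide-irrefl s)
last-neighbour g (t ∷ w) (link _ far _) (here refl) s =
  ⊥-elim (All.lookup far (last∈ t g w) (sharesSide-sym s))
  where
  last∈ : ∀ t g w → cell (flip (exit (step t g) w)) ∈ beyond g (t ∷ w)
  last∈ t g []       = here refl
  last∈ t g (t′ ∷ w) = there (last∈ t′ (step t g) w)
last-neighbour g (t ∷ w) (link _ _ th)  (there c∈)  s = last-neighbour (step t g) w th c∈ s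

neighbour-∉ : ∀ {ts g k} → OnlyNeighbour ts g → k ≢ proj₂ g → cell (flip (cell g , k)) ∉ ts
neighbour-∉ {g = g} {k} only k≢ c∈ =
  k≢ (cell-flip-injective (cell g) (only c∈ (sharesSide-flip (cell g , k))))

side-∉ : ∀ {ts g k c} → OnlyNeighbour ts g → k ≢ proj₂ g → c ∈ ts → c ≢ cell g →
         side (cell g , k) ∉ sides c
side-∉ {ts} {g} {k} only k≢ c∈ts c≢g e∈c with side∈⇒ (cell g , k) e∈c
... | inj₁ eq = c≢g eq
... | inj₂ eq = neighbour-∉ {ts} {g} only k≢ (subst (_∈ ts) eq c∈ts)

-- Fewer cells draw fewer edges, so regions can only grow when cells are removed.
region-mono : ∀ {ts ts′} → (∀ {c} → c ∈ ts′ → c ∈ ts) → ∀ {c d} → Region ts c d → Region ts′ c d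
region-mono {ts} {ts′} i = Star.map λ (e , e∈c , e∈d , e∉) → e , e∈c , e∈d , e∉ ∘ edges-mono {ts′} {ts} i

-- Removing an end of a chain joins its cell to the region on the far side of
-- one of its free sides.
regions-drop : ∀ {ts ts′} g → (∀ {c} → c ∈ ts′ → c ∈ ts) → (∀ {c} → c ∈ ts → c ≡ cell g ⊎ c ∈ ts′) →
               cell g ∉ ts′ → OnlyNeighbour ts g → Regions ts → Regions ts′
regions-drop {ts} {ts′} g inc split g∉ only reg c (N , b)
  with split (reg c (N , λ d r → b d (region-mono {ts} {ts′} inc r)))
... | inj₂ c∈   = c∈
... | inj₁ refl = ⊥-elim (neighbour-∉ {ts} {g} only k≢ (reg outer (N , λ d r →
    b d (st ◅ region-mono {ts} {ts′} inc r))))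
  where
  k≢ : rotate (proj₂ g) ≢ proj₂ g
  k≢ = rotateBy≢ left (proj₂ g)
  outer = cell (flip (next g))
  st : Step ts′ (cell g) outer
  st = side (next g) , ∈-sides⁺ (next g) ,
    subst (_∈ sides outer) (side-flip (next g)) (∈-sides⁺ (flip (next g))) ,
    λ e∈ → let c , c∈ , e∈c = ∈-edges⁻ ts′ e∈ in
      side-∉ {ts} {g} only k≢ (inc c∈) (λ eq → g∉ (subst (_∈ ts′) eq c∈)) e∈c

chain-dropFirst : ∀ {g t w} → Chain (ribbon g (t ∷ w)) → Chain (ribbon (step t g) w)
chain-dropFirst {g} {t} {w} ch with unique ch | thread ch
... | g∉ ∷ u | th@(link _ _ th′) = record
  { unique  = u
  ; thread  = th′
  ; regions = regions-drop g there (λ { (here eq) → inj₁ eq ; (there c∈) → inj₂ c∈ })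
                (λ g∈ → All.lookup g∉ g∈ refl) (first-neighbour g (t ∷ w) th) (regions ch)
  }

beyond-∷ʳ : ∀ g w t → beyond g (w ∷ʳ t) ≡ beyond g w ∷ʳ cell (flip (exit g (w ∷ʳ t)))
beyond-∷ʳ g []       t = refl
beyond-∷ʳ g (t′ ∷ w) t = cong (cell (flip (step t′ g)) ∷_) (beyond-∷ʳ (step t′ g) w t)

ribbon-∷ʳ : ∀ g w t → ribbon g (w ∷ʳ t) ≡ ribbon g w ∷ʳ cell (flip (exit g (w ∷ʳ t)))
ribbon-∷ʳ g w t = cong (λ cs → cell g ∷ cell (flip g) ∷ cs) (beyond-∷ʳ g w t)

unique-∷ʳ⁻ : ∀ {A : Set} {xs : List A} {x} → Unique (xs ∷ʳ x) → Unique xs × x ∉ xs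
unique-∷ʳ⁻ {xs = []}     _        = [] , λ ()
unique-∷ʳ⁻ {xs = y ∷ xs} (y∉ ∷ u) with u′ , x∉ ← unique-∷ʳ⁻ {xs = xs} u =
  (All.tabulate λ z∈ → All.lookup y∉ (∈-++⁺ˡ z∈)) ∷ u′ ,
  λ { (here refl) → All.lookup y∉ (∈-++⁺ʳ xs (here refl)) refl ; (there x∈) → x∉ x∈ }

thread-∷ʳ⁻ : ∀ {cs c} → Thread (cs ∷ʳ c) → Thread cs
thread-∷ʳ⁻ {[]}          _ = []
thread-∷ʳ⁻ {d ∷ []}      _ = [-]
thread-∷ʳ⁻ {d ∷ e ∷ cs} (link s far th) =
  link s (All.tabulate λ z∈ → All.lookup far (∈-++⁺ˡ z∈)) (thread-∷ʳ⁻ th)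

chain-dropLast : ∀ {g w t} → Chain (ribbon g (w ∷ʳ t)) → Chain (ribbon g w)
chain-dropLast {g} {w} {t} ch = record
  { unique  = proj₁ u
  ; thread  = thread-∷ʳ⁻ {ribbon g w} (subst Thread (ribbon-∷ʳ g w t) (thread ch))
  ; regions = regions-drop h
      (λ {c} c∈ → subst (c ∈_) (sym (ribbon-∷ʳ g w t)) (∈-++⁺ˡ c∈))
      (λ {c} c∈ → split (∈-++⁻ (ribbon g w) (subst (c ∈_) (ribbon-∷ʳ g w t) c∈)))
      (proj₂ u)
      (λ c∈ s → trans (last-neighbour g (w ∷ʳ t) (thread ch) c∈ s)
                      (cong cell (sym (flip-flip (exit g (w ∷ʳ t))))))
      (regions ch)
  }
  where
  h = flip (exit g (w ∷ʳ t))
  u = unique-∷ʳ⁻ {xs = ribbon g w} (subst Unique (ribbon-∷ʳ g w t) (unique ch))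
  split : ∀ {c} → c ∈ ribbon g w ⊎ c ∈ cell h ∷ [] → c ≡ cell h ⊎ c ∈ ribbon g w
  split (inj₁ c∈)        = inj₂ c∈
  split (inj₂ (here eq)) = inj₁ eq

chain-prefix : ∀ {g w} w′ → Chain (ribbon g (w ++ w′)) → Chain (ribbon g w)
chain-prefix {g} {w} []       ch = subst (Chain ∘ ribbon g) (++-identityʳ w) ch
chain-prefix {g} {w} (t ∷ w′) ch =
  chain-dropLast (chain-prefix w′ (subst (Chain ∘ ribbon g) (sym (∷ʳ-++ w t w′)) ch))

-- Chains do not return

-- The border of a ribbon falls into two walks from the apex of the first cell
-- to that of the last, on either hand; outer t g is the first side.
outer : Turn → HalfEdge → HalfEdge
outer t g = cell g , rotateBy (opposite t) (proj₂ g)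

-- A turn about its own vertex leaves a hand where it is. A turn about the other hand's vertex moves
-- it to the new vertex, along the side through which the chain does not leave.
walk : Turn → HalfEdge → Word → List Side
walk left  g []          = side (step left g) ∷ []
walk left  g (left  ∷ w) = walk left (step left g) w
walk left  g (right ∷ w) = side (step left g) ∷ walk left (step right g) w
walk right g []          = side (step right g) ∷ []
walk right g (left  ∷ w) = side (step right g) ∷ walk right (step left g) w
walk right g (right ∷ w) = walk right (step right g) w

loop : Turn → HalfEdge → Word → List Side
loop t g w = side (outer t g) ∷ walk t g w

walk-sides : ∀ t g w → All IsSide (walk t g w)
walk-sides left  g []          = (_ , refl) ∷ []
walk-sides left  g (left  ∷ w) = walk-sides left (step left g) w
walk-sides left  g (right ∷ w) = (_ , refl) ∷ walk-sides left (step right g) w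
walk-sides right g []          = (_ , refl) ∷ []
walk-sides right g (left  ∷ w) = (_ , refl) ∷ walk-sides right (step left g) w
walk-sides right g (right ∷ w) = walk-sides right (step right g) w

onEnds-side : ∀ f h → onEnds f (side h) ≡ f (source h) xor f (target h)
onEnds-side f h with side-ends h
... | inj₁ eq = cong (onEnds f) eq
... | inj₂ eq = trans (cong (onEnds f) eq) (xor-comm (f (target h)) (f (source h)))

onEnds-step : ∀ f t g → onEnds f (side (step t g)) ≡ f (pivot t g) xor f (apex (flip g))
onEnds-step f left  g = trans (onEnds-side f (step left g)) (cong₂ _xor_ (cong f (pivot-keep left g)) refl)
onEnds-step f right g = trans (onEnds-side f (step right g))
  (trans (xor-comm (f (source (step right g))) _) (cong₂ _xor_ (cong f (pivot-keep right g)) refl))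

onEnds-outer : ∀ f t g → onEnds f (side (outer t g)) ≡ f (apex g) xor f (pivot t g)
onEnds-outer f left  g = trans (onEnds-side f (outer left g)) (cong (λ h → f (apex g) xor f (source h)) (next³ g))
onEnds-outer f right g = trans (onEnds-side f (outer right g)) (xor-comm (f (target g)) (f (apex g)))

xor-cancel : ∀ a b c → (a xor b) xor (b xor c) ≡ a xor c
xor-cancel false false _ = refl
xor-cancel true  false _ = refl
xor-cancel false true  c = not-involutive c
xor-cancel true  true  _ = refl

-- Telescoping modulo 2: each intermediate vertex is counted twice.
walk-ends : ∀ f t g w → parity (onEnds f) (walk t g w) ≡ f (pivot t g) xor f (apex (flip (exit g w)))
walk-ends f left g [] = trans (xor-comm (onEnds f (side (step left g))) false) (onEnds-step f left g)
walk-ends f right g [] = trans (xor-comm (onEnds f (side (step right g))) false) (onEnds-step f right g)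
walk-ends f left g (left ∷ w) = trans (walk-ends f left (step left g) w) (cong₂ _xor_ (cong f (pivot-keep left g)) refl)
walk-ends f right g (right ∷ w) = trans (walk-ends f right (step right g) w) (cong₂ _xor_ (cong f (pivot-keep right g)) refl)
walk-ends f left g (right ∷ w) = trans
  (cong₂ _xor_ (onEnds-step f left g) (walk-ends f left (step right g) w))
  (xor-cancel (f (source g)) (f (apex (flip g))) _)
walk-ends f right g (left ∷ w) = trans
  (cong₂ _xor_ (onEnds-step f right g) (walk-ends f right (step left g) w))
  (xor-cancel (f (target g)) (f (apex (flip g))) _)

loop-closed : ∀ t g w → apex (flip (exit g w)) ≡ apex g → Closed (loop t g w)
loop-closed t g w eq f = begin
  onEnds f (side (outer t g)) xor parity (onEnds f) (walk t g w)
    ≡⟨ cong₂ _xor_ (onEnds-outer f t g) (walk-ends f t g w) ⟩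
  (f (apex g) xor f (pivot t g)) xor (f (pivot t g) xor f (apex (flip (exit g w))))
    ≡⟨ xor-cancel (f (apex g)) (f (pivot t g)) _ ⟩
  f (apex g) xor f (apex (flip (exit g w)))
    ≡⟨ cong (λ u → f (apex g) xor f u) eq ⟩
  f (apex g) xor f (apex g) ≡⟨ xor-same (f (apex g)) ⟩
  false ∎
  where open ≡-Reasoning

step-side∈ : ∀ t g → side (step t g) ∈ sides (cell (flip g))
step-side∈ t g = ∈-sides⁺ (step t g)

walk-cells : ∀ t g w → All (λ e → ∃ λ c → c ∈ cell (flip g) ∷ beyond g w × e ∈ sides c) (walk t g w)
walk-cells left  g []          = (_ , here refl , step-side∈ left g) ∷ []
walk-cells right g []          = (_ , here refl , step-side∈ right g) ∷ []
walk-cells left  g (left  ∷ w) = All.map (λ (c , c∈ , e∈) → c , there c∈ , e∈) (walk-cells left (step left g) w)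
walk-cells left  g (right ∷ w) = (_ , here refl , step-side∈ left g) ∷
  All.map (λ (c , c∈ , e∈) → c , there c∈ , e∈) (walk-cells left (step right g) w)
walk-cells right g (left  ∷ w) = (_ , here refl , step-side∈ right g) ∷
  All.map (λ (c , c∈ , e∈) → c , there c∈ , e∈) (walk-cells right (step left g) w)
walk-cells right g (right ∷ w) = All.map (λ (c , c∈ , e∈) → c , there c∈ , e∈) (walk-cells right (step right g) w)

loop-edges : ∀ t g w → All (_∈ edges (ribbon g w)) (loop t g w)
loop-edges t g w = ∈-edges⁺ {ribbon g w} (here refl) (∈-sides⁺ (outer t g)) ∷
  All.map (λ (c , c∈ , e∈) → ∈-edges⁺ {ribbon g w} (there c∈) e∈) (walk-cells t g w)

-- The three sides of a cell other than c are crossed an even number of times in all, so two of them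
-- may be traded for the third.
around-step : ∀ {c g} → c ≢ cell (flip g) →
  crosses c (side (step left g)) xor crosses c (side (step right g)) ≡ crosses c (side g)
around-step {c} {g} c≢ = sym (xor-≡ (trans
  (cong₂ _xor_ (cong (crosses c) (sym (side-flip g))) refl) (around-other {c} {flip g} c≢)))

-- Modulo 2 the two walks together with side g bound the cells after the first,
-- so no ray from another cell crosses the whole an odd number of times.
walks-winding : ∀ {c} g w → c ∉ cell (flip g) ∷ beyond g w →
  winding c (walk left g w) xor winding c (walk right g w) ≡ crosses c (side g)
walks-winding {c} g [] c∉ = trans
  (cong₂ _xor_ (xor-comm (crosses c (side (step left g))) false) (xor-comm (crosses c (side (step right g))) false))
  (around-step (c∉ ∘ here))
walks-winding {c} g (left ∷ w) c∉ = begin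
  l xor (q xor r) ≡⟨ cong (l xor_) (xor-comm q r) ⟩
  l xor (r xor q) ≡⟨ xor-assoc l r q ⟨
  (l xor r) xor q ≡⟨ cong (_xor q) (walks-winding (step left g) w (c∉ ∘ there)) ⟩
  crosses c (side (step left g)) xor q ≡⟨ around-step (c∉ ∘ here) ⟩
  crosses c (side g) ∎
  where
  open ≡-Reasoning
  q = crosses c (side (step right g))
  l = winding c (walk left (step left g) w)
  r = winding c (walk right (step left g) w)
walks-winding {c} g (right ∷ w) c∉ = begin
  (q xor l) xor r ≡⟨ xor-assoc q l r ⟩
  q xor (l xor r) ≡⟨ cong (q xor_) (walks-winding (step right g) w (c∉ ∘ there)) ⟩
  q xor crosses c (side (step right g)) ≡⟨ around-step (c∉ ∘ here) ⟩
  crosses c (side g) ∎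
  where
  open ≡-Reasoning
  q = crosses c (side (step left g))
  l = winding c (walk left (step right g) w)
  r = winding c (walk right (step right g) w)

-- By `walks-winding` the two walks together count like `side g`; with the two outer sides that
-- makes up the border of the first cell, around which it winds once.
loops-winding : ∀ g w → cell g ∉ cell (flip g) ∷ beyond g w →
  winding (cell g) (loop left g w) xor winding (cell g) (loop right g w) ≡ true
loops-winding g w g∉ = begin
  (r xor l′) xor (q xor r′)   ≡⟨ xor-interchange r l′ q r′ ⟩
  (r xor q) xor (l′ xor r′)   ≡⟨ cong ((r xor q) xor_) (walks-winding g w g∉) ⟩
  (r xor q) xor p             ≡⟨ xor-comm (r xor q) p ⟩
  p xor (r xor q)             ≡⟨ cong (p xor_) (xor-comm r q) ⟩
  p xor (q xor r)             ≡⟨ around-self g ⟩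
  true                        ∎
  where
  open ≡-Reasoning
  p  = crosses (cell g) (side g)
  q  = crosses (cell g) (side (next g))
  r  = crosses (cell g) (side (next (next g)))
  l′ = winding (cell g) (walk left g w)
  r′ = winding (cell g) (walk right g w)

first∉ : ∀ {c cs} → Chain (c ∷ cs) → c ∉ cs
first∉ ch c∈ with c∉ ∷ _ ← unique ch = All.lookup c∉ c∈ refl

-- The outer side occurs exactly once: all other sides of the loop belong to later cells, and the
-- outer side is shared with none of these.
loop-through : ∀ t g w → Chain (ribbon g w) → parity (_==ₛ side (outer t g)) (loop t g w) ≡ true
loop-through t g w ch = cong₂ _xor_ (==ₛ-refl (side (outer t g)))
  (parity-false (_==ₛ side (outer t g)) (All.map
    (λ {e} (c , c∈ , e∈c) → ≢⇒==ₛ {e} {side (outer t g)} λ { refl →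
      side-∉ {ribbon g w} {g} (first-neighbour g w (thread ch)) (rotateBy≢ (opposite t) (proj₂ g))
        (there c∈) (λ { refl → first∉ ch c∈ }) e∈c })
    (walk-cells t g w)))

-- A chain that came back to its first apex would enclose the cell across a
-- free side of its first cell.
loop-encloses : ∀ t g w → Chain (ribbon g w) → apex (flip (exit g w)) ≡ apex g →
                winding (cell g) (loop t g w) ≢ false
loop-encloses t g w ch eq w≡false =
  neighbour-∉ {ribbon g w} {g} (first-neighbour g w (thread ch)) (rotateBy≢ (opposite t) (proj₂ g))
    (regions ch _ (wound⇒bounded (ribbon g w) isSides closed (loop-edges t g w) wound))
  where
  isSides = (_ , refl) ∷ walk-sides t g w
  closed  = loop-closed t g w eq
  wound : winding (cell (flip (outer t g))) (loop t g w) ≡ true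
  wound = trans (cong (_xor winding (cell (flip (outer t g))) (loop t g w)) (sym w≡false))
    (trans (winding-flip isSides closed (outer t g)) (loop-through t g w ch))

-- `loops-winding` makes the winding around the first cell even for one of the two loops, which
-- `loop-encloses` rules out.
no-return : ∀ g w → Chain (ribbon g w) → apex (flip (exit g w)) ≢ apex g
no-return g w ch eq
  with winding (cell g) (loop left g w) in wl | winding (cell g) (loop right g w) in wr
     | loops-winding g w (first∉ ch)
... | false | true  | _ = loop-encloses left g w ch eq wl
... | true  | false | _ = loop-encloses right g w ch eq wr

-- Vertices, edges and degrees

verts : HalfEdge → Word → List Point
verts g []      = apex g ∷ source g ∷ target g ∷ apex (flip g) ∷ []
verts g (t ∷ w) = apex g ∷ verts (step t g) w

apex≢pivot : ∀ t g → apex g ≢ pivot t g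
apex≢pivot left  = apex≢source
apex≢pivot right = apex≢target

tip≢pivot : ∀ t g → apex (flip g) ≢ pivot t g
tip≢pivot left  g eq = apex≢target (flip g) (trans eq (sym (target-flip g)))
tip≢pivot right g eq = apex≢source (flip g) (trans eq (sym (source-flip g)))

opposite² : ∀ t → opposite (opposite t) ≡ t
opposite² left  = refl
opposite² right = refl

-- Every vertex away from the first cell is the tip of some prefix of the chain. Since prefixes of
-- chains are chains, this is the form to which `no-return` applies.
data Position (g : HalfEdge) (w : Word) : Point → Set where
  atApex  : Position g w (apex g)
  atPivot : ∀ t → Position g w (pivot t g)
  atTip   : ∀ w₁ w₂ → w₁ ++ w₂ ≡ w → Position g w (apex (flip (exit g w₁)))

position : ∀ g w {u} → u ∈ verts g w → Position g w u
position g []      (here refl)                         = atApex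
position g []      (there (here refl))                 = atPivot left
position g []      (there (there (here refl)))         = atPivot right
position g []      (there (there (there (here refl)))) = atTip [] [] refl
position g (t ∷ w) (here refl)                         = atApex
position g (t ∷ w) (there u∈) with position (step t g) w u∈
... | atApex = subst (Position g (t ∷ w)) (sym (apex-step t g)) (atPivot (opposite t))
... | atTip w₁ w₂ eq = atTip (t ∷ w₁) w₂ (cong (t ∷_) eq)
... | atPivot t′ with compare t t′
...   | same = subst (Position g (t ∷ w)) (sym (pivot-keep t g)) (atPivot t)
...   | opp  = subst (Position g (t ∷ w)) (sym (pivot-fresh t g)) (atTip [] (t ∷ w) refl)

-- A later vertex is either an end of the first exit side, and distinct from the apex within one
-- cell, or a tip, and distinct from it by `no-return` for a prefix.
verts-unique : ∀ g w → Chain (ribbon g w) → Unique (verts g w)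
verts-unique g [] ch =
  (apex≢source g ∷ apex≢target g ∷ (no-return g [] ch ∘ sym) ∷ []) ∷
  (source≢target g ∷ (tip≢pivot left g ∘ sym) ∷ []) ∷
  ((tip≢pivot right g ∘ sym) ∷ []) ∷ [] ∷ []
verts-unique g (t ∷ w) ch =
  All.tabulate (λ u∈ → fresh (position (step t g) w u∈)) ∷ verts-unique (step t g) w (chain-dropFirst {g} {t} {w} ch)
  where
  fresh : ∀ {u} → Position (step t g) w u → apex g ≢ u
  fresh atApex eq = apex≢pivot (opposite t) g (trans eq (apex-step t g))
  fresh (atTip w₁ w₂ refl) eq = no-return g (t ∷ w₁) (chain-prefix {w = t ∷ w₁} w₂ ch) (sym eq)
  fresh (atPivot t′) eq with compare t t′
  ... | same = apex≢pivot t g (trans eq (pivot-keep t g))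
  ... | opp  = no-return g [] (chain-prefix {w = []} (t ∷ w) ch) (sym (trans eq (pivot-fresh t g)))

apex∈verts : ∀ g w → apex g ∈ verts g w
apex∈verts g []      = here refl
apex∈verts g (_ ∷ _) = here refl

pivot∈verts : ∀ t g w → pivot t g ∈ verts g w
pivot∈verts left  g [] = there (here refl)
pivot∈verts right g [] = there (there (here refl))
pivot∈verts t g (t′ ∷ w) with compare t t′
... | same = there (subst (_∈ verts (step t g) w) (pivot-keep t g) (pivot∈verts t (step t g) w))
... | opp  = there (subst (_∈ verts (step (opposite t) g) w)
  (trans (apex-step (opposite t) g) (cong (λ t → pivot t g) (opposite² t))) (apex∈verts (step (opposite t) g) w))

∈-verts⁺ : ∀ g w {c u} → c ∈ ribbon g w → u ∈ corners c → u ∈ verts g w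
∈-verts⁺ g w (here refl) u∈c with k , refl ← ∈-corners⁻ (cell g) u∈c with rotation (cell g) (proj₂ g) k
... | rot₀ = pivot∈verts left g w
... | rot₁ = pivot∈verts right g w
... | rot₂ = apex∈verts g w
∈-verts⁺ g [] (there (here refl)) u∈c
  with k , refl ← ∈-corners⁻ (cell (flip g)) u∈c with rotation (cell (flip g)) (proj₂ (flip g)) k
... | rot₀ = there (there (here (source-flip g)))
... | rot₁ = there (here (target-flip g))
... | rot₂ = there (there (there (here refl)))
∈-verts⁺ g (t ∷ w) (there c∈) u∈c = there (∈-verts⁺ (step t g) w c∈ u∈c)

∈-verts⁻ : ∀ g w {u} → u ∈ verts g w → ∃ λ c → c ∈ ribbon g w × u ∈ corners c
∈-verts⁻ g []      (here refl)                         = _ , here refl , ∈-corners⁺ (next (next g))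
∈-verts⁻ g []      (there (here refl))                 = _ , here refl , ∈-corners⁺ g
∈-verts⁻ g []      (there (there (here refl)))         = _ , here refl , ∈-corners⁺ (next g)
∈-verts⁻ g []      (there (there (there (here refl)))) = _ , there (here refl) , ∈-corners⁺ (next (next (flip g)))
∈-verts⁻ g (t ∷ w) (here refl)                         = _ , here refl , ∈-corners⁺ (next (next g))
∈-verts⁻ g (t ∷ w) (there u∈) with c , c∈ , u∈c ← ∈-verts⁻ (step t g) w u∈ = c , there c∈ , u∈c

vertices⇒verts : ∀ g w {u} → u ∈ vertices (ribbon g w) → u ∈ verts g w
vertices⇒verts g w u∈ with c , c∈ , u∈c ← ∈-vertices⁻ (ribbon g w) u∈ = ∈-verts⁺ g w c∈ u∈c

verts⇒vertices : ∀ g w {u} → u ∈ verts g w → u ∈ vertices (ribbon g w)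
verts⇒vertices g w u∈ with c , c∈ , u∈c ← ∈-verts⁻ g w u∈ = ∈-vertices⁺ {ribbon g w} c∈ u∈c

-- Edges of a ribbon and degrees read off the word

Joins : Side → Point → Point → Set
Joins e p q = e ≡ (p , q) ⊎ e ≡ (q , p)

Incident : Point → Side → Set
Incident u e = u ≡ proj₁ e ⊎ u ≡ proj₂ e

incident⇒ : ∀ {e p q u} → Joins e p q → Incident u e → u ≡ p ⊎ u ≡ q
incident⇒ (inj₁ refl) i         = i
incident⇒ (inj₂ refl) (inj₁ eq) = inj₂ eq
incident⇒ (inj₂ refl) (inj₂ eq) = inj₁ eq

incident⇐ : ∀ {e p q u} → Joins e p q → u ≡ p ⊎ u ≡ q → Incident u e
incident⇐ (inj₁ refl) i         = i
incident⇐ (inj₂ refl) (inj₁ eq) = inj₂ eq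
incident⇐ (inj₂ refl) (inj₂ eq) = inj₁ eq

joins-≢ : ∀ {e e′ p q p′ q′} → Joins e p q → Joins e′ p′ q′ → q ≢ p′ → q ≢ q′ → e ≢ e′
joins-≢ j j′ q≢p′ q≢q′ refl with incident⇒ j′ (incident⇐ j (inj₂ refl))
... | inj₁ eq = q≢p′ eq
... | inj₂ eq = q≢q′ eq

joins-sym : ∀ {e p q} → Joins e p q → Joins e q p
joins-sym (inj₁ eq) = inj₂ eq
joins-sym (inj₂ eq) = inj₁ eq

outer-joins : ∀ t g → Joins (side (outer t g)) (apex g) (pivot t g)
outer-joins left  g = subst (λ h → Joins (side (outer left g)) (apex g) (source h)) (next³ g) (side-ends (outer left g))
outer-joins right g = joins-sym (side-ends (outer right g))

step-joins : ∀ t g → Joins (side (step t g)) (pivot t g) (apex (flip g))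
step-joins left  g = subst (λ u → Joins (side (step left g)) u (apex (flip g))) (pivot-keep left g) (side-ends (step left g))
step-joins right g = subst (λ u → Joins (side (step right g)) u (apex (flip g))) (pivot-keep right g) (joins-sym (side-ends (step right g)))

-- The side of entry becomes an outer side once the first cell is gone. Hence `edgeList` spends only
-- two sides on each cell and names `side g` itself only for the last two cells.
outer-step : ∀ t g → outer t (step t g) ≡ flip g
outer-step left  g = next³ (flip g)
outer-step right g = next³ (flip g)

edgeList : HalfEdge → Word → List Side
edgeList g []      = side (outer left g) ∷ side (outer right g) ∷ side g ∷ side (step left g) ∷ side (step right g) ∷ []
edgeList g (t ∷ w) = side (outer left g) ∷ side (outer right g) ∷ edgeList (step t g) w

side∈edgeList : ∀ g w → side g ∈ edgeList g w
outer∈edgeList : ∀ t g w → side (outer t g) ∈ edgeList g w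

outer∈edgeList left  g []      = here refl
outer∈edgeList left  g (_ ∷ _) = here refl
outer∈edgeList right g []      = there (here refl)
outer∈edgeList right g (_ ∷ _) = there (here refl)

side∈edgeList g []      = there (there (here refl))
side∈edgeList g (t ∷ w) = there (there (subst (_∈ edgeList (step t g) w)
  (trans (cong side (outer-step t g)) (side-flip g)) (outer∈edgeList t (step t g) w)))

∈-edgeList⁺ : ∀ g w {c e} → c ∈ ribbon g w → e ∈ sides c → e ∈ edgeList g w
∈-edgeList⁺ g w (here refl) e∈c with k , refl ← ∈-sides⁻ (cell g) e∈c with rotation (cell g) (proj₂ g) k
... | rot₀ = side∈edgeList g w
... | rot₁ = outer∈edgeList right g w
... | rot₂ = outer∈edgeList left g w
∈-edgeList⁺ g [] (there (here refl)) e∈c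
  with k , refl ← ∈-sides⁻ (cell (flip g)) e∈c with rotation (cell (flip g)) (proj₂ (flip g)) k
... | rot₀ = there (there (here (side-flip g)))
... | rot₁ = there (there (there (here refl)))
... | rot₂ = there (there (there (there (here refl))))
∈-edgeList⁺ g (t ∷ w) (there c∈) e∈c = there (there (∈-edgeList⁺ (step t g) w c∈ e∈c))

∈-edgeList⁻ : ∀ g w {e} → e ∈ edgeList g w → ∃ λ c → c ∈ ribbon g w × e ∈ sides c
∈-edgeList⁻ g []      (here refl)                         = _ , here refl , ∈-sides⁺ (outer left g)
∈-edgeList⁻ g []      (there (here refl))                 = _ , here refl , ∈-sides⁺ (outer right g)
∈-edgeList⁻ g []      (there (there (here refl)))         = _ , here refl , ∈-sides⁺ g
∈-edgeList⁻ g []      (there (there (there (here refl)))) = _ , there (here refl) , ∈-sides⁺ (step left g)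
∈-edgeList⁻ g []      (there (there (there (there (here refl))))) = _ , there (here refl) , ∈-sides⁺ (step right g)
∈-edgeList⁻ g (t ∷ w) (here refl)                         = _ , here refl , ∈-sides⁺ (outer left g)
∈-edgeList⁻ g (t ∷ w) (there (here refl))                 = _ , here refl , ∈-sides⁺ (outer right g)
∈-edgeList⁻ g (t ∷ w) (there (there e∈)) with c , c∈ , e∈c ← ∈-edgeList⁻ (step t g) w e∈ = c , there c∈ , e∈c

incident-corner : ∀ {c e u} → e ∈ sides c → Incident u e → u ∈ corners c
incident-corner {c} e∈c i with k , refl ← ∈-sides⁻ c e∈c with incident⇒ (side-ends (c , k)) i
... | inj₁ refl = ∈-corners⁺ (c , k)
... | inj₂ refl = ∈-corners⁺ (next (c , k))

edgeList-ends : ∀ g w {e u} → e ∈ edgeList g w → Incident u e → u ∈ verts g w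
edgeList-ends g w e∈ i with c , c∈ , e∈c ← ∈-edgeList⁻ g w e∈ = ∈-verts⁺ g w c∈ (incident-corner e∈c i)

edgeList-unique : ∀ g w → Unique (verts g w) → Unique (edgeList g w)
edgeList-unique g [] ((_ ∷ _ ∷ a≢tip ∷ []) ∷ _) =
  (joins-≢ (outer-joins left g) (outer-joins right g) (apex≢source g ∘ sym) (source≢target g) ∷
   apex∉ left (side-ends g) (apex≢source g) (apex≢target g) ∷
   apex∉ left (step-joins left g) (apex≢source g) a≢tip ∷
   apex∉ left (step-joins right g) (apex≢target g) a≢tip ∷ []) ∷
  (apex∉ right (side-ends g) (apex≢source g) (apex≢target g) ∷
   apex∉ right (step-joins left g) (apex≢source g) a≢tip ∷
   apex∉ right (step-joins right g) (apex≢target g) a≢tip ∷ []) ∷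
  (tip∉ left ∷ tip∉ right ∷ []) ∷
  (joins-≢ (joins-sym (step-joins left g)) (step-joins right g) (source≢target g) (tip≢pivot left g ∘ sym) ∷ []) ∷
  [] ∷ []
  where
  apex∉ : ∀ t {e p q} → Joins e p q → apex g ≢ p → apex g ≢ q → side (outer t g) ≢ e
  apex∉ t j = joins-≢ (joins-sym (outer-joins t g)) j
  tip∉ : ∀ t → side g ≢ side (step t g)
  tip∉ t = joins-≢ (step-joins t g) (side-ends g) (tip≢pivot left g) (tip≢pivot right g) ∘ sym
edgeList-unique g (t ∷ w) (apex∉ ∷ u) =
  (joins-≢ (outer-joins left g) (outer-joins right g) (apex≢source g ∘ sym) (source≢target g) ∷ fresh left) ∷
  fresh right ∷ edgeList-unique (step t g) w u
  where
  fresh : ∀ t′ → All (side (outer t′ g) ≢_) (edgeList (step t g) w)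
  fresh t′ = All.tabulate λ { e∈ refl → All.lookup apex∉
    (edgeList-ends (step t g) w e∈ (incident⇐ (outer-joins t′ g) (inj₁ refl))) refl }

-- Two lists without repetitions and with the same members are permutations of each other; from here
-- on the deduplicated list is replaced by one that follows the word.
edges-↭ : ∀ g w → Unique (verts g w) → edges (ribbon g w) ↭ edgeList g w
edges-↭ g w u = ∼bag⇒↭ (unique∧set⇒bag (deduplicate-! _≟ₛ_ (concatMap sides (ribbon g w))) (edgeList-unique g w u)
  (mk⇔ (λ e∈ → let c , c∈ , e∈c = ∈-edges⁻ (ribbon g w) e∈ in ∈-edgeList⁺ g w c∈ e∈c)
       (λ e∈ → let c , c∈ , e∈c = ∈-edgeList⁻ g w e∈ in ∈-edges⁺ {ribbon g w} c∈ e∈c)))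

incident? : ∀ u e → Dec (Incident u e)
incident? u e = (u ≟ₚ proj₁ e) ⊎-dec (u ≟ₚ proj₂ e)

incidence : Point → List Side → ℕ
incidence u es = length (filter (incident? u) es)

degree≡incidence : ∀ g w → Unique (verts g w) → ∀ u → degree (ribbon g w) u ≡ incidence u (edgeList g w)
degree≡incidence g w uniq u = ↭-length (filter-↭ (incident? u) (edges-↭ g w uniq))

incidence-++ : ∀ u es es′ → incidence u (es ++ es′) ≡ incidence u es ℕ.+ incidence u es′
incidence-++ u es es′ = trans (cong length (filter-++ (incident? u) es es′)) (length-++ (filter (incident? u) es))

incidence-yes : ∀ {e p q u} es → Joins e p q → u ≡ p ⊎ u ≡ q → incidence u (e ∷ es) ≡ suc (incidence u es)
incidence-yes {u = u} es j i = cong length (filter-accept (incident? u) (incident⇐ j i))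

incidence-no : ∀ {e p q u} es → Joins e p q → u ≢ p → u ≢ q → incidence u (e ∷ es) ≡ incidence u es
incidence-no {u = u} es j u≢p u≢q = cong length (filter-reject (incident? u) λ i → no-end (incident⇒ j i))
  where
  no-end : ¬ (u ≡ _ ⊎ u ≡ _)
  no-end (inj₁ eq) = u≢p eq
  no-end (inj₂ eq) = u≢q eq

outers : HalfEdge → List Side → List Side
outers g es = side (outer left g) ∷ side (outer right g) ∷ es

incidence-outers-apex : ∀ g es → incidence (apex g) (outers g es) ≡ 2 ℕ.+ incidence (apex g) es
incidence-outers-apex g es = trans
  (incidence-yes (side (outer right g) ∷ es) (outer-joins left g) (inj₁ refl))
  (cong suc (incidence-yes es (outer-joins right g) (inj₁ refl)))

incidence-outers-pivot : ∀ t g es → incidence (pivot t g) (outers g es) ≡ suc (incidence (pivot t g) es)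
incidence-outers-pivot left g es = trans
  (incidence-yes (side (outer right g) ∷ es) (outer-joins left g) (inj₂ refl))
  (cong suc (incidence-no es (outer-joins right g) (apex≢source g ∘ sym) (source≢target g)))
incidence-outers-pivot right g es = trans
  (incidence-no (side (outer right g) ∷ es) (outer-joins left g) (apex≢target g ∘ sym) (source≢target g ∘ sym))
  (incidence-yes es (outer-joins right g) (inj₂ refl))

incidence-outers-other : ∀ {g u} es → u ≢ apex g → u ≢ source g → u ≢ target g →
                         incidence u (outers g es) ≡ incidence u es
incidence-outers-other {g} es a s t = trans
  (incidence-no (side (outer right g) ∷ es) (outer-joins left g) a s)
  (incidence-no es (outer-joins right g) a t)

incidence-none : ∀ g w {u} → u ∉ verts g w → incidence u (edgeList g w) ≡ 0
incidence-none g w {u} u∉ = cong length (filter-none (incident? u)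
  (All.tabulate λ e∈ i → u∉ (edgeList-ends g w e∈ i)))

-- The degree of `pivot t g`: 3 from the first two cells and one more for each turn around it. At an
-- opposite turn it is left behind as the next apex, with two edges there and one outer side.
valence : Turn → Word → ℕ
valence _     []          = 3
valence left  (left  ∷ w) = suc (valence left w)
valence left  (right ∷ w) = 3
valence right (left  ∷ w) = 3
valence right (right ∷ w) = suc (valence right w)

incidence-apex : ∀ g w → Unique (verts g w) → incidence (apex g) (edgeList g w) ≡ 2
incidence-apex g [] ((a≢s ∷ a≢t ∷ a≢tip ∷ []) ∷ _) = trans (incidence-outers-apex g _) (cong (2 ℕ.+_) (trans
  (incidence-no (side (step left g) ∷ side (step right g) ∷ []) (side-ends g) a≢s a≢t) (trans
  (incidence-no (side (step right g) ∷ []) (step-joins left g) a≢s a≢tip)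
  (incidence-no [] (step-joins right g) a≢t a≢tip))))
incidence-apex g (t ∷ w) (a∉ ∷ _) = trans (incidence-outers-apex g _)
  (cong (2 ℕ.+_) (incidence-none (step t g) w λ a∈ → All.lookup a∉ a∈ refl))

incidence-pivot : ∀ t g w → Unique (verts g w) → incidence (pivot t g) (edgeList g w) ≡ valence t w
incidence-pivot left g [] u = trans (incidence-outers-pivot left g _) (cong suc (trans
  (incidence-yes (side (step left g) ∷ side (step right g) ∷ []) (side-ends g) (inj₁ refl)) (cong suc (trans
  (incidence-yes (side (step right g) ∷ []) (step-joins left g) (inj₁ refl))
  (cong suc (incidence-no [] (step-joins right g) (source≢target g) (tip≢pivot left g ∘ sym)))))))
incidence-pivot right g [] u = trans (incidence-outers-pivot right g _) (cong suc (trans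
  (incidence-yes (side (step left g) ∷ side (step right g) ∷ []) (side-ends g) (inj₂ refl)) (cong suc (trans
  (incidence-no (side (step right g) ∷ []) (step-joins left g) (source≢target g ∘ sym) (tip≢pivot right g ∘ sym))
  (incidence-yes [] (step-joins right g) (inj₁ refl))))))
incidence-pivot t g (t′ ∷ w) (_ ∷ u) = trans (incidence-outers-pivot t g _) (rest t t′ u)
  where
  rest : ∀ t t′ → Unique (verts (step t′ g) w) →
         suc (incidence (pivot t g) (edgeList (step t′ g) w)) ≡ valence t (t′ ∷ w)
  kept : ∀ t → Unique (verts (step t g) w) → incidence (pivot t g) (edgeList (step t g) w) ≡ valence t w
  kept t u = trans (cong (λ p → incidence p (edgeList (step t g) w)) (sym (pivot-keep t g)))
    (incidence-pivot t (step t g) w u)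
  left-behind : ∀ t → Unique (verts (step t g) w) → incidence (pivot (opposite t) g) (edgeList (step t g) w) ≡ 2
  left-behind t u = trans (cong (λ p → incidence p (edgeList (step t g) w)) (sym (apex-step t g)))
    (incidence-apex (step t g) w u)
  rest left  left  u = cong suc (kept left u)
  rest left  right u = cong suc (left-behind right u)
  rest right left  u = cong suc (left-behind left u)
  rest right right u = cong suc (kept right u)

incidence-tip : ∀ g → apex g ≢ apex (flip g) → incidence (apex (flip g)) (edgeList g []) ≡ 2
incidence-tip g a≢tip = trans
  (incidence-outers-other {g} _ (a≢tip ∘ sym) (tip≢pivot left g) (tip≢pivot right g)) (trans
  (incidence-no (side (step left g) ∷ side (step right g) ∷ []) (side-ends g) (tip≢pivot left g) (tip≢pivot right g)) (trans
  (incidence-yes (side (step right g) ∷ []) (step-joins left g) (inj₂ refl))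
  (cong suc (incidence-yes [] (step-joins right g) (inj₂ refl)))))

incidence-tail : ∀ u e es → incidence u es ≤ incidence u (e ∷ es)
incidence-tail u e es with incident? u e
... | yes i = ℕ.≤-trans (ℕ.n≤1+n _) (ℕ.≤-reflexive (sym (cong length (filter-accept (incident? u) i))))
... | no ¬i = ℕ.≤-reflexive (sym (cong length (filter-reject (incident? u) ¬i)))

-- The degree bound m as a condition on the word. All vertices but the first apex and the last tip,
-- both of degree 2, are pivots of some suffix.
data Tame (m : ℕ) : Word → Set where
  []  : 3 ≤ m → Tame m []
  _∷_ : ∀ {t w} → (∀ t′ → valence t′ (t ∷ w) ≤ m) → Tame m w → Tame m (t ∷ w)

tame-here : ∀ {m w} → Tame m w → ∀ t → valence t w ≤ m
tame-here ([] 3≤m) _ = 3≤m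
tame-here (p ∷ _)  t = p t

incidence⇒tame : ∀ {m} g w → Unique (verts g w) →
  (∀ {u} → u ∈ verts g w → incidence u (edgeList g w) ≤ m) → Tame m w
incidence⇒tame {m} g [] u b =
  [] (subst (_≤ m) (incidence-pivot left g [] u) (b (pivot∈verts left g [])))
incidence⇒tame {m} g (t ∷ w) u@(_ ∷ u′) b =
  (λ t′ → subst (_≤ m) (incidence-pivot t′ g (t ∷ w) u) (b (pivot∈verts t′ g (t ∷ w)))) ∷
  incidence⇒tame (step t g) w u′ λ {v} v∈ → ℕ.≤-trans (ℕ.≤-trans
    (incidence-tail v _ (edgeList (step t g) w))
    (incidence-tail v _ (side (outer right g) ∷ edgeList (step t g) w))) (b (there v∈))

tame⇒incidence : ∀ {m} g w → Unique (verts g w) → Tame m w →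
  ∀ {u} → u ∈ verts g w → incidence u (edgeList g w) ≤ m
tame⇒incidence {m} g w uniq tame u∈ = go g w uniq tame u∈
  where
  3≤m : ∀ {w} → Tame m w → 3 ≤ m
  3≤m ([] p)  = p
  3≤m (_ ∷ p) = 3≤m p
  2≤m : 2 ≤ m
  2≤m = ℕ.≤-trans (s≤s (s≤s z≤n)) (3≤m tame)
  go : ∀ g w → Unique (verts g w) → Tame m w → ∀ {u} → u ∈ verts g w → incidence u (edgeList g w) ≤ m
  go g [] u tm (here refl) = subst (_≤ m) (sym (incidence-apex g [] u)) 2≤m
  go g [] u tm (there (here refl)) = subst (_≤ m) (sym (incidence-pivot left g [] u)) (3≤m tm)
  go g [] u tm (there (there (here refl))) = subst (_≤ m) (sym (incidence-pivot right g [] u)) (3≤m tm)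
  go g [] ((_ ∷ _ ∷ a≢tip ∷ []) ∷ _) tm (there (there (there (here refl)))) =
    subst (_≤ m) (sym (incidence-tip g a≢tip)) 2≤m
  go g (t ∷ w) u tm (here refl) = subst (_≤ m) (sym (incidence-apex g (t ∷ w) u)) 2≤m
  go g (t ∷ w) uniq@(a∉ ∷ uniq′) tm@(_ ∷ tm′) {u} (there u∈) with u ≟ₚ source g | u ≟ₚ target g
  ... | yes refl | _        = subst (_≤ m) (sym (incidence-pivot left g (t ∷ w) uniq)) (tame-here tm left)
  ... | no _     | yes refl = subst (_≤ m) (sym (incidence-pivot right g (t ∷ w) uniq)) (tame-here tm right)
  ... | no u≢s   | no u≢t   = subst (_≤ m)
    (sym (incidence-outers-other {g} _ (λ { refl → All.lookup a∉ u∈ refl }) u≢s u≢t))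
    (go (step t g) w uniq′ tm′ u∈)

maxDegree⇒tame : ∀ {m} g w → Chain (ribbon g w) → MaxDegree≤ m (ribbon g w) → Tame m w
maxDegree⇒tame {m} g w ch b = incidence⇒tame g w u λ {v} v∈ →
  subst (_≤ m) (degree≡incidence g w u v) (b v (verts⇒vertices g w v∈))
  where u = verts-unique g w ch

tame⇒maxDegree : ∀ {m} g w → Chain (ribbon g w) → Tame m w → MaxDegree≤ m (ribbon g w)
tame⇒maxDegree {m} g w ch tm v v∈ =
  subst (_≤ m) (sym (degree≡incidence g w u v)) (tame⇒incidence g w u tm (vertices⇒verts g w v∈))
  where u = verts-unique g w ch

-- Segments

valence-same : ∀ t w → valence t (t ∷ w) ≡ suc (valence t w)
valence-same left  _ = refl
valence-same right _ = refl

valence-opp : ∀ t w → valence t (opposite t ∷ w) ≡ 3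
valence-opp left  _ = refl
valence-opp right _ = refl

valence-opp′ : ∀ t w → valence (opposite t) (t ∷ w) ≡ 3
valence-opp′ left  _ = refl
valence-opp′ right _ = refl

3≤valence : ∀ t w → 3 ≤ valence t w
3≤valence _ [] = ℕ.≤-refl
3≤valence t (t′ ∷ w) with compare t t′
... | same = subst (3 ≤_) (sym (valence-same t w)) (ℕ.≤-trans (3≤valence t w) (ℕ.n≤1+n _))
... | opp  = subst (3 ≤_) (sym (valence-opp t w)) ℕ.≤-refl

-- A ribbon is linear when its word alternates (Tame 4), so the segments are cut
-- out by the maximal alternating stretches of the word.
run : Turn → Word → Word
run t []       = []
run t (t′ ∷ w) with compare t t′
... | same = []
... | opp  = opposite t ∷ run (opposite t) w

-- A segment ends between two equal letters: the first is its last letter, the second opens the next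
-- segment. The new segment starts at `step t g`, so it shares its first two cells with the old one.
laterSegments : HalfEdge → Turn → Word → List (List Cell)
laterSegments g t []       = []
laterSegments g t (t′ ∷ w) with compare t t′
... | same = ribbon (step t g) (t ∷ run t w) ∷ laterSegments (step t g) t w
... | opp  = laterSegments (step t g) (opposite t) w

segmentList : HalfEdge → Turn → Word → List (List Cell)
segmentList g t w = ribbon g (t ∷ run t w) ∷ laterSegments g t w

run-prefix : ∀ t w → ∃ λ w′ → run t w ++ w′ ≡ w
run-prefix t []       = [] , refl
run-prefix t (t′ ∷ w) with compare t t′
... | same = t ∷ w , refl
... | opp with w′ , eq ← run-prefix (opposite t) w = w′ , cong (opposite t ∷_) eq

valence≤4 : ∀ t w → valence t (t ∷ w) ≡ 4 → ∀ t′ → valence t′ (t ∷ w) ≤ 4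
valence≤4 t w eq t′ with compare t t′
... | same = ℕ.≤-reflexive eq
... | opp  = subst (_≤ 4) (sym (valence-opp′ t w)) (ℕ.n≤1+n 3)

run-tame : ∀ t w → Tame 4 (t ∷ run t w)
run-tame t [] = valence≤4 t [] (valence-same t []) ∷ [] (ℕ.n≤1+n 3)
run-tame t (t′ ∷ w) with compare t t′
... | same = valence≤4 t [] (valence-same t []) ∷ [] (ℕ.n≤1+n 3)
... | opp = valence≤4 t _ (trans (valence-same t _) (cong suc (valence-opp t _))) ∷ run-tame (opposite t) w

-- Going beyond the run would repeat a letter and produce a vertex of degree at least 5.
run-longest : ∀ t w w₁ w₂ → w₁ ++ w₂ ≡ w → Tame 4 (t ∷ w₁) → ∃ λ w₃ → w₁ ++ w₃ ≡ run t w
run-longest t w        []        w₂ _    _         = run t w , refl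
run-longest t (t′ ∷ w) (t′ ∷ w₁) w₂ refl (v ∷ tame) with compare t t′
... | same = ⊥-elim (ℕ.<-irrefl refl (ℕ.≤-trans
  (s≤s (s≤s (3≤valence t w₁)))
  (subst (_≤ 4) (trans (valence-same t (t ∷ w₁)) (cong suc (valence-same t w₁))) (v t))))
... | opp with w₃ , eq ← run-longest (opposite t) (w₁ ++ w₂) w₁ w₂ refl tame = w₃ , cong (opposite t ∷_) eq

-- What a segment demands besides its degree bound and maximality, in a form closed under
-- composition: it has to be checked only for the removal of one end cell.
record Part (ts cs : List Cell) : Set where
  field
    sub    : cs ⊆ ts
    sound  : Chain cs
    filled : ∀ {u v} → (u , v) ∈ edges ts → u ∈ vertices cs → v ∈ vertices cs → (u , v) ∈ edges cs

open Part

⊆⇒∈ : ∀ {A : Set} {xs ys : List A} → xs ⊆ ys → ∀ {x} → x ∈ xs → x ∈ ys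
⊆⇒∈ τ = Sublist.lookup τ

part-refl : ∀ {ts} → Chain ts → Part ts ts
part-refl ch = record { sub = ⊆-refl ; sound = ch ; filled = λ e∈ _ _ → e∈ }

part-trans : ∀ {ts cs ds} → Part ts cs → Part cs ds → Part ts ds
part-trans {ts} {cs} {ds} p q = record
  { sub    = ⊆-trans (sub q) (sub p)
  ; sound  = sound q
  ; filled = λ e∈ u∈ v∈ → filled q (filled p e∈ (mono u∈) (mono v∈)) u∈ v∈
  }
  where
  mono : ∀ {u} → u ∈ vertices ds → u ∈ vertices cs
  mono = vertices-mono {ds} {cs} (⊆⇒∈ (sub q))

apex∈ends : ∀ t {h us u v} → apex h ∉ us → (u , v) ≡ side (outer t h) → u ∈ us → v ∈ us → ⊥
apex∈ends t {h} a∉ eq u∈ v∈ with subst (λ e → Joins e (apex h) (pivot t h)) (sym eq) (outer-joins t h)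
... | inj₁ refl = a∉ u∈
... | inj₂ refl = a∉ v∈

-- The sides of an end cell that are not shared with its neighbour have a new vertex.
filled-drop : ∀ {ts ts′} h → (∀ {c} → c ∈ ts → c ≡ cell h ⊎ c ∈ ts′) →
  cell (flip h) ∈ ts′ → apex h ∉ vertices ts′ →
  ∀ {u v} → (u , v) ∈ edges ts → u ∈ vertices ts′ → v ∈ vertices ts′ → (u , v) ∈ edges ts′
filled-drop {ts} {ts′} h split h∈ a∉ {u} {v} e∈ u∈ v∈ with ∈-edges⁻ ts e∈
... | c , c∈ , e∈c with split c∈
...   | inj₂ c∈′ = ∈-edges⁺ {ts′} c∈′ e∈c
...   | inj₁ refl with k , eq ← ∈-sides⁻ (cell h) e∈c with rotation (cell h) (proj₂ h) k
...     | rot₀ = ∈-edges⁺ {ts′} h∈ (subst (_∈ sides (cell (flip h))) (trans (side-flip h) (sym eq)) (∈-sides⁺ (flip h)))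
...     | rot₁ = ⊥-elim (apex∈ends right a∉ eq u∈ v∈)
...     | rot₂ = ⊥-elim (apex∈ends left a∉ eq u∈ v∈)

part-dropFirst : ∀ g t w → Chain (ribbon g (t ∷ w)) → Part (ribbon g (t ∷ w)) (ribbon (step t g) w)
part-dropFirst g t w ch = record
  { sub    = skip (cell g) ⊆-refl
  ; sound  = chain-dropFirst {g} {t} {w} ch
  ; filled = filled-drop {ts′ = ribbon (step t g) w} g (λ { (here eq) → inj₁ eq ; (there c∈) → inj₂ c∈ }) (here refl)
      (λ a∈ → All.lookup (AllPairs.head (verts-unique g (t ∷ w) ch)) (vertices⇒verts (step t g) w a∈) refl)
  }

tip∈verts : ∀ g w → apex (flip (exit g w)) ∈ verts g w
tip∈verts g []      = there (there (there (here refl)))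
tip∈verts g (t ∷ w) = there (tip∈verts (step t g) w)

-- The counterpart at the far end of what uniqueness gives at once for the first apex; `verts`
-- unfolds from the front, so an induction is required here.
tip-fresh : ∀ g w t → Unique (verts g (w ∷ʳ t)) → apex (flip (exit g (w ∷ʳ t))) ∉ verts g w
tip-fresh g [] t (a∉ ∷ (_ ∷ _ ∷ a′≢tip ∷ []) ∷ _) u∈ = new (position g [] u∈) refl
  where
  tip = apex (flip (step t g))
  new : ∀ {u} → Position g [] u → u ≢ tip
  new atApex eq = All.lookup a∉ (tip∈verts (step t g) []) eq
  new (atPivot t′) eq with compare t t′
  ... | same = tip≢pivot t (step t g) (sym (trans (pivot-keep t g) eq))
  ... | opp  = a′≢tip (trans (apex-step t g) eq)
  new (atTip [] [] refl) eq = tip≢pivot (opposite t) (step t g) (sym (trans (pivot-fresh t g) eq))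
tip-fresh g (t′ ∷ w) t (a∉ ∷ _) (here eq) = All.lookup a∉ (tip∈verts (step t′ g) (w ∷ʳ t)) (sym eq)
tip-fresh g (t′ ∷ w) t (_ ∷ u)  (there u∈) = tip-fresh (step t′ g) w t u u∈

exit∈ribbon : ∀ g w t → cell (exit g (w ∷ʳ t)) ∈ ribbon g w
exit∈ribbon g []       t = there (here refl)
exit∈ribbon g (t′ ∷ w) t = there (exit∈ribbon (step t′ g) w t)

part-dropLast : ∀ g w t → Chain (ribbon g (w ∷ʳ t)) → Part (ribbon g (w ∷ʳ t)) (ribbon g w)
part-dropLast g w t ch = record
  { sub    = subst (ribbon g w ⊆_) (sym (ribbon-∷ʳ g w t)) (++⁺ʳ (cell h ∷ []) ⊆-refl)
  ; sound  = chain-dropLast {g} {w} {t} ch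
  ; filled = filled-drop {ts′ = ribbon g w} h
      (λ {c} c∈ → split (∈-++⁻ (ribbon g w) (subst (c ∈_) (ribbon-∷ʳ g w t) c∈)))
      (subst (λ h → cell h ∈ ribbon g w) (sym (flip-flip (exit g (w ∷ʳ t)))) (exit∈ribbon g w t))
      (λ a∈ → tip-fresh g w t (verts-unique g (w ∷ʳ t) ch) (vertices⇒verts g w a∈))
  }
  where
  h = flip (exit g (w ∷ʳ t))
  split : ∀ {c} → c ∈ ribbon g w ⊎ c ∈ cell h ∷ [] → c ≡ cell h ⊎ c ∈ ribbon g w
  split (inj₁ c∈)        = inj₂ c∈
  split (inj₂ (here eq)) = inj₁ eq

part-prefix : ∀ g w w′ → Chain (ribbon g (w ++ w′)) → Part (ribbon g (w ++ w′)) (ribbon g w)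
part-prefix g w []       ch = subst (λ v → Part (ribbon g v) (ribbon g w)) (sym (++-identityʳ w))
  (part-refl (subst (Chain ∘ ribbon g) (++-identityʳ w) ch))
part-prefix g w (t ∷ w′) ch = subst (λ v → Part (ribbon g v) (ribbon g w)) (∷ʳ-++ w t w′)
  (part-trans p (part-dropLast g w t (sound p)))
  where p = part-prefix g (w ∷ʳ t) w′ (subst (Chain ∘ ribbon g) (sym (∷ʳ-++ w t w′)) ch)

part-first : ∀ g t w → Chain (ribbon g (t ∷ w)) → Part (ribbon g (t ∷ w)) (ribbon g (t ∷ run t w))
part-first g t w ch with w′ , eq ← run-prefix t w =
  subst (λ v → Part (ribbon g (t ∷ v)) (ribbon g (t ∷ run t w))) eq
    (part-prefix g (t ∷ run t w) w′ (subst (λ v → Chain (ribbon g (t ∷ v))) (sym eq) ch))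

later-parts : ∀ g t w → Chain (ribbon g (t ∷ w)) → All (Part (ribbon (step t g) w)) (laterSegments g t w)
later-parts g t []       ch = []
later-parts g t (t′ ∷ w) ch with compare t t′ | part-dropFirst g t (t′ ∷ w) ch
... | same | p = part-first (step t g) t w (sound p) ∷
  All.map (part-trans (part-dropFirst (step t g) t w (sound p))) (later-parts (step t g) t w (sound p))
... | opp  | p = All.map (part-trans (part-dropFirst (step t g) (opposite t) w (sound p)))
  (later-parts (step t g) (opposite t) w (sound p))

segment-parts : ∀ g t w → Chain (ribbon g (t ∷ w)) → All (Part (ribbon g (t ∷ w))) (segmentList g t w)
segment-parts g t w ch = part-first g t w ch ∷
  All.map (part-trans (part-dropFirst g t w ch)) (later-parts g t w ch)

TameRibbon : List Cell → Set
TameRibbon cs = ∃ λ g → ∃₂ λ t w → cs ≡ ribbon g (t ∷ w) × Tame 4 (t ∷ w)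

later-tame : ∀ g t w → All TameRibbon (laterSegments g t w)
later-tame g t []       = []
later-tame g t (t′ ∷ w) with compare t t′
... | same = (step t g , t , run t w , refl , run-tame t w) ∷ later-tame (step t g) t w
... | opp  = later-tame (step t g) (opposite t) w

segments-tame : ∀ g t w → All TameRibbon (segmentList g t w)
segments-tame g t w = (g , t , run t w , refl , run-tame t w) ∷ later-tame g t w

segments-linear : ∀ g t w → Chain (ribbon g (t ∷ w)) → All LinearChain (segmentList g t w)
segments-linear g t w ch = All.zipWith
  (λ { (p , (g′ , t′ , w′ , refl , tame)) → chain⇒triangularChain (sound p) , tame⇒maxDegree g′ (t′ ∷ w′) (sound p) tame })
  (segment-parts g t w ch , segments-tame g t w)

ribbon-++ : ∀ g w w′ → ribbon g w ⊆ ribbon g (w ++ w′)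
ribbon-++ g w w′ = refl ∷ refl ∷ go g w
  where
  go : ∀ g w → beyond g w ⊆ beyond g (w ++ w′)
  go g []      = minimum _
  go g (t ∷ w) = refl ∷ go (step t g) w

-- The first cell of a chain has only one neighbour, so a ribbon starting there can skip no cell and
-- must follow the chain letter by letter.
ribbon-prefix : ∀ g w g′ w′ → Chain (ribbon g w) → cell g′ ≡ cell g → ribbon g′ w′ ⊆ ribbon g w →
                g′ ≡ g × ∃ λ w″ → w′ ++ w″ ≡ w
ribbon-prefix g w g′ w′ ch eq (skip _ τ) = ⊥-elim (first∉ ch (⊆⇒∈ τ (here (sym eq))))
ribbon-prefix g w (c , k) w′ ch refl (refl ∷ τ)
  with refl ← cell-flip-injective c (first-neighbour g w (thread ch) (there (⊆⇒∈ τ (here refl))) (sharesSide-flip (c , k)))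
  = refl , go w w′ ch τ
  where
  go : ∀ w w′ → Chain (ribbon g w) → cell (flip g) ∷ beyond g w′ ⊆ cell (flip g) ∷ beyond g w →
       ∃ λ w″ → w′ ++ w″ ≡ w
  go w        []        _  _ = w , refl
  go []       (t′ ∷ w′) _  (_ ∷ ())
  go []       (t′ ∷ w′) _  (skip _ ())
  go (t ∷ w) (t′ ∷ w′) ch τ
    with eq , w″ , refl ← ribbon-prefix (step t g) w (step t′ g) w′ (chain-dropFirst {g} {t} {w} ch) refl τ
    with refl ← step-injective {t′} {t} {g} eq = w″ , refl

-- A tame ribbon through the first cell stays within the first run. Any other lies in the tail,
-- whose segments are those of the whole, save that at an opposite turn the first of them is
-- extended by `cell g`.
cover : ∀ g t w → Chain (ribbon g (t ∷ w)) → ∀ g′ w′ → Tame 4 w′ → ribbon g′ w′ ⊆ ribbon g (t ∷ w) →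
        Any (ribbon g′ w′ ⊆_) (segmentList g t w)
cover g t w ch g′ w′ tame τ@(eq ∷ _) with ribbon-prefix g (t ∷ w) g′ w′ ch eq τ
... | refl , w″ , p = here (within-run w′ w″ p tame)
  where
  within-run : ∀ w′ w″ → w′ ++ w″ ≡ t ∷ w → Tame 4 w′ → ribbon g w′ ⊆ ribbon g (t ∷ run t w)
  within-run []       _  _    _    = ribbon-++ g [] (t ∷ run t w)
  within-run (_ ∷ w₁) w″ refl tame with w₃ , eq ← run-longest t w w₁ w″ refl tame =
    subst (λ v → ribbon g (t ∷ w₁) ⊆ ribbon g (t ∷ v)) eq (ribbon-++ g (t ∷ w₁) w₃)
cover g t [] ch g′ w′ tame (skip _ τ) = here (skip _ τ)
cover g t (t′ ∷ w) ch g′ w′ tame (skip _ τ)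
  with cover (step t g) t′ w (chain-dropFirst {g} {t} {t′ ∷ w} ch) g′ w′ tame τ | compare t t′
... | here τ′ | same = there (here τ′)
... | there a | same = there (there a)
... | here τ′ | opp  = here (skip _ τ′)
... | there a | opp  = there a

cell-cover : ∀ g w {c} → c ∈ ribbon g w → ∃ λ g′ → ribbon g′ [] ⊆ ribbon g w × c ∷ [] ⊆ ribbon g′ []
cell-cover g w       (here refl)         = g , ribbon-++ g [] w , refl ∷ minimum _
cell-cover g w       (there (here refl)) = g , ribbon-++ g [] w , skip _ (refl ∷ [])
cell-cover g (t ∷ w) (there (there c∈)) with g′ , τ , σ ← cell-cover (step t g) w (there c∈) = g′ , skip _ τ , σ

linear⇒tameRibbon : ∀ {c d cs} → LinearChain (c ∷ d ∷ cs) → ∃₂ λ g w → c ∷ d ∷ cs ≡ ribbon g w × Tame 4 w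
linear⇒tameRibbon {c} {d} {cs} (tc , deg) with ch ← triangularChain⇒chain tc
  with g , w , eq ← chain⇒ribbon c d cs (unique ch) (thread ch) =
  g , w , eq , maxDegree⇒tame g w (subst Chain eq ch) (subst (MaxDegree≤ 4) eq deg)

-- Lists of at most one cell have no word; a single cell is therefore first placed in a ribbon of
-- two cells.
linear-cover : ∀ g t w → Chain (ribbon g (t ∷ w)) → ∀ S → LinearChain S → S ⊆ ribbon g (t ∷ w) →
               Any (S ⊆_) (segmentList g t w)
linear-cover g t w ch []          _   _ = here (minimum _)
linear-cover g t w ch (c ∷ [])    _   τ with g′ , τ′ , σ ← cell-cover g (t ∷ w) (⊆⇒∈ τ (here refl)) =
  Any.map (⊆-trans σ) (cover g t w ch g′ [] ([] (ℕ.n≤1+n 3)) τ′)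
linear-cover g t w ch (c ∷ d ∷ S) lin τ with g′ , w′ , eq , tame ← linear⇒tameRibbon lin =
  Any.map (λ {S′} σ → subst (_⊆ S′) (sym eq) σ) (cover g t w ch g′ w′ tame (subst (_⊆ ribbon g (t ∷ w)) eq τ))

-- Maximality and order of the segments

Incomparable : List Cell → List Cell → Set
Incomparable S S′ = ¬ S ⊆ S′ × ¬ S′ ⊆ S

⊆-strip : ∀ {A : Set} {x : A} {xs ys} → x ∉ xs → xs ⊆ x ∷ ys → xs ⊆ ys
⊆-strip x∉ (refl ∷ _) = ⊥-elim (x∉ (here refl))
⊆-strip x∉ (skip _ τ) = τ

-- Only the first segment contains the first cell. Conversely, a later segment inside it would
-- already lie in it without that cell: before an equal turn only two cells remain, fewer than a
-- segment has, and before an opposite turn the first segment of the tail remains.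
segments-incomparable : ∀ g t w → Chain (ribbon g (t ∷ w)) → AllPairs Incomparable (segmentList g t w)
segments-incomparable g t [] ch = [] ∷ []
segments-incomparable g t (t′ ∷ w) ch
  with compare t t′ | chain-dropFirst {g} {t} {t′ ∷ w} ch
... | same | ch′ = All.zipWith
    (λ { (p , (g″ , t″ , w″ , refl , _)) →
      (λ τ → first∉ ch (⊆⇒∈ (sub p) (⊆⇒∈ τ (here refl)))) ,
      (λ τ → too-long (⊆-strip (λ g∈ → first∉ ch (⊆⇒∈ (sub p) g∈)) τ)) })
    (segment-parts (step t g) t w ch′ , segments-tame (step t g) t w) ∷
  segments-incomparable (step t g) t w ch′
  where
  too-long : ∀ {A : Set} {x y z u v : A} {xs} → ¬ (x ∷ y ∷ z ∷ xs ⊆ u ∷ v ∷ [])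
  too-long (_ ∷ _ ∷ ())
  too-long (_ ∷ skip _ ())
  too-long (skip _ (_ ∷ ()))
  too-long (skip _ (skip _ ()))
... | opp | ch′ with segments-incomparable (step t g) (opposite t) w ch′ | segment-parts (step t g) (opposite t) w ch′
...   | inc ∷ incs | _ ∷ ps = All.zipWith
    (λ (p , (_ , S⊈X)) →
      (λ τ → first∉ ch (⊆⇒∈ (sub p) (⊆⇒∈ τ (here refl)))) ,
      (λ τ → S⊈X (⊆-strip (λ g∈ → first∉ ch (⊆⇒∈ (sub p) g∈)) τ)))
    (ps , inc) ∷ incs

allPairs-compare : ∀ {A : Set} {R : A → A → Set} {xs x y} → AllPairs R xs → x ∈ xs → y ∈ xs →
                   x ≡ y ⊎ R x y ⊎ R y x
allPairs-compare (_ ∷ _)  (here refl) (here refl) = inj₁ refl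
allPairs-compare (r ∷ _)  (here refl) (there y∈)  = inj₂ (inj₁ (All.lookup r y∈))
allPairs-compare (r ∷ _)  (there x∈)  (here refl) = inj₂ (inj₂ (All.lookup r x∈))
allPairs-compare (_ ∷ rs) (there x∈)  (there y∈)  = allPairs-compare rs x∈ y∈

-- Maximality: a larger linear part lies in some listed segment, which by incomparability can only
-- be S.
segmentList-sound : ∀ g t w → Chain (ribbon g (t ∷ w)) → ∀ {S} → S ∈ segmentList g t w → Segment (ribbon g (t ∷ w)) S
segmentList-sound g t w ch {S} S∈ = record
  { part    = sub p
  ; linear  = All.lookup (segments-linear g t w ch) S∈
  ; induced = filled p
  ; maximal = λ S′ S′⊆ lin S⊆S′ → ⊆-antisym (within-S S⊆S′ (linear-cover g t w ch S′ lin S′⊆)) S⊆S′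
  }
  where
  p = All.lookup (segment-parts g t w ch) S∈
  within-S : ∀ {S′} → S ⊆ S′ → Any (S′ ⊆_) (segmentList g t w) → S′ ⊆ S
  within-S S⊆S′ a with S″ , S″∈ , S′⊆S″ ← find a
    with allPairs-compare (segments-incomparable g t w ch) S∈ S″∈
  ... | inj₁ refl               = S′⊆S″
  ... | inj₂ (inj₁ (S⊈S″ , _)) = ⊥-elim (S⊈S″ (⊆-trans S⊆S′ S′⊆S″))
  ... | inj₂ (inj₂ (_ , S⊈S″)) = ⊥-elim (S⊈S″ (⊆-trans S⊆S′ S′⊆S″))

-- S lies in some listed segment, and the maximality of S itself makes the two equal.
segmentList-complete : ∀ g t w → Chain (ribbon g (t ∷ w)) → ∀ {S} → Segment (ribbon g (t ∷ w)) S → S ∈ segmentList g t w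
segmentList-complete g t w ch {S} seg
  with S′ , S′∈ , S⊆S′ ← find (linear-cover g t w ch S (Segment.linear seg) (Segment.part seg)) =
  subst (_∈ segmentList g t w)
    (Segment.maximal seg S′ (sub (All.lookup (segment-parts g t w ch) S′∈))
      (All.lookup (segments-linear g t w ch) S′∈) S⊆S′)
    S′∈

precedes-skip : ∀ {ts c S S′} → Precedes ts S S′ → Precedes (c ∷ ts) S S′
precedes-skip (a , b , as , bs , eq , eq′ , τ) = a , b , as , bs , eq , eq′ , skip _ τ

segments-ordered : ∀ g t w → Chain (ribbon g (t ∷ w)) → AllPairs (Precedes (ribbon g (t ∷ w))) (segmentList g t w)
segments-ordered g t w ch = first-before g t w ch ∷ later g t w ch
  where
  first-before : ∀ g t w → Chain (ribbon g (t ∷ w)) →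
    All (Precedes (ribbon g (t ∷ w)) (ribbon g (t ∷ run t w))) (laterSegments g t w)
  first-before g t w ch = All.zipWith
    (λ { (p , (g′ , t′ , w′ , refl , _)) →
      cell g , cell g′ , _ , _ , refl , refl , refl ∷ ⊆-trans (refl ∷ minimum _) (sub p) })
    (later-parts g t w ch , later-tame g t w)
  later : ∀ g t w → Chain (ribbon g (t ∷ w)) → AllPairs (Precedes (ribbon g (t ∷ w))) (laterSegments g t w)
  later g t []       ch = []
  later g t (t′ ∷ w) ch with compare t t′ | chain-dropFirst {g} {t} {t′ ∷ w} ch
  ... | same | ch′ = All.map precedes-skip (first-before (step t g) t w ch′) ∷
    AllPairs.map precedes-skip (later (step t g) t w ch′)
  ... | opp  | ch′ = AllPairs.map precedes-skip (later (step t g) (opposite t) w ch′)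

precedes-asym : ∀ {ts S S′} → Unique ts → Precedes ts S S′ → ¬ Precedes ts S′ S
precedes-asym u (c , d , _ , _ , refl , refl , τ) (_ , _ , _ , _ , refl , refl , σ) = order u τ σ
  where
  order : ∀ {ts : List Cell} → Unique ts → c ∷ d ∷ [] ⊆ ts → d ∷ c ∷ [] ⊆ ts → ⊥
  order (x∉ ∷ _) (refl ∷ _)  (refl ∷ σ)  = All.lookup x∉ (⊆⇒∈ σ (here refl)) refl
  order (x∉ ∷ _) (refl ∷ _)  (skip _ σ)  = All.lookup x∉ (⊆⇒∈ σ (there (here refl))) refl
  order (x∉ ∷ _) (skip _ τ)  (refl ∷ _)  = All.lookup x∉ (⊆⇒∈ τ (there (here refl))) refl
  order (_ ∷ u)  (skip _ τ)  (skip _ σ)  = order u τ σ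

sorted-tail : ∀ {A : Set} {R : A → A → Set} → (∀ {x y} → R x y → ¬ R y x) → ∀ {x xs ys} →
  All (R x) xs → (∀ {z} → z ∈ x ∷ xs → z ∈ x ∷ ys) → ∀ {z} → z ∈ xs → z ∈ ys
sorted-tail asym r f z∈ with f (there z∈)
... | here refl = ⊥-elim (asym (All.lookup r z∈) (All.lookup r z∈))
... | there z∈′ = z∈′

sorted-≡ : ∀ {A : Set} {R : A → A → Set} → (∀ {x y} → R x y → ¬ R y x) → ∀ {xs ys} →
  AllPairs R xs → AllPairs R ys → (∀ {x} → x ∈ xs → x ∈ ys) → (∀ {x} → x ∈ ys → x ∈ xs) → xs ≡ ys
sorted-≡ asym {[]} {[]} _ _ _ _ = refl
sorted-≡ asym {[]} {y ∷ ys} _ _ _ g with () ← g (here refl)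
sorted-≡ asym {x ∷ xs} {[]} _ _ f _ with () ← f (here refl)
sorted-≡ asym {x ∷ xs} {y ∷ ys} (rx ∷ rxs) (ry ∷ rys) f g with f (here refl) | g (here refl)
... | there x∈ | there y∈ = ⊥-elim (asym (All.lookup rx y∈) (All.lookup ry x∈))
... | here refl | _ = cong (x ∷_) (sorted-≡ asym rxs rys (sorted-tail asym rx f) (sorted-tail asym ry g))
... | there _ | here refl = cong (x ∷_) (sorted-≡ asym rxs rys (sorted-tail asym rx f) (sorted-tail asym ry g))

-- A length vector fixes its segments only by membership and order. Precedence is asymmetric because
-- the cells are distinct, so these two data determine the list.
segments-≡ : ∀ g t w → Chain (ribbon g (t ∷ w)) → ∀ {k} {l : Vec ℕ k} (lv : LengthVector (ribbon g (t ∷ w)) l) →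
             Vec.toList (LengthVector.segments lv) ≡ segmentList g t w
segments-≡ g t w ch lv = sorted-≡ (precedes-asym (unique ch)) (LengthVector.ordered lv) (segments-ordered g t w ch)
  (λ S∈ → segmentList-complete g t w ch (Equivalence.to (LengthVector.complete lv _) S∈))
  (λ S∈ → Equivalence.from (LengthVector.complete lv _) (segmentList-sound g t w ch S∈))

-- The index of a ribbon

laterRuns : Turn → Word → List ℕ
laterRuns t []       = []
laterRuns t (t′ ∷ w) with compare t t′
... | same = length (run t w) ∷ laterRuns t w
... | opp  = laterRuns (opposite t) w

length-ribbon : ∀ g w → length (ribbon g w) ≡ 2 ℕ.+ length w
length-ribbon g w = cong (2 ℕ.+_) (go g w)
  where
  go : ∀ g w → length (beyond g w) ≡ length w
  go g []      = refl
  go g (t ∷ w) = cong suc (go (step t g) w)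

-- The 3 counts the two cells at the first half-edge and the one reached by the opening letter,
-- which `run` leaves out.
segmentList-lengths : ∀ g t w → map length (segmentList g t w) ≡ map (3 ℕ.+_) (length (run t w) ∷ laterRuns t w)
segmentList-lengths g t w = cong₂ _∷_ (length-ribbon g (t ∷ run t w)) (later g t w)
  where
  later : ∀ g t w → map length (laterSegments g t w) ≡ map (3 ℕ.+_) (laterRuns t w)
  later g t []       = refl
  later g t (t′ ∷ w) with compare t t′
  ... | same = cong₂ _∷_ (length-ribbon (step t g) (t ∷ run t w)) (later (step t g) t w)
  ... | opp  = later (step t g) (opposite t) w

-- The letters of w, counted along its runs and the breaks between them.
letters : ∀ {k} → ℕ → Vec ℕ k → ℕ
letters r []        = r
letters r (r′ ∷ rs) = suc r ℕ.+ letters r′ rs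

letters-run : ∀ t w → letters (length (run t w)) (Vec.fromList (laterRuns t w)) ≡ length w
letters-run t []       = refl
letters-run t (t′ ∷ w) with compare t t′
... | same = cong suc (letters-run t w)
... | opp  = trans (shift (length (run (opposite t) w)) (Vec.fromList (laterRuns (opposite t) w)))
                   (cong suc (letters-run (opposite t) w))
  where
  shift : ∀ {k} r (rs : Vec ℕ k) → letters (suc r) rs ≡ suc (letters r rs)
  shift r []      = refl
  shift r (_ ∷ _) = refl

-- Only the first and the last run may be empty.
Inner : ∀ {k} → ℕ → Vec ℕ k → Set
Inner r []        = ⊤
Inner r (r′ ∷ rs) = 1 ≤ r × Inner r′ rs

InnerTail : ∀ {k} → Vec ℕ k → Set
InnerTail []       = ⊤
InnerTail (r ∷ rs) = Inner r rs

-- Two breaks with an empty run between them would be three equal letters, hence a vertex of degree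
-- at least 6.
tame-inner : ∀ t w → Tame 5 (t ∷ w) → InnerTail (Vec.fromList (laterRuns t w))
tame-inner t [] _ = tt
tame-inner t (t′ ∷ w) (v ∷ tame) with compare t t′
... | opp  = tame-inner (opposite t) w tame
... | same = next-inner w v (tame-inner t w tame)
  where
  next-inner : ∀ w → (∀ t′ → valence t′ (t ∷ t ∷ w) ≤ 5) → InnerTail (Vec.fromList (laterRuns t w)) →
               Inner (length (run t w)) (Vec.fromList (laterRuns t w))
  next-inner [] _ _ = tt
  next-inner (t′ ∷ w) v inner with compare t t′
  ... | same = ⊥-elim (ℕ.<-irrefl refl (ℕ.≤-trans (s≤s (s≤s (s≤s (3≤valence t w))))
    (subst (_≤ 5) (trans (valence-same t _) (cong suc (trans (valence-same t _) (cong suc (valence-same t w))))) (v t))))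
  ... | opp  = positive (laterRuns (opposite t) w) inner
    where
    positive : ∀ {r} rs → InnerTail (Vec.fromList rs) → Inner (suc r) (Vec.fromList rs)
    positive []      _     = tt
    positive (_ ∷ _) inner = s≤s z≤n , inner

-- With `freshValence`, the valences of the pivot of the last turn and of the opposite one, in terms
-- of run lengths. The 4 belongs to a break that follows at once.
keptValence : ∀ {k} → ℕ → Vec ℕ k → ℕ
keptValence zero    (_ ∷ _) = 4
keptValence zero    []      = 3
keptValence (suc _) _       = 3

freshValence : ∀ {k} → ℕ → Vec ℕ k → ℕ
freshValence zero    _  = 3
freshValence (suc r) rs = suc (keptValence r rs)

-- The bound 5, applied with the preceding letter t, allows at most one further turn about the same
-- pivot.
kept-valence : ∀ t w → Tame 5 (t ∷ w) → valence t w ≡ keptValence (length (run t w)) (Vec.fromList (laterRuns t w))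
kept-valence t []       _ = refl
kept-valence t (t′ ∷ w) (v ∷ _) with compare t t′
... | opp  = valence-opp t w
... | same = trans (valence-same t w) (cong suc (ℕ.≤-antisym
  (ℕ.+-cancelˡ-≤ 2 _ _ (subst (_≤ 5) (trans (valence-same t _) (cong suc (valence-same t w))) (v t)))
  (3≤valence t w)))

fresh-valence : ∀ t w → Tame 5 (t ∷ w) →
  valence (opposite t) w ≡ freshValence (length (run t w)) (Vec.fromList (laterRuns t w))
fresh-valence t []       _ = refl
fresh-valence t (t′ ∷ w) (_ ∷ tame) with compare t t′
... | same = valence-opp′ t w
... | opp  = trans (valence-same (opposite t) w) (cong suc (kept-valence (opposite t) w tame))

-- Summing the edge weights along the word

module Weight (f : ℕ → ℕ → ℚ) where

  -- Terms of the sequences of θ a b and θ b a may differ although the reals agree. Reading f only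
  -- at ordered indices gives a weight that is symmetric exactly.
  ϑ : ℕ → ℕ → ℚ
  ϑ a b = if a ≤ᵇ b then f a b else f b a

  ϑ-sym : ∀ a b → ϑ a b ≡ ϑ b a
  ϑ-sym a b with a ≤ᵇ b in p | b ≤ᵇ a in q
  ... | true  | true  with refl ← ℕ.≤-antisym (ℕ.≤ᵇ⇒≤ a b (subst Bool.T (sym p) tt)) (ℕ.≤ᵇ⇒≤ b a (subst Bool.T (sym q) tt)) = refl
  ... | true  | false = refl
  ... | false | true  = refl
  ... | false | false with ℕ.≤-total a b
  ...   | inj₁ a≤b = ⊥-elim (subst Bool.T p (ℕ.≤⇒≤ᵇ a≤b))
  ...   | inj₂ b≤a = ⊥-elim (subst Bool.T q (ℕ.≤⇒≤ᵇ b≤a))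

  weight : (Point → ℕ) → Side → ℚ
  weight D (u , v) = ϑ (D u) (D v)

  total : (Point → ℕ) → List Side → ℚ
  total D = foldr (λ e → weight D e ℚ.+_) 0ℚ

  weight-joins : ∀ D {e p q} → Joins e p q → weight D e ≡ ϑ (D p) (D q)
  weight-joins D (inj₁ refl) = refl
  weight-joins D (inj₂ refl) = ϑ-sym _ _

  total-↭ : ∀ D {es es′} → es ↭ es′ → total D es ≡ total D es′
  total-↭ D ↭.refl = refl
  total-↭ D (↭.prep e p) = cong (weight D e ℚ.+_) (total-↭ D p)
  total-↭ D (↭.swap e e′ p) = trans (x∙yz≈y∙xz (weight D e) (weight D e′) _)
    (cong (λ q → weight D e′ ℚ.+ (weight D e ℚ.+ q)) (total-↭ D p))
  total-↭ D (↭.trans p q) = trans (total-↭ D p) (total-↭ D q)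

  -- The weight of the edges still to come after a turn to t, when the apex has
  -- degree p and the pivot has met a edges so far.
  pending : ℕ → ℕ → Turn → Word → ℚ
  pending p a t [] = ϑ p (a ℕ.+ 3) ℚ.+ (ϑ p 3 ℚ.+ (ϑ (a ℕ.+ 3) 3 ℚ.+ (ϑ (a ℕ.+ 3) 2 ℚ.+ (ϑ 3 2 ℚ.+ 0ℚ))))
  pending p a t (t′ ∷ w) with compare t t′
  ... | same = ϑ p (a ℕ.+ valence t (t ∷ w)) ℚ.+ (ϑ p (valence (opposite t) (t ∷ w)) ℚ.+ pending 3 (suc a) t w)
  ... | opp  = ϑ p (a ℕ.+ valence t (opposite t ∷ w)) ℚ.+
    (ϑ p (valence (opposite t) (opposite t ∷ w)) ℚ.+ pending (a ℕ.+ 3) 1 (opposite t) w)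

  Untouched : (Point → ℕ) → HalfEdge → Word → Set
  Untouched A g w = ∀ {u} → u ∈ verts g w → u ≢ apex g → u ≢ source g → u ≢ target g → A u ≡ 0

  total-outers : ∀ D t g es → total D (outers g es) ≡
    ϑ (D (apex g)) (D (pivot t g)) ℚ.+ (ϑ (D (apex g)) (D (pivot (opposite t) g)) ℚ.+ total D es)
  total-outers D left g es = cong₂ ℚ._+_ (weight-joins D (outer-joins left g))
    (cong (ℚ._+ total D es) (weight-joins D (outer-joins right g)))
  total-outers D right g es = trans (total-outers D left g es)
    (x∙yz≈y∙xz (ϑ (D (apex g)) (D (source g))) (ϑ (D (apex g)) (D (target g))) (total D es))

  total-end : ∀ D t g → total D (side g ∷ side (step left g) ∷ side (step right g) ∷ []) ≡
    ϑ (D (pivot t g)) (D (pivot (opposite t) g)) ℚ.+ (ϑ (D (pivot t g)) (D (apex (flip g))) ℚ.+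
      (ϑ (D (pivot (opposite t) g)) (D (apex (flip g))) ℚ.+ 0ℚ))
  total-end D left g = cong₂ ℚ._+_ (weight-joins D (side-ends g))
    (cong₂ ℚ._+_ (weight-joins D (step-joins left g)) (cong (ℚ._+ 0ℚ) (weight-joins D (step-joins right g))))
  total-end D right g = trans (total-end D left g) (cong₂ ℚ._+_ (ϑ-sym (D (source g)) (D (target g)))
    (x∙yz≈y∙xz (ϑ (D (source g)) (D (apex (flip g)))) (ϑ (D (target g)) (D (apex (flip g)))) 0ℚ))

  -- A counts the edges already removed at each vertex, while D keeps the degrees in the whole
  -- chain. After a turn only the apex and the pivot of that turn have lost edges, as `Untouched`
  -- and the last hypothesis record, so two numbers describe the state.
  total-pending : ∀ D A t g w → Unique (verts g w) →
    (∀ u → D u ≡ A u ℕ.+ incidence u (edgeList g w)) → Untouched A g w → A (pivot (opposite t) g) ≡ 0 →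
    total D (edgeList g w) ≡ pending (D (apex g)) (A (pivot t g)) t w
  total-pending D A t g [] uniq deg new o≡0 = begin
    total D (edgeList g [])
      ≡⟨ total-outers D t g (side g ∷ side (step left g) ∷ side (step right g) ∷ []) ⟩
    ϑ (D a) (D k) ℚ.+ (ϑ (D a) (D o) ℚ.+ total D (side g ∷ side (step left g) ∷ side (step right g) ∷ []))
      ≡⟨ cong (λ q → ϑ (D a) (D k) ℚ.+ (ϑ (D a) (D o) ℚ.+ q)) (total-end D t g) ⟩
    ending (D k) (D o) (D (apex (flip g)))
      ≡⟨ cong₂ (λ x y → ending x y (D (apex (flip g)))) (deg-pivot t)
               (trans (deg-pivot (opposite t)) (cong (ℕ._+ 3) o≡0)) ⟩
    ending (A k ℕ.+ 3) 3 (D (apex (flip g)))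
      ≡⟨ cong (ending (A k ℕ.+ 3) 3) deg-tip ⟩
    pending (D a) (A k) t [] ∎
    where
    open ≡-Reasoning
    a = apex g
    k = pivot t g
    o = pivot (opposite t) g
    ending : ℕ → ℕ → ℕ → ℚ
    ending x y z = ϑ (D a) x ℚ.+ (ϑ (D a) y ℚ.+ (ϑ x y ℚ.+ (ϑ x z ℚ.+ (ϑ y z ℚ.+ 0ℚ))))
    deg-pivot : ∀ t → D (pivot t g) ≡ A (pivot t g) ℕ.+ 3
    deg-pivot t = trans (deg (pivot t g)) (cong (A (pivot t g) ℕ.+_) (incidence-pivot t g [] uniq))
    a≢tip : a ≢ apex (flip g)
    a≢tip = All.lookup (AllPairs.head uniq) (there (there (here refl)))
    deg-tip : D (apex (flip g)) ≡ 2
    deg-tip = trans (deg (apex (flip g))) (cong₂ ℕ._+_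
      (new (there (there (there (here refl)))) (a≢tip ∘ sym) (tip≢pivot left g) (tip≢pivot right g))
      (incidence-tip g a≢tip))
  total-pending D A t g (t′ ∷ w) uniq@(a∉ ∷ uniq′) deg new o≡0 = trans (total-outers D t g (edgeList (step t′ g) w)) (turning t′ refl)
    where
    a = apex g
    A′ : Point → ℕ
    A′ u = incidence u (outers g []) ℕ.+ A u
    deg-pivot : ∀ t → D (pivot t g) ≡ A (pivot t g) ℕ.+ valence t (t′ ∷ w)
    deg-pivot t = trans (deg (pivot t g)) (cong (A (pivot t g) ℕ.+_) (incidence-pivot t g (t′ ∷ w) uniq))
    deg-other : D (pivot (opposite t) g) ≡ valence (opposite t) (t′ ∷ w)
    deg-other = trans (deg-pivot (opposite t)) (cong (ℕ._+ _) o≡0)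
    deg′ : ∀ u → D u ≡ A′ u ℕ.+ incidence u (edgeList (step t′ g) w)
    deg′ u = begin
      D u ≡⟨ deg u ⟩
      A u ℕ.+ incidence u (outers g es) ≡⟨ cong (A u ℕ.+_) (incidence-++ u (outers g []) es) ⟩
      A u ℕ.+ (incidence u (outers g []) ℕ.+ incidence u es) ≡⟨ ℕ.+-assoc (A u) _ _ ⟨
      (A u ℕ.+ incidence u (outers g [])) ℕ.+ incidence u es ≡⟨ cong (ℕ._+ incidence u es) (ℕ.+-comm (A u) _) ⟩
      A′ u ℕ.+ incidence u es ∎
      where
      open ≡-Reasoning
      es = edgeList (step t′ g) w
    outside : ∀ {u} → u ∈ verts (step t′ g) w → u ≢ source g → u ≢ target g → A′ u ≡ 0
    outside u∈ u≢s u≢t = cong₂ ℕ._+_ (incidence-outers-other {g} [] u≢a u≢s u≢t) (new (there u∈) u≢a u≢s u≢t)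
      where u≢a = λ { refl → All.lookup a∉ u∈ refl }
    new′ : Untouched A′ (step t′ g) w
    new′ {u} u∈ u≢a u≢s u≢t = outside u∈ (u≢pivot left) (u≢pivot right)
      where
      u≢pivot′ : ∀ t → u ≢ pivot t (step t′ g)
      u≢pivot′ left  = u≢s
      u≢pivot′ right = u≢t
      u≢pivot : ∀ t → u ≢ pivot t g
      u≢pivot t eq with compare t′ t
      ... | same = u≢pivot′ t′ (trans eq (sym (pivot-keep t′ g)))
      ... | opp  = u≢a (trans eq (sym (apex-step t′ g)))
    tip-untouched : A′ (pivot (opposite t′) (step t′ g)) ≡ 0
    tip-untouched = outside (pivot∈verts (opposite t′) (step t′ g) w)
      (λ eq → tip≢pivot left g (trans (sym (pivot-fresh t′ g)) eq))
      (λ eq → tip≢pivot right g (trans (sym (pivot-fresh t′ g)) eq))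
    rest : total D (edgeList (step t′ g) w) ≡ pending (D (pivot (opposite t′) g)) (suc (A (pivot t′ g))) t′ w
    rest = trans (total-pending D A′ t′ (step t′ g) w uniq′ deg′ new′ tip-untouched)
      (cong₂ (λ x y → pending x y t′ w) (cong D (apex-step t′ g))
        (trans (cong A′ (pivot-keep t′ g)) (cong (ℕ._+ A (pivot t′ g)) (incidence-outers-pivot t′ g []))))
    -- The letter is generalised together with an equation, so that `compare` can be matched on
    -- although t′ occurs throughout the facts above.
    turning : ∀ t″ → t″ ≡ t′ →
      ϑ (D a) (D (pivot t g)) ℚ.+ (ϑ (D a) (D (pivot (opposite t) g)) ℚ.+ total D (edgeList (step t′ g) w)) ≡
      pending (D a) (A (pivot t g)) t (t″ ∷ w)
    turning t″ eq with compare t t″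
    turning _ refl | same = cong₂ (λ x y → ϑ (D a) x ℚ.+ y) (deg-pivot t)
      (cong₂ (λ x y → ϑ (D a) x ℚ.+ y) deg-other
        (trans rest (cong (λ x → pending x (suc (A (pivot t g))) t w) (trans deg-other (valence-opp′ t w)))))
    turning _ refl | opp = cong₂ (λ x y → ϑ (D a) x ℚ.+ y) (deg-pivot t)
      (cong₂ (λ x y → ϑ (D a) x ℚ.+ y) deg-other
        (trans rest (cong₂ (λ x y → pending x y (opposite t) w)
          (trans (cong (λ t → D (pivot t g)) (opposite² t)) (trans (deg-pivot t) (cong (A (pivot t g) ℕ.+_) (valence-opp t w))))
          (cong suc o≡0))))

  total-edges : ∀ g t w → Chain (ribbon g (t ∷ w)) →
    total (degree (ribbon g (t ∷ w))) (edges (ribbon g (t ∷ w))) ≡ pending 2 0 t (t ∷ w)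
  total-edges g t w ch = begin
    total D (edges (ribbon g (t ∷ w))) ≡⟨ total-↭ D (edges-↭ g (t ∷ w) uniq) ⟩
    total D (edgeList g (t ∷ w))
      ≡⟨ total-pending D (λ _ → 0) t g (t ∷ w) uniq deg (λ _ _ _ _ → refl) refl ⟩
    pending (D (apex g)) 0 t (t ∷ w)
      ≡⟨ cong (λ p → pending p 0 t (t ∷ w)) (trans (deg (apex g)) (incidence-apex g (t ∷ w) uniq)) ⟩
    pending 2 0 t (t ∷ w) ∎
    where
    open ≡-Reasoning
    D    = degree (ribbon g (t ∷ w))
    uniq = verts-unique g (t ∷ w) ch
    deg  = degree≡incidence g (t ∷ w) uniq

  -- Run lengths determine all degrees ahead, so the turns are forgotten. In the closed forms below
  -- a is 2 right after a break and 1 otherwise.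
  pendingRuns : ∀ {k} → ℕ → ℕ → ℕ → Vec ℕ k → ℚ
  pendingRuns p a zero    []        =
    ϑ p (a ℕ.+ 3) ℚ.+ (ϑ p 3 ℚ.+ (ϑ (a ℕ.+ 3) 3 ℚ.+ (ϑ (a ℕ.+ 3) 2 ℚ.+ (ϑ 3 2 ℚ.+ 0ℚ))))
  pendingRuns p a zero    (r′ ∷ rs) = ϑ p (a ℕ.+ 4) ℚ.+ (ϑ p 3 ℚ.+ pendingRuns 3 (suc a) r′ rs)
  pendingRuns p a (suc r) rs        =
    ϑ p (a ℕ.+ 3) ℚ.+ (ϑ p (suc (keptValence r rs)) ℚ.+ pendingRuns (a ℕ.+ 3) 1 r rs)

  pending-runs : ∀ p a t w → Tame 5 (t ∷ w) →
    pending p a t w ≡ pendingRuns p a (length (run t w)) (Vec.fromList (laterRuns t w))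
  pending-runs p a t [] _ = refl
  pending-runs p a t (t′ ∷ w) tame@(_ ∷ tame′) with compare t t′ | kept-valence t (t′ ∷ w) tame | fresh-valence t (t′ ∷ w) tame
  ... | same | kv | fv = cong₂ (λ x y → ϑ p (a ℕ.+ x) ℚ.+ y) kv
    (cong₂ (λ x y → ϑ p x ℚ.+ y) fv (pending-runs 3 (suc a) t w tame′))
  ... | opp  | kv | fv = cong₂ (λ x y → ϑ p (a ℕ.+ x) ℚ.+ y) kv
    (cong₂ (λ x y → ϑ p x ℚ.+ y) fv (pending-runs (a ℕ.+ 3) 1 (opposite t) w tame′))

·-homo-+ : ∀ x m n → (m ℕ.+ n) · x ≡ m · x + n · x
·-homo-+ = ×-homo-+

double : ∀ n x → (2 ℕ.* n) · x ≡ n · (x + x)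
double zero    x = refl
double (suc n) x = trans (cong (_· x) (ℕ.*-suc 2 n))
  (trans (sym (ℚ.+-assoc x x _)) (cong (x + x +_) (double n x)))

-- Unfolds exactly as `_·_` does, so that the solver's polynomials evaluate to the rational
-- expressions by computation.
times : ∀ {m} → ℕ → Polynomial m → Polynomial m
times zero    x = con 0ℚ
times (suc k) x = x :+ times k x

module _ {m} (x₂₃ x₂₄ x₂₅ x₃₃ x₃₄ x₃₅ x₄₄ x₄₅ x₅₅ : Polynomial m) where

  dᵖ Λ₁ᵖ Λ₂ᵖ Λ₃ᵖ Λ₄ᵖ Λ₅ᵖ firstᵖ lastᵖ : Polynomial m
  dᵖ     = x₄₄ :+ x₄₄
  Λ₁ᵖ    = x₂₅ :- x₂₄ :+ x₃₃ :- times 3 x₃₄ :+ x₃₅ :+ times 3 x₄₄ :- times 2 x₄₅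
  Λ₂ᵖ    = x₃₅ :- x₃₄ :+ x₄₄ :- x₄₅
  Λ₃ᵖ    = times 2 x₃₄ :+ x₃₅ :- times 7 x₄₄ :+ times 4 x₄₅
  Λ₄ᵖ    = times 2 x₃₅ :- times 2 x₃₄ :+ times 3 x₄₄ :- times 4 x₄₅ :+ x₅₅
  Λ₅ᵖ    = x₄₄ :- times 2 x₄₅ :+ x₅₅
  firstᵖ = x₂₃ :+ x₂₄ :+ x₃₄ :- x₃₅ :+ times 2 x₄₄ :- times 2 x₄₅
  lastᵖ  = x₂₃ :+ x₂₄ :+ x₃₄ :+ times 4 x₄₄ :- times 2 x₄₅

-- Closed forms, stretch by stretch

module Closed (f : ℕ → ℕ → ℚ) where

  open Weight f

  -- With the multiples of d, first and last are the shares of Λ₀ that belong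
  -- to the two terminal segments.
  d Λ₁ Λ₂ Λ₃ Λ₄ Λ₅ first last : ℚ
  d     = f 4 4 + f 4 4
  Λ₁    = f 2 5 - f 2 4 + f 3 3 - 3 · f 3 4 + f 3 5 + 3 · f 4 4 - 2 · f 4 5
  Λ₂    = f 3 5 - f 3 4 + f 4 4 - f 4 5
  Λ₃    = 2 · f 3 4 + f 3 5 - 7 · f 4 4 + 4 · f 4 5
  Λ₄    = 2 · f 3 5 - 2 · f 3 4 + 3 · f 4 4 - 4 · f 4 5 + f 5 5
  Λ₅    = f 4 4 - 2 · f 4 5 + f 5 5
  first = f 2 3 + f 2 4 + f 3 4 - f 3 5 + 2 · f 4 4 - 2 · f 4 5
  last  = f 2 3 + f 2 4 + f 3 4 + 4 · f 4 4 - 2 · f 4 5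

  Λ₀ : ℕ → ℚ
  Λ₀ n = (2 ℕ.* n) · f 4 4 + 2 · f 2 3 + 2 · f 2 4 + 2 · f 3 4 - f 3 5 - 4 · f 4 5

  Λ₀-split : ∀ n → Λ₀ (3 ℕ.+ n) ≡ n · d + (first + last)
  -- Here and below the solver variables a, b, c, e, g, h, i, j, k stand for the values of f at 23,
  -- 24, 25, 33, 34, 35, 44, 45, 55.
  Λ₀-split n rewrite double (3 ℕ.+ n) (f 4 4) = solve 10 (λ a b c e g h i j k y →
    (let x = dᵖ a b c e g h i j k in x :+ (x :+ (x :+ y))) :+ times 2 a :+ times 2 b :+ times 2 g :- h :- times 4 j
      := y :+ (firstᵖ a b c e g h i j k :+ lastᵖ a b c e g h i j k))
    refl (f 2 3) (f 2 4) (f 2 5) (f 3 3) (f 3 4) (f 3 5) (f 4 4) (f 4 5) (f 5 5) (n · d)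

  keptValence-end : ∀ r → keptValence r [] ≡ 3
  keptValence-end zero    = refl
  keptValence-end (suc _) = refl

  -- Away from the ends of a stretch all degrees are 4, so each letter adds two edges of weight
  -- `f 4 4`.
  middle-end : ∀ r → pendingRuns 4 1 r [] ≡ r · d + (f 4 4 + (f 3 4 + (f 3 4 + (f 2 4 + (f 2 3 + 0ℚ)))))
  middle-end zero    = sym (ℚ.+-identityˡ _)
  middle-end (suc r) rewrite keptValence-end r | middle-end r =
    solve 3 (λ x y z → x :+ (x :+ (y :+ z)) := x :+ x :+ y :+ z) refl (f 4 4) (r · d) _

  middle-break : ∀ {k} r r′ (rs : Vec ℕ k) → pendingRuns 4 1 (suc r) (r′ ∷ rs) ≡
    r · d + (f 4 4 + (f 4 5 + (f 4 5 + (f 3 4 + pendingRuns 3 2 r′ rs))))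
  middle-break zero    r′ rs = sym (ℚ.+-identityˡ _)
  middle-break (suc r) r′ rs rewrite middle-break r r′ rs =
    solve 3 (λ x y z → x :+ (x :+ (y :+ z)) := x :+ x :+ y :+ z) refl (f 4 4) (r · d) _

  -- The vertex of degree 5 at the break is adjacent to the final vertex of degree 2 when the length
  -- is 3, and to the last vertex of degree 3 when it is 4. These are the corrections Λ₁ and Λ₂;
  -- from length 5 on it is out of reach of the end.
  last-segment : ∀ r → pendingRuns 3 2 r [] ≡ r · d + (last + (η (3 ℕ.+ r) · Λ₁ + (ξ (3 ℕ.+ r) · Λ₂ + Λ₃)))
  last-segment 0 = solve 9 (λ a b c e g h i j k →
    h :+ (e :+ (h :+ (c :+ (a :+ con 0ℚ)))) :=
    con 0ℚ :+ (lastᵖ a b c e g h i j k :+ (times 1 (Λ₁ᵖ a b c e g h i j k) :+ (con 0ℚ :+ Λ₃ᵖ a b c e g h i j k))))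
    refl (f 2 3) (f 2 4) (f 2 5) (f 3 3) (f 3 4) (f 3 5) (f 4 4) (f 4 5) (f 5 5)
  last-segment 1 = solve 9 (λ a b c e g h i j k →
    h :+ (g :+ (j :+ (h :+ (g :+ (b :+ (a :+ con 0ℚ)))))) :=
    times 1 (dᵖ a b c e g h i j k) :+ (lastᵖ a b c e g h i j k :+ (con 0ℚ :+ (times 1 (Λ₂ᵖ a b c e g h i j k) :+ Λ₃ᵖ a b c e g h i j k))))
    refl (f 2 3) (f 2 4) (f 2 5) (f 3 3) (f 3 4) (f 3 5) (f 4 4) (f 4 5) (f 5 5)
  last-segment (suc (suc m)) rewrite keptValence-end m | middle-end m = solve 10 (λ a b c e g h i j k y →
    h :+ (g :+ (j :+ (j :+ (y :+ (i :+ (g :+ (g :+ (b :+ (a :+ con 0ℚ))))))))) :=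
    dᵖ a b c e g h i j k :+ (dᵖ a b c e g h i j k :+ y) :+ (lastᵖ a b c e g h i j k :+ (con 0ℚ :+ (con 0ℚ :+ Λ₃ᵖ a b c e g h i j k))))
    refl (f 2 3) (f 2 4) (f 2 5) (f 3 3) (f 3 4) (f 3 5) (f 4 4) (f 4 5) (f 5 5) (m · d)

  -- Each of the two breaks has a vertex of degree 5, and these are adjacent exactly for lengths 4
  -- and 5. That is the source of `f 5 5` in Λ₄ and Λ₅.
  inner-segment : ∀ {k} m r′ (rs : Vec ℕ k) → pendingRuns 3 2 (suc m) (r′ ∷ rs) ≡
    (2 ℕ.+ m) · d + (Λ₃ + (ξ (4 ℕ.+ m) · Λ₄ + σ (4 ℕ.+ m) · Λ₅)) + pendingRuns 3 2 r′ rs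
  inner-segment 0 r′ rs = solve 10 (λ a b c e g h i j k x →
    h :+ (h :+ (k :+ (h :+ x))) :=
    times 2 (dᵖ a b c e g h i j k) :+ (Λ₃ᵖ a b c e g h i j k :+ (times 1 (Λ₄ᵖ a b c e g h i j k) :+ con 0ℚ)) :+ x)
    refl (f 2 3) (f 2 4) (f 2 5) (f 3 3) (f 3 4) (f 3 5) (f 4 4) (f 4 5) (f 5 5) _
  inner-segment 1 r′ rs = solve 10 (λ a b c e g h i j k x →
    h :+ (g :+ (j :+ (k :+ (j :+ (g :+ x))))) :=
    times 3 (dᵖ a b c e g h i j k) :+ (Λ₃ᵖ a b c e g h i j k :+ (con 0ℚ :+ times 1 (Λ₅ᵖ a b c e g h i j k))) :+ x)
    refl (f 2 3) (f 2 4) (f 2 5) (f 3 3) (f 3 4) (f 3 5) (f 4 4) (f 4 5) (f 5 5) _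
  inner-segment (suc (suc m)) r′ rs rewrite middle-break m r′ rs = solve 11 (λ a b c e g h i j k y x →
    h :+ (g :+ (j :+ (j :+ (y :+ (i :+ (j :+ (j :+ (g :+ x)))))))) :=
    (let z = dᵖ a b c e g h i j k in z :+ (z :+ (z :+ (z :+ y)))) :+ (Λ₃ᵖ a b c e g h i j k :+ (con 0ℚ :+ con 0ℚ)) :+ x)
    refl (f 2 3) (f 2 4) (f 2 5) (f 3 3) (f 3 4) (f 3 5) (f 4 4) (f 4 5) (f 5 5) (m · d) _

  pendingAll : ∀ {k} → ℕ → Vec ℕ k → ℚ
  pendingAll r rs = ϑ 2 (suc (keptValence r rs)) + (ϑ 2 3 + pendingRuns 3 1 r rs)

  -- In the long case the edge of weight `f 3 5` at the break is counted with the stretch after it.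
  -- The first stretch has none before it, so the negative `f 3 5` in `first` cancels the one in Λ₃.
  first-segment : ∀ {k} r r′ (rs : Vec ℕ k) → pendingAll r (r′ ∷ rs) ≡
    suc r · d + (first + (η (3 ℕ.+ r) · Λ₁ + (ξ (3 ℕ.+ r) · Λ₂ + Λ₃))) + pendingRuns 3 2 r′ rs
  first-segment 0 r′ rs = solve 10 (λ a b c e g h i j k x →
    c :+ (a :+ (h :+ (e :+ x))) :=
    times 1 (dᵖ a b c e g h i j k) :+ (firstᵖ a b c e g h i j k :+ (times 1 (Λ₁ᵖ a b c e g h i j k) :+ (con 0ℚ :+ Λ₃ᵖ a b c e g h i j k))) :+ x)
    refl (f 2 3) (f 2 4) (f 2 5) (f 3 3) (f 3 4) (f 3 5) (f 4 4) (f 4 5) (f 5 5) _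
  first-segment 1 r′ rs = solve 10 (λ a b c e g h i j k x →
    b :+ (a :+ (g :+ (h :+ (j :+ (g :+ x))))) :=
    times 2 (dᵖ a b c e g h i j k) :+ (firstᵖ a b c e g h i j k :+ (con 0ℚ :+ (times 1 (Λ₂ᵖ a b c e g h i j k) :+ Λ₃ᵖ a b c e g h i j k))) :+ x)
    refl (f 2 3) (f 2 4) (f 2 5) (f 3 3) (f 3 4) (f 3 5) (f 4 4) (f 4 5) (f 5 5) _
  first-segment (suc (suc m)) r′ rs rewrite middle-break m r′ rs = solve 11 (λ a b c e g h i j k y x →
    b :+ (a :+ (g :+ (g :+ (y :+ (i :+ (j :+ (j :+ (g :+ x)))))))) :=
    (let z = dᵖ a b c e g h i j k in z :+ (z :+ (z :+ y))) :+ (firstᵖ a b c e g h i j k :+ (con 0ℚ :+ (con 0ℚ :+ Λ₃ᵖ a b c e g h i j k))) :+ x)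
    refl (f 2 3) (f 2 4) (f 2 5) (f 3 3) (f 3 4) (f 3 5) (f 4 4) (f 4 5) (f 5 5) (m · d) _

  only-segment : ∀ m → pendingAll (suc m) [] ≡ Λ₀ (4 ℕ.+ m) + Λ₃
  only-segment m rewrite keptValence-end m | middle-end m | Λ₀-split (suc m) = solve 10 (λ a b c e g h i j k y →
    b :+ (a :+ (g :+ (g :+ (y :+ (i :+ (g :+ (g :+ (b :+ (a :+ con 0ℚ))))))))) :=
    dᵖ a b c e g h i j k :+ y :+ (firstᵖ a b c e g h i j k :+ lastᵖ a b c e g h i j k) :+ Λ₃ᵖ a b c e g h i j k)
    refl (f 2 3) (f 2 4) (f 2 5) (f 3 3) (f 3 4) (f 3 5) (f 4 4) (f 4 5) (f 5 5) (m · d)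

  -- A stretch before the last contributes one d more than its run has letters, the extra one being
  -- for the break, just as in `letters`. The condition `Inner` excludes an empty run there.
  later-segments : ∀ {k} r (rs : Vec ℕ k) → Inner r rs → let ls = Vec.map (3 ℕ.+_) (r ∷ rs) in
    pendingRuns 3 2 r rs ≡ letters r rs · d + (last + (η (Vec.last ls) · Λ₁ + (ξ (Vec.last ls) · Λ₂ +
      (suc k · Λ₃ + (Vec.sum (Vec.map ξ (Vec.init ls)) · Λ₄ + Vec.sum (Vec.map σ (Vec.init ls)) · Λ₅)))))
  later-segments r [] _ = trans (last-segment r) (solve 5
    (λ y z p q x → y :+ (z :+ (p :+ (q :+ x))) := y :+ (z :+ (p :+ (q :+ (x :+ con 0ℚ :+ (con 0ℚ :+ con 0ℚ))))))
    refl (r · d) last (η (3 ℕ.+ r) · Λ₁) (ξ (3 ℕ.+ r) · Λ₂) Λ₃)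
  later-segments {suc k} (suc m) (r′ ∷ rs) (_ , inner)
    rewrite ·-homo-+ d m (letters r′ rs)
          | ·-homo-+ Λ₄ (ξ (4 ℕ.+ m)) (Vec.sum (Vec.map ξ (Vec.init (Vec.map (3 ℕ.+_) (r′ ∷ rs)))))
          | ·-homo-+ Λ₅ (σ (4 ℕ.+ m)) (Vec.sum (Vec.map σ (Vec.init (Vec.map (3 ℕ.+_) (r′ ∷ rs)))))
    = trans (inner-segment m r′ rs) (trans (cong ((2 ℕ.+ m) · d + (Λ₃ + (ξ (4 ℕ.+ m) · Λ₄ + σ (4 ℕ.+ m) · Λ₅)) +_)
        (later-segments r′ rs inner))
      (solve 12 (λ d y l₃ e₄ e₅ u z p₁ p₂ p₃ p₄ p₅ →
        d :+ (d :+ y) :+ (l₃ :+ (e₄ :+ e₅)) :+ (u :+ (z :+ (p₁ :+ (p₂ :+ (p₃ :+ (p₄ :+ p₅)))))) :=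
        d :+ (d :+ (y :+ u)) :+ (z :+ (p₁ :+ (p₂ :+ (l₃ :+ p₃ :+ (e₄ :+ p₄ :+ (e₅ :+ p₅)))))))
        refl d (m · d) Λ₃ (ξ (4 ℕ.+ m) · Λ₄) (σ (4 ℕ.+ m) · Λ₅) (letters r′ rs · d) last
        (η (Vec.last ls) · Λ₁) (ξ (Vec.last ls) · Λ₂) (suc k · Λ₃)
        (Vec.sum (Vec.map ξ (Vec.init ls)) · Λ₄) (Vec.sum (Vec.map σ (Vec.init ls)) · Λ₅)))
    where ls = Vec.map (3 ℕ.+_) (r′ ∷ rs)

  all-segments : ∀ {k} r r′ (rs : Vec ℕ k) → Inner r′ rs → let l₁ = 3 ℕ.+ r ; ls = Vec.map (3 ℕ.+_) (r′ ∷ rs) in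
    pendingAll r (r′ ∷ rs) ≡
    Λ₀ (3 ℕ.+ letters r (r′ ∷ rs)) + (η l₁ ℕ.+ η (Vec.last ls)) · Λ₁ + (ξ l₁ ℕ.+ ξ (Vec.last ls)) · Λ₂ + (2 ℕ.+ k) · Λ₃
      + Vec.sum (Vec.map ξ (Vec.init ls)) · Λ₄ + Vec.sum (Vec.map σ (Vec.init ls)) · Λ₅
  all-segments {k} r r′ rs inner
    rewrite Λ₀-split (letters r (r′ ∷ rs)) | ·-homo-+ d r (letters r′ rs)
          | ·-homo-+ Λ₁ (η (3 ℕ.+ r)) (η (Vec.last (Vec.map (3 ℕ.+_) (r′ ∷ rs))))
          | ·-homo-+ Λ₂ (ξ (3 ℕ.+ r)) (ξ (Vec.last (Vec.map (3 ℕ.+_) (r′ ∷ rs))))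
    = trans (first-segment r r′ rs) (trans (cong (suc r · d + (first + (η (3 ℕ.+ r) · Λ₁ + (ξ (3 ℕ.+ r) · Λ₂ + Λ₃))) +_)
        (later-segments r′ rs inner))
      (solve 13 (λ d y s h₁ x₁ l₃ u z p₁ p₂ p₃ p₄ p₅ →
        d :+ y :+ (s :+ (h₁ :+ (x₁ :+ l₃))) :+ (u :+ (z :+ (p₁ :+ (p₂ :+ (p₃ :+ (p₄ :+ p₅)))))) :=
        d :+ (y :+ u) :+ (s :+ z) :+ (h₁ :+ p₁) :+ (x₁ :+ p₂) :+ (l₃ :+ p₃) :+ p₄ :+ p₅)
        refl d (r · d) first (η (3 ℕ.+ r) · Λ₁) (ξ (3 ℕ.+ r) · Λ₂) Λ₃ (letters r′ rs · d) last
        (η (Vec.last ls) · Λ₁) (ξ (Vec.last ls) · Λ₂) (suc k · Λ₃)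
        (Vec.sum (Vec.map ξ (Vec.init ls)) · Λ₄) (Vec.sum (Vec.map σ (Vec.init ls)) · Λ₅)))
    where ls = Vec.map (3 ℕ.+_) (r′ ∷ rs)

  pending-all : ∀ t w → Tame 5 (t ∷ w) →
    pending 2 0 t (t ∷ w) ≡ pendingAll (length (run t w)) (Vec.fromList (laterRuns t w))
  pending-all t w tame = trans (start t w) (cong₂ (λ x y → ϑ 2 (suc x) + (ϑ 2 3 + y))
    (kept-valence t w tame) (pending-runs 3 1 t w tame))
    where
    start : ∀ t w → pending 2 0 t (t ∷ w) ≡ ϑ 2 (suc (valence t w)) + (ϑ 2 3 + pending 3 1 t w)
    start left  w = refl
    start right w = refl

-- Passage to the reals

seq-· : ∀ k x m → seq (k D.· x) m ≡ k · seq x m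
seq-· zero    x m = refl
seq-· (suc k) x m = cong (seq x m +_) (seq-· k x m)

seq-≡⇒≈ : ∀ {x y z} → x ≈ y → (∀ m → seq y m ≡ seq z m) → x ≈ z
seq-≡⇒≈ {x} x≈y eq ε 0<ε with N , p ← x≈y ε 0<ε =
  N , λ n N≤n → subst (λ q → ℚ.∣ seq x n - q ∣ ℚ.< ε) (eq n) (p n N≤n)

≈-refl : ∀ {x} → x ≈ x
≈-refl {x} ε 0<ε = 0 , λ n _ → subst (λ q → ℚ.∣ q ∣ ℚ.< ε) (sym (ℚ.+-inverseʳ (seq x n))) 0<ε

0<½*ε : ∀ {ε} → 0ℚ ℚ.< ε → 0ℚ ℚ.< ½ ℚ.* ε
0<½*ε {ε} 0<ε = subst (ℚ._< ½ ℚ.* ε) (ℚ.*-zeroʳ ½) (ℚ.*-monoʳ-<-pos ½ 0<ε)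

+-cong : ∀ {x x′ y y′} → x ≈ x′ → y ≈ y′ → x D.+ y ≈ x′ D.+ y′
+-cong {x} {x′} {y} {y′} x≈x′ y≈y′ ε 0<ε
  with N , p ← x≈x′ (½ ℚ.* ε) (0<½*ε 0<ε) | M , q ← y≈y′ (½ ℚ.* ε) (0<½*ε 0<ε) =
  N ℕ.⊔ M , λ n le → subst₂ ℚ._<_
    (cong ℚ.∣_∣ (solve 4 (λ a b c d → (a :- c) :+ (b :- d) := (a :+ b) :- (c :+ d)) refl
      (seq x n) (seq y n) (seq x′ n) (seq y′ n)))
    (trans (sym (ℚ.*-distribʳ-+ ε ½ ½)) (ℚ.*-identityˡ ε))
    (ℚ.≤-<-trans (ℚ.∣p+q∣≤∣p∣+∣q∣ (seq x n - seq x′ n) (seq y n - seq y′ n))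
      (ℚ.+-mono-< (p n (ℕ.m⊔n≤o⇒m≤o N M le)) (q n (ℕ.m⊔n≤o⇒n≤o N M le))))

sumℝ-cong : ∀ {A : Set} {F G : A → ℝ} → (∀ x → F x ≈ G x) → ∀ xs → sumℝ (map F xs) ≈ sumℝ (map G xs)
sumℝ-cong         eq []       = ≈-refl {0ℝ}
sumℝ-cong {F = F} {G} eq (x ∷ xs) = +-cong {F x} {G x} {sumℝ (map F xs)} {sumℝ (map G xs)} (eq x) (sumℝ-cong eq xs)

sorted : (ℕ → ℕ → ℝ) → ℕ → ℕ → ℝ
sorted θ a b = if a ≤ᵇ b then θ a b else θ b a

-- The symmetry of θ enters here; after this replacement both sides of the theorem agree term by
-- term.
sorted-≈ : ∀ {θ} → IsBIDWeight θ → ∀ a b → θ a b ≈ sorted θ a b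
sorted-≈ {θ} bid a b with a ≤ᵇ b
... | true  = ≈-refl {θ a b}
... | false = IsBIDWeight.symmetric bid a b

seq-sum : ∀ θ m D es → seq (sumℝ (map (λ (u , v) → sorted θ (D u) (D v)) es)) m ≡ Weight.total (λ a b → seq (θ a b) m) D es
seq-sum θ m D []             = refl
seq-sum θ m D ((u , v) ∷ es) = cong₂ _+_ (if-float (λ x → seq x m) (D u ≤ᵇ D v)) (seq-sum θ m D es)

vec-≡ : ∀ {A : Set} {m n} (xs : Vec A m) (ys : Vec A n) → Vec.toList xs ≡ Vec.toList ys →
        (∃ (Vec A) ∋ (m , xs)) ≡ (n , ys)
vec-≡ []       []       _  = refl
vec-≡ (x ∷ xs) (y ∷ ys) eq with refl ← ∷-injectiveˡ eq with refl ← vec-≡ xs ys (∷-injectiveʳ eq) = refl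

seq-Λ₀ : ∀ θ m n → seq (Formula.Λ₀ θ n) m ≡ Closed.Λ₀ (λ a b → seq (θ a b) m) n
seq-Λ₀ θ m n = cong
  (λ q → q + 2 · seq (θ 2 3) m + 2 · seq (θ 2 4) m + 2 · seq (θ 3 4) m - seq (θ 3 5) m - 4 · seq (θ 4 5) m)
  (seq-· (2 ℕ.* n) (θ 4 4) m)

seq-value : ∀ θ m {k} r (rs : Vec ℕ k) → InnerTail rs → 4 ≤ 3 ℕ.+ letters r rs →
  Closed.pendingAll (λ a b → seq (θ a b) m) r rs ≡
  seq (Formula.value θ (3 ℕ.+ letters r rs) (Vec.map (3 ℕ.+_) (r ∷ rs))) m
seq-value θ m (suc r) [] _ _ = trans (only-segment r)
  (cong (_+ Λ₃) (sym (seq-Λ₀ θ m (4 ℕ.+ r))))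
  where
  open Closed (λ a b → seq (θ a b) m)
-- Three triangles: their edge of weight θ 3 3 is missing from the formula for s = 1, and 4 ≤ n
-- excludes them.
seq-value θ m zero [] _ (s≤s (s≤s (s≤s ())))
seq-value θ m r (r′ ∷ rs) inner _ = trans (all-segments r r′ rs inner) (sym (shape rs))
  where
  open Closed (λ a b → seq (θ a b) m)
  shape : ∀ {k} (rs : Vec ℕ k) → let n = 3 ℕ.+ letters r (r′ ∷ rs) ; l₁ = 3 ℕ.+ r ; ls = Vec.map (3 ℕ.+_) (r′ ∷ rs) in
    seq (Formula.value θ n (l₁ ∷ ls)) m ≡
    Λ₀ n + (η l₁ ℕ.+ η (Vec.last ls)) · Λ₁ + (ξ l₁ ℕ.+ ξ (Vec.last ls)) · Λ₂ + (2 ℕ.+ k) · Λ₃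
      + Vec.sum (Vec.map ξ (Vec.init ls)) · Λ₄ + Vec.sum (Vec.map σ (Vec.init ls)) · Λ₅
  -- For two segments `value` has no inner sums; in the general form they are two zero summands.
  shape [] = trans (cong (_+ 2 · Λ₃) (cong₂ _+_ (cong₂ _+_ (seq-Λ₀ θ m n) (seq-· (η l₁ ℕ.+ η l₂) F.Λ₁ m)) (seq-· (ξ l₁ ℕ.+ ξ l₂) F.Λ₂ m)))
    (sym (trans (ℚ.+-identityʳ _) (ℚ.+-identityʳ _)))
    where
    n  = 3 ℕ.+ letters r (r′ ∷ [])
    l₁ = 3 ℕ.+ r
    l₂ = 3 ℕ.+ r′
    module F = Formula θ n
  shape {k} rs@(_ ∷ _) = cong₂ _+_ (cong₂ _+_ (cong₂ _+_ (cong₂ _+_ (cong₂ _+_ (seq-Λ₀ θ m n)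
    (seq-· (η l₁ ℕ.+ η (Vec.last ls)) F.Λ₁ m)) (seq-· (ξ l₁ ℕ.+ ξ (Vec.last ls)) F.Λ₂ m)) (seq-· (2 ℕ.+ k) F.Λ₃ m))
    (seq-· (Vec.sum (Vec.map ξ (Vec.init ls))) F.Λ₄ m)) (seq-· (Vec.sum (Vec.map σ (Vec.init ls))) F.Λ₅ m)
    where
    n  = 3 ℕ.+ letters r (r′ ∷ rs)
    l₁ = 3 ℕ.+ r
    ls = Vec.map (3 ℕ.+_) (r′ ∷ rs)
    module F = Formula θ n

lengthVector-runs : ∀ g t w → Chain (ribbon g (t ∷ w)) → ∀ {k} (l : Vec ℕ k) → LengthVector (ribbon g (t ∷ w)) l →
  (∃ (Vec ℕ) ∋ (k , l)) ≡ (_ , Vec.map (3 ℕ.+_) (length (run t w) ∷ Vec.fromList (laterRuns t w)))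
lengthVector-runs g t w ch l lv = vec-≡ l ls (begin
  Vec.toList l                                    ≡⟨ cong Vec.toList (LengthVector.lengths lv) ⟩
  Vec.toList (Vec.map length (LengthVector.segments lv)) ≡⟨ Vec.toList-map length (LengthVector.segments lv) ⟩
  map length (Vec.toList (LengthVector.segments lv)) ≡⟨ cong (map length) (segments-≡ g t w ch lv) ⟩
  map length (segmentList g t w)                  ≡⟨ segmentList-lengths g t w ⟩
  map (3 ℕ.+_) (r ∷ laterRuns t w)                ≡⟨ cong (λ rs → map (3 ℕ.+_) (r ∷ rs)) (Vec.toList∘fromList (laterRuns t w)) ⟨
  map (3 ℕ.+_) (r ∷ Vec.toList rs)                ≡⟨ Vec.toList-map (3 ℕ.+_) (r ∷ rs) ⟨
  Vec.toList ls                                   ∎)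
  where
  open ≡-Reasoning
  r  = length (run t w)
  rs = Vec.fromList (laterRuns t w)
  ls = Vec.map (3 ℕ.+_) (r ∷ rs)

TI-runs : ∀ g t w → Chain (ribbon g (t ∷ w)) → Tame 5 (t ∷ w) →
  (θ : ℕ → ℕ → ℝ) → IsBIDWeight θ → let r = length (run t w) ; rs = Vec.fromList (laterRuns t w) in
  4 ≤ 3 ℕ.+ letters r rs →
  TI θ (ribbon g (t ∷ w)) ≈ Formula.value θ (3 ℕ.+ letters r rs) (Vec.map (3 ℕ.+_) (r ∷ rs))
TI-runs g t w ch tame θ bid 4≤n =
  seq-≡⇒≈ {TI θ T} {TI (sorted θ) T} {Formula.value θ (3 ℕ.+ letters r rs) (Vec.map (3 ℕ.+_) (r ∷ rs))}
    (sumℝ-cong (λ (u , v) → sorted-≈ bid (degree T u) (degree T v)) (edges T))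
    (λ m → trans (seq-sum θ m (degree T) (edges T))
      (trans (Weight.total-edges (f m) g t w ch)
      (trans (Closed.pending-all (f m) t w tame)
      (seq-value θ m r rs (tame-inner t w tame) 4≤n))))
  where
  T  = ribbon g (t ∷ w)
  r  = length (run t w)
  rs = Vec.fromList (laterRuns t w)
  f : ℕ → ℕ → ℕ → ℚ
  f m a b = seq (θ a b) m

-- The number of segments is known to match the number of runs only through an equality of pairs,
-- along which this predicate can be transported. The empty vector, for which there is no formula,
-- gets ⊤.
HasValue : (ℕ → ℕ → ℝ) → List Cell → ℕ → ∃ (Vec ℕ) → Set
HasValue θ T n (zero  , _) = ⊤
HasValue θ T n (suc _ , l) = TI θ T ≈ Formula.value θ n l

TI-ribbon : ∀ θ → IsBIDWeight θ → ∀ g w → Chain (ribbon g w) → Tame 5 w → 4 ≤ 2 ℕ.+ length w →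
  ∀ {k} (l : Vec ℕ k) → LengthVector (ribbon g w) l → HasValue θ (ribbon g w) (2 ℕ.+ length w) (k , l)
TI-ribbon θ bid g (t ∷ w) ch tame 4≤n l lv =
  subst (HasValue θ (ribbon g (t ∷ w)) (3 ℕ.+ length w)) (sym (lengthVector-runs g t w ch l lv))
    (subst (λ n → HasValue θ (ribbon g (t ∷ w)) (3 ℕ.+ n) (_ , Vec.map (3 ℕ.+_) (r ∷ rs))) (letters-run t w)
      (TI-runs g t w ch tame θ bid (subst (λ n → 4 ≤ 3 ℕ.+ n) (sym (letters-run t w)) 4≤n)))
  where
  r  = length (run t w)
  rs = Vec.fromList (laterRuns t w)
TI-ribbon θ bid g [] ch tame (s≤s (s≤s ()))

TI-chain : ∀ θ → IsBIDWeight θ → ∀ T → Chain T → MaxDegree≤ 5 T → 4 ≤ length T →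
  ∀ {k} (l : Vec ℕ k) → LengthVector T l → HasValue θ T (length T) (k , l)
TI-chain θ bid (c ∷ d ∷ cs) ch deg 4≤n {k} l lv =
  subst (λ n → HasValue θ T n (k , l)) (sym len)
    (subst (λ T → HasValue θ T (2 ℕ.+ length w) (k , l)) (sym eq)
      (TI-ribbon θ bid g w ch′ (maxDegree⇒tame g w ch′ (subst (MaxDegree≤ 5) eq deg))
        (subst (4 ≤_) len 4≤n) l (subst (λ T → LengthVector T l) eq lv)))
  where
  T = c ∷ d ∷ cs
  coded = chain⇒ribbon c d cs (unique ch) (thread ch)
  g = proj₁ coded
  w = proj₁ (proj₂ coded)
  eq : T ≡ ribbon g w
  eq = proj₂ (proj₂ coded)
  ch′ = subst Chain eq ch
  len : length T ≡ 2 ℕ.+ length w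
  len = trans (cong length eq) (length-ribbon g w)
TI-chain θ bid []       ch deg ()
TI-chain θ bid (_ ∷ []) ch deg (s≤s ())

theorem2p1 : (n : ℕ) → 4 ≤ n →
    (T : List Cell) → T ∈𝔗 n →
    {k : ℕ} (l : Vec ℕ (suc k)) → LengthVector T l →
    (θ : ℕ → ℕ → ℝ) → IsBIDWeight θ →
    TI θ T ≈ Formula.value θ n l
theorem2p1 n 4≤n T T∈ {k} l lv θ bid =
  subst (λ n → HasValue θ T n (suc k , l)) size
    (TI-chain θ bid T (triangularChain⇒chain chain) maxDegree (subst (4 ≤_) (sym size) 4≤n) l lv)
  where open _∈𝔗_ T∈
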